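{- Let $\Gamma=(G,\sigma)$ be a signed graph. Then $\Gamma$ has a symmetric spectrum if and only if $$\sum_{C\in \mathcal{H}_1^+}(-2)^{p(C)}M(G-C, x)=\sum_{C\in \mathcal{H}_1^- }(-2)^{p(C)}M(G-C, x)$$ as polynomials in $x$.
   Context: Graphs are finite and simple. A signed graph $\Gamma=(G,\sigma)$ consists of a connected simple graph $G$ (the underlying graph) and a function $\sigma:E(G)\to\{+1,-1\}$. Its adjacency matrix $A(\Gamma)$ has $(u,v)$-entry $\sigma(uv)$ if $uv\in E(G)$ and $0$ otherwise. The spectrum of $\Gamma$ is the multiset of eigenvalues of $A(\Gamma)$; it is symmetric if for each eigenvalue $\lambda$ of $A(\Gamma)$, $-\lambda$ is also an eigenvalue with the same multiplicity. For a subgraph $\Gamma'$ of $\Gamma$, $\sigma(\Gamma')=\prod_{e\in E(\Gamma')}\sigma(e)$. A 2-regular subgraph $H$ of $G$ is a (nonempty) vertex-disjoint union of cycles of $G$; $|H|$ is its number of vertices and $p(H)$ its number of components. $\mathcal{H}_1$ is the set of 2-regular subgraphs $H$ with $|H|$ odd, $\mathcal{H}_1^+=\{H\in\mathcal{H}_1\mid\sigma(H)=1\}$ and $\mathcal{H}_1^-=\{H\in\mathcal{H}_1\mid\sigma(H)=-1\}$. $G-C$ is the subgraph of $G$ induced by $V(G)\setminus V(C)$. The matching polynomial of a graph $K$ on $n$ vertices is $M(K,x)=\sum_{i=0}^{m(K)}(-1)^i m_i(K)x^{n-2i}$, where $m(K)$ is the size of a largest matching and $m_i(K)$ is the number of matchings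 of $K$ with exactly $i$ edges ($m_0(K)=1$; for the graph with no vertices $M=1$). -}

module Defs where

open import Algebra.Apartness using (HeytingCommutativeRing; HeytingField)
open import Algebra.Bundles using (CommutativeRing)
open import Algebra.Bundles.Raw using (RawRing)
import Algebra.Definitions.RawSemiring as SemiringDefinitions
open import Data.Bool.Base using (if_then_else_)
open import Data.Fin.Base as Fin using (Fin; zero; suc; toℕ; punchIn)
import Data.Fin.Properties as Fin
open import Data.Integer.Base as ℤ using (ℤ; +_; -[1+_]; 0ℤ; -1ℤ; _◃_)
open import Data.List.Base using (List; []; _∷_; _++_; map; foldr; filter; length; allFin; cartesianProduct; cartesianProductWith; upTo; deduplicate)
import Data.List.Membership.DecPropositional as DecMembership
open import Data.List.Relation.Unary.All using (All; all?)
open import Data.List.Relation.Unary.AllPairs using (AllPairs; allPairs?)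
open import Data.List.Relation.Unary.Any using (here; there)
open import Data.Nat.Base as ℕ using (ℕ; zero; suc; _∸_; _⊔_; _<_)
open import Data.Nat.Divisibility using (_∣?_) renaming (_∣_ to _∣ℕ_)
import Data.Nat.Properties as ℕ
open import Data.Product.Base using (_×_; _,_; ∃-syntax; Σ-syntax; proj₁; proj₂)
open import Data.Product.Properties using (≡-dec)
open import Data.Sign.Base as Sign using (Sign)
import Data.Sign.Properties as Sign
open import Data.Sum.Base using (_⊎_; inj₁; inj₂)
open import Level using (0ℓ; Level) renaming (suc to lsuc; _⊔_ to _⊔ˡ_)
open import Relation.Binary.Construct.Closure.ReflexiveTransitive using (Star; ε; _◅_; _◅◅_; gmap)
open import Relation.Binary.Core using (Rel)
open import Relation.Binary.Definitions using (Decidable; Symmetric; Irreflexive)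
open import Relation.Binary.PropositionalEquality using (_≡_; _≢_; refl)
open import Relation.Nullary.Decidable using (Dec; yes; no; does; ¬?; _×-dec_; _⊎-dec_; map′)
open import Relation.Nullary.Negation using (¬_)

private
  variable
    n : ℕ
    c ℓ ℓ₁ ℓ₂ : Level

-- A list is a polynomial with constant term first; trailing zeros are
-- allowed and disregarded by the equality.
module Polynomial (R : RawRing c ℓ) where
  open RawRing R

  Poly : Set c
  Poly = List Carrier

  coeff : Poly → ℕ → Carrier
  coeff []      k       = 0#
  coeff (a ∷ p) zero    = a
  coeff (a ∷ p) (suc k) = coeff p k

  infix 4 _≈ₚ_
  _≈ₚ_ : Rel Poly ℓ
  p ≈ₚ q = ∀ k → coeff p k ≈ coeff q k

  infixl 6 _+ₚ_
  _+ₚ_ : Poly → Poly → Poly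
  []      +ₚ q       = q
  (a ∷ p) +ₚ []      = a ∷ p
  (a ∷ p) +ₚ (b ∷ q) = (a + b) ∷ (p +ₚ q)

  infixl 7 _*ₚ_
  _*ₚ_ : Poly → Poly → Poly
  []      *ₚ q = []
  (a ∷ p) *ₚ q = map (a *_) q +ₚ (0# ∷ (p *ₚ q))

  polyRawRing : RawRing c ℓ
  polyRawRing = record
    { Carrier = Poly
    ; _≈_     = _≈ₚ_
    ; _+_     = _+ₚ_
    ; _*_     = _*ₚ_
    ; -_      = map (-_)
    ; 0#      = []
    ; 1#      = 1# ∷ []
    }

  const : Carrier → Poly
  const a = a ∷ []

  X : Poly
  X = 0# ∷ 1# ∷ []

  eval : Poly → Carrier → Carrier
  eval p x = foldr (λ a r → a + x * r) 0# p

  open SemiringDefinitions (RawRing.rawSemiring polyRawRing) public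
    using () renaming (_^_ to _^ₚ_; _∣_ to _∣ₚ_; _∤_ to _∤ₚ_)

  sumₚ : ∀ {a} {A : Set a} → (A → Poly) → List A → Poly
  sumₚ f xs = foldr (λ x s → f x +ₚ s) [] xs

module ℤ[X] = Polynomial ℤ.+-*-rawRing

module Determinant (R : RawRing c ℓ) where
  open RawRing R
  open SemiringDefinitions rawSemiring using (sum; _^_)

  det : (Fin n → Fin n → Carrier) → Carrier
  det {zero}  A = 1#
  det {suc n} A = sum λ j →
    (- 1#) ^ toℕ j * (A zero j * det (λ i k → A (suc i) (punchIn j k)))

module Spectrum (R : RawRing c ℓ) where
  open RawRing R
  open Polynomial R
  open Determinant polyRawRing using (det)
  open SemiringDefinitions rawSemiring using (sum)

  SquareMatrix : ℕ → Set c
  SquareMatrix n = Fin n → Fin n → Carrier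

  IsEigenvalue : SquareMatrix n → Carrier → Set (c ⊔ˡ ℓ)
  IsEigenvalue {n} A μ = Σ[ v ∈ (Fin n → Carrier) ]
    (∃[ i ] (v i ≉ 0#)) × (∀ i → sum (λ j → A i j * v j) ≈ μ * v i)

  -- The sign convention is det (x I - A), so this is monic.
  charPoly : SquareMatrix n → Poly
  charPoly A = det λ i j →
    (if does (i Fin.≟ j) then X else []) +ₚ const (- A i j)

  -- Algebraic multiplicity: the order of μ as a root of charPoly A.
  HasMultiplicity : SquareMatrix n → Carrier → ℕ → Set (c ⊔ˡ ℓ)
  HasMultiplicity A μ m =
      (X +ₚ const (- μ)) ^ₚ m ∣ₚ charPoly A
    × (X +ₚ const (- μ)) ^ₚ suc m ∤ₚ charPoly A

  SymmetricSpectrum : SquareMatrix n → Set (c ⊔ˡ ℓ)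
  SymmetricSpectrum A = ∀ μ → IsEigenvalue A μ →
    IsEigenvalue A (- μ) × (∃[ m ] HasMultiplicity A μ m × HasMultiplicity A (- μ) m)

-- Spectra are taken in a field of this kind (ℂ, say).  Decidability of
-- apartness makes it a field in the usual, discrete sense: each element is
-- zero or invertible.
record AlgebraicallyClosedField₀ c ℓ₁ ℓ₂ : Set (lsuc (c ⊔ˡ ℓ₁ ⊔ˡ ℓ₂)) where
  field
    heytingField : HeytingField c ℓ₁ ℓ₂
  open HeytingField heytingField public
  rawRing : RawRing c ℓ₁
  rawRing = CommutativeRing.rawRing (HeytingCommutativeRing.commutativeRing heytingCommutativeRing)
  open RawRing rawRing public using (_≉_)
  open SemiringDefinitions (RawRing.rawSemiring rawRing) public
    using () renaming (_×_ to _·_)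
  open Polynomial rawRing
  field
    _#?_ : Decidable _#_
    characteristic-zero : ∀ k → suc k · 1# ≉ 0#
    algebraically-closed : ∀ p k → coeff p (suc k) ≉ 0# → ∃[ x ] (eval p x ≈ 0#)

  fromℤ : ℤ → Carrier
  fromℤ (+ k)    = k · 1#
  fromℤ -[1+ k ] = - (suc k · 1#)

record SimpleGraph (n : ℕ) : Set₁ where
  infix 4 _~_ _~?_
  field
    _~_    : Rel (Fin n) 0ℓ
    sym    : Symmetric _~_
    irrefl : Irreflexive _≡_ _~_
    _~?_   : Decidable _~_

  Connected : Set
  Connected = ∀ u v → Star _~_ u v

-- The signature is given on ordered pairs of vertices; its values at
-- non-adjacent pairs are never used.
record SignedGraph (n : ℕ) : Set₁ where
  field
    graph     : SimpleGraph n
  open SimpleGraph graph public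
  field
    connected : Connected
    σ         : Fin n → Fin n → Sign
    σ-sym     : ∀ {u v} → u ~ v → σ u v ≡ σ v u

adjacencyMatrix : SignedGraph n → Fin n → Fin n → ℤ
adjacencyMatrix Γ u v = if does (u ~? v) then σ u v ◃ 1 else 0ℤ
  where open SignedGraph Γ

module _ (K : AlgebraicallyClosedField₀ c ℓ₁ ℓ₂) where
  open AlgebraicallyClosedField₀ K

  HasSymmetricSpectrum : SignedGraph n → Set (c ⊔ˡ ℓ₁)
  HasSymmetricSpectrum Γ =
    Spectrum.SymmetricSpectrum rawRing λ u v → fromℤ (adjacencyMatrix Γ u v)

-- Graphs whose vertices form a subset of Fin n, as needed for subgraphs and
-- for G - C.  Both lists are meant to be free of repetitions, and an edge is
-- recorded once, as the pair of its ends in increasing order.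
record VEGraph (n : ℕ) : Set where
  constructor ⟨_,_⟩
  field
    vertices : List (Fin n)
    edges    : List (Fin n × Fin n)

open VEGraph public

order : VEGraph n → ℕ
order K = length (vertices K)

module _ {n : ℕ} where
  open DecMembership (Fin._≟_ {n}) public using (_∈_; _∉_; _∈?_)
  open DecMembership (≡-dec (Fin._≟_ {n}) (Fin._≟_ {n})) public
    using () renaming (_∈_ to _∈ᴱ_; _∈?_ to _∈ᴱ?_)

toVE : SimpleGraph n → VEGraph n
toVE {n} G = ⟨ allFin n , filter (λ e → (proj₁ e Fin.<? proj₂ e) ×-dec (proj₁ e ~? proj₂ e)) (cartesianProduct (allFin n) (allFin n)) ⟩
  where open SimpleGraph G

infixl 6 _─_
_─_ : VEGraph n → List (Fin n) → VEGraph n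
K ─ S = ⟨ filter (λ v → ¬? (v ∈? S)) (vertices K)
        , filter (λ e → ¬? (proj₁ e ∈? S) ×-dec ¬? (proj₂ e ∈? S)) (edges K) ⟩

-- Of a list without repetitions, each subset appears exactly once.
sublists : ∀ {a} {A : Set a} → List A → List (List A)
sublists []       = [] ∷ []
sublists (x ∷ xs) = map (x ∷_) (sublists xs) ++ sublists xs

IsGraph : VEGraph n → Set
IsGraph H = All (λ e → proj₁ e ∈ vertices H × proj₂ e ∈ vertices H) (edges H)

isGraph? : (H : VEGraph n) → Dec (IsGraph H)
isGraph? H = all? (λ e → (proj₁ e ∈? vertices H) ×-dec (proj₂ e ∈? vertices H)) (edges H)

subgraphs : VEGraph n → List (VEGraph n)
subgraphs K = filter isGraph? (cartesianProductWith ⟨_,_⟩ (sublists (vertices K)) (sublists (edges K)))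

DisjointEdges : Rel (Fin n × Fin n) 0ℓ
DisjointEdges (u , v) (u′ , v′) = (u ≢ u′ × u ≢ v′) × (v ≢ u′ × v ≢ v′)

disjointEdges? : Decidable (DisjointEdges {n})
disjointEdges? (u , v) (u′ , v′) =
  (¬? (u Fin.≟ u′) ×-dec ¬? (u Fin.≟ v′)) ×-dec (¬? (v Fin.≟ u′) ×-dec ¬? (v Fin.≟ v′))

matchings : VEGraph n → List (List (Fin n × Fin n))
matchings K = filter (allPairs? disjointEdges?) (sublists (edges K))

matchingCount : VEGraph n → ℕ → ℕ
matchingCount K i = length (filter (λ F → length F ℕ.≟ i) (matchings K))

matchingNumber : VEGraph n → ℕ
matchingNumber K = foldr (λ F m → length F ⊔ m) 0 (matchings K)

matchingPoly : VEGraph n → ℤ[X].Poly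
matchingPoly K = sumₚ
  (λ i → const (-1ℤ ℤ.^ i ℤ.* + matchingCount K i) *ₚ X ^ₚ (order K ∸ 2 ℕ.* i))
  (upTo (suc (matchingNumber K)))
  where open ℤ[X]

Adjacent : List (Fin n × Fin n) → Rel (Fin n) 0ℓ
Adjacent E u v = (u , v) ∈ᴱ E ⊎ (v , u) ∈ᴱ E

Joined : List (Fin n × Fin n) → Rel (Fin n) 0ℓ
Joined E = Star (Adjacent E)

private
  Via : Fin n × Fin n → List (Fin n × Fin n) → Rel (Fin n) 0ℓ
  Via (a , b) E u v = (Joined E u v) ⊎ ((Joined E u a × Joined E b v) ⊎ (Joined E u b × Joined E a v))

  weaken : ∀ {e} {E : List (Fin n × Fin n)} {u v} → Joined E u v → Joined (e ∷ E) u v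
  weaken = gmap (λ x → x) λ { (inj₁ p) → inj₁ (there p) ; (inj₂ p) → inj₂ (there p) }

  fromVia : ∀ {e} {E : List (Fin n × Fin n)} {u v} → Via e E u v → Joined (e ∷ E) u v
  fromVia (inj₁ p)              = weaken p
  fromVia (inj₂ (inj₁ (p , q))) = weaken p ◅◅ (inj₁ (here refl) ◅ weaken q)
  fromVia (inj₂ (inj₂ (p , q))) = weaken p ◅◅ (inj₂ (here refl) ◅ weaken q)

  step : ∀ {e} {E : List (Fin n × Fin n)} {u w v} → Adjacent (e ∷ E) u w → Via e E w v → Via e E u v
  step (inj₁ (here refl)) (inj₁ q)              = inj₂ (inj₁ (ε , q))
  step (inj₁ (here refl)) (inj₂ (inj₁ (_ , q))) = inj₂ (inj₁ (ε , q))
  step (inj₁ (here refl)) (inj₂ (inj₂ (_ , q))) = inj₁ q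
  step (inj₂ (here refl)) (inj₁ q)              = inj₂ (inj₂ (ε , q))
  step (inj₂ (here refl)) (inj₂ (inj₁ (_ , q))) = inj₁ q
  step (inj₂ (here refl)) (inj₂ (inj₂ (_ , q))) = inj₂ (inj₂ (ε , q))
  step (inj₁ (there p))   q                     = prepend (inj₁ p) q
    where
    prepend : ∀ {e} {E : List (Fin n × Fin n)} {u w v} → Adjacent E u w → Via e E w v → Via e E u v
    prepend a (inj₁ q)              = inj₁ (a ◅ q)
    prepend a (inj₂ (inj₁ (q , r))) = inj₂ (inj₁ (a ◅ q , r))
    prepend a (inj₂ (inj₂ (q , r))) = inj₂ (inj₂ (a ◅ q , r))
  step (inj₂ (there p))   (inj₁ q)              = inj₁ (inj₂ p ◅ q)
  step (inj₂ (there p))   (inj₂ (inj₁ (q , r))) = inj₂ (inj₁ (inj₂ p ◅ q , r))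
  step (inj₂ (there p))   (inj₂ (inj₂ (q , r))) = inj₂ (inj₂ (inj₂ p ◅ q , r))

  toVia : ∀ {e} {E : List (Fin n × Fin n)} {u v} → Joined (e ∷ E) u v → Via e E u v
  toVia ε       = inj₁ ε
  toVia (a ◅ p) = step a (toVia p)

joined? : (E : List (Fin n × Fin n)) → Decidable (Joined E)
joined? [] u v = map′ (λ { refl → ε }) (λ { ε → refl ; (inj₁ () ◅ _) ; (inj₂ () ◅ _) }) (u Fin.≟ v)
joined? ((a , b) ∷ E) u v = map′ fromVia toVia
  (joined? E u v ⊎-dec ((joined? E u a ×-dec joined? E b v) ⊎-dec (joined? E u b ×-dec joined? E a v)))

-- One representative is kept from each class of vertices under Joined.
#components : VEGraph n → ℕ
#components H = length (deduplicate (joined? (edges H)) (vertices H))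

degree : VEGraph n → Fin n → ℕ
degree H v = length (filter (λ e → (v Fin.≟ proj₁ e) ⊎-dec (v Fin.≟ proj₂ e)) (edges H))

TwoRegular : VEGraph n → Set
TwoRegular H = 0 < order H × All (λ v → degree H v ≡ 2) (vertices H)

twoRegular? : (H : VEGraph n) → Dec (TwoRegular H)
twoRegular? H = (0 ℕ.<? order H) ×-dec all? (λ v → degree H v ℕ.≟ 2) (vertices H)

module _ (Γ : SignedGraph n) where
  open SignedGraph Γ

  sign : VEGraph n → Sign
  sign H = foldr (λ e s → σ (proj₁ e) (proj₂ e) Sign.* s) Sign.+ (edges H)

  𝓗₁ : List (VEGraph n)
  𝓗₁ = filter (λ H → twoRegular? H ×-dec ¬? (2 ∣? order H)) (subgraphs (toVE graph))

  𝓗₁⁺ : List (VEGraph n)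
  𝓗₁⁺ = filter (λ H → sign H Sign.≟ Sign.+) 𝓗₁

  𝓗₁⁻ : List (VEGraph n)
  𝓗₁⁻ = filter (λ H → sign H Sign.≟ Sign.-) 𝓗₁

  M[G-_] : VEGraph n → ℤ[X].Poly
  M[G- H ] = matchingPoly (toVE graph ─ vertices H)

{-# OPTIONS --safe #-}
module Submission where

-- Let φ = det (x I - A).  The spectrum is symmetric iff φ (x) = (-1)ⁿ φ (- x): the
-- eigenvalues are the roots of φ, and a monic polynomial over an algebraically
-- closed field is determined by its roots with multiplicities.  By multilinearity
-- in the rows, φ expands along the edges, each of them being unused, used in one
-- direction or used in both.  The edges used in both directions form a matching;
-- those used in one direction form directed cycles, and contracting edges one at a
-- time shows that the orientations of a 2-regular subgraph H contribute
-- σ (H) (-2)^p(H) in total.  Hence φ is the sum of σ (H) (-2)^p(H) M (G - H , x) over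
-- all 2-regular H, the empty one included.  As M (G - H , x) has the parity of
-- n - |H|, the terms with |H| odd are the part of φ that violates the symmetry, so
-- the spectrum is symmetric iff they add up to zero.

open import Defs
open import Algebra.Apartness using (HeytingCommutativeRing)
open import Algebra.Bundles using (CommutativeRing; RawRing; Semiring)
import Algebra.Definitions.RawSemiring as SemiringDefinitions
open import Algebra.Morphism.Structures using (IsRingHomomorphism)
import Algebra.Properties.CommutativeSemigroup as CommutativeSemigroupProperties
import Algebra.Properties.CommutativeSemiring.Exp as CommutativeSemiringExp
import Algebra.Properties.Monoid.Mult.TCOptimised as TCOptimised
import Algebra.Properties.Ring as RingProperties
import Algebra.Properties.Semiring.Divisibility as SemiringDivisibility
import Algebra.Properties.Semiring.Exp as SemiringExp
import Algebra.Properties.Semiring.Mult as SemiringMult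
import Algebra.Properties.Semiring.Sum as SemiringSum
import Algebra.Solver.Ring as RingSolver
open import Algebra.Solver.Ring.AlmostCommutativeRing using (fromCommutativeRing; _-Raw-AlmostCommutative⟶_)
open import Data.Bool.Base using (true; false; if_then_else_)
open import Data.Fin.Base as Fin using (Fin; zero; suc; toℕ; punchIn; punchOut; inject₁)
open import Data.Fin.Permutation.Components using (transpose)
import Data.Fin.Properties as Fin
open import Data.Integer.Base as ℤ using (ℤ; +_; -[1+_]; 0ℤ; 1ℤ; -1ℤ; _◃_; _⊖_)
import Data.Integer.Properties as ℤ
open import Data.List.Base using (List; []; _∷_; map; length; _++_; filter; foldr; deduplicate; allFin; cartesianProduct; cartesianProductWith; upTo; applyUpTo)
import Data.List.Membership.Propositional as Membership
open import Data.List.Membership.Propositional.Properties using (∈-∃++; ∈-++⁺ˡ; ∈-++⁺ʳ; ∈-++⁻; ∈-filter⁺; ∈-filter⁻; ∈-deduplicate⁻; ∈-map⁻; ∈-map⁺; ∈-allFin)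
open import Data.List.Properties using (length-++; length-map; length-tabulate; ++-identityʳ; filter-accept; filter-reject; ≡-dec; ∷-injectiveʳ)
open import Data.List.Relation.Binary.Permutation.Propositional as Perm using (_↭_)
import Data.List.Relation.Binary.Permutation.Propositional.Properties as Perm
open import Data.List.Relation.Unary.All as All using (All; []; _∷_; all?)
import Data.List.Relation.Unary.All.Properties as All
open import Data.List.Relation.Unary.AllPairs as AllPairs using (AllPairs; []; _∷_; allPairs?)
import Data.List.Relation.Unary.AllPairs.Properties as AllPairs
open import Data.List.Relation.Unary.Any using (here; there)
open import Data.List.Relation.Unary.Unique.Propositional using (Unique)
import Data.List.Relation.Unary.Unique.Propositional.Properties as Unique
open import Data.Maybe.Base as Maybe using (Maybe)
open import Data.Nat.Base as ℕ using (ℕ; zero; suc; _<_; _≤_; z≤n; s≤s; _∸_)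
open import Data.Nat.Divisibility using (_∣?_; divides) renaming (_∣_ to _∣ℕ_)
import Data.Nat.Properties as ℕ
open import Data.Product.Base using (_×_; _,_; ∃-syntax; Σ-syntax; proj₁; proj₂)
open import Data.Sign.Base as Sign using (Sign)
import Data.Sign.Properties as Sign
open import Data.Sum.Base using (_⊎_; inj₁; inj₂; [_,_]′; swap)
open import Data.Unit.Base using (tt)
open import Function.Base using (_∘_; id; case_of_)
open import Function.Bundles using (_⇔_; mk⇔)
open import Level using (_⊔_)
open import Relation.Binary.Construct.Closure.ReflexiveTransitive as Star using (ε; _◅_; _◅◅_)
open import Relation.Binary.Definitions using (tri<; tri≈; tri>)
open import Relation.Binary.PropositionalEquality as ≡ using (_≡_; _≢_; _≗_)
import Relation.Binary.Reasoning.Setoid as SetoidReasoning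
open import Relation.Nullary.Decidable using (Dec; yes; no; does; dec-true; dec-false; dec⇒maybe; ¬?; _×-dec_; _⊎-dec_)
open import Relation.Nullary.Negation using (¬_; contradiction)
open import Relation.Unary using (Decidable)

-- `det` is defined by recursion along the first row, and no permutation is ever enumerated. A list
-- of arcs stands for the choice of an entry in some of the rows, and `sgn` of its successor map,
-- itself a determinant, is zero unless that map is bijective; choices that are not permutations
-- vanish by themselves. A k-cycle has sign (-1)^(k-1), so the factor (-1)^length leaves -1 per
-- cycle. Contracting an edge keeps the orientation sum because at most one of its two directions
-- continues the path through it; a cycle ends as a loop, which counts -1 in each direction, whence
-- the -2. For this induction 2-regularity is stated for edge lists with loops and repetitions. The
-- expansion takes place in any commutative ring with an element `x` and edge weights of square one,
-- and is applied to ℤ[X]; only the statement about roots needs the field, and characteristic zero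
-- joins the two. Replacing x by - x is a ring endomorphism acting on each term by a sign; symmetry
-- gives that twice the odd part is zero, and 2 is cancelled in ℤ.

-- Integer multiples of one in a commutative ring

module IntegerScalars {c ℓ} (R : CommutativeRing c ℓ) where
  open CommutativeRing R
  open RingProperties ring
  open SemiringDefinitions (Semiring.rawSemiring semiring) using () renaming (_×_ to _·_; _×′_ to _·′_)
  open SemiringMult semiring using (×-homo-+; ×1-homo-*)
  open SetoidReasoning setoid

  ⟦_⟧ : ℤ → Carrier
  ⟦ + k ⟧      = k · 1#
  ⟦ -[1+ k ] ⟧ = - (suc k · 1#)

  ⊖-homo : ∀ m n → ⟦ m ⊖ n ⟧ ≈ m · 1# - n · 1#
  ⊖-homo m       zero    = sym (trans (+-congˡ -0#≈0#) (+-identityʳ _))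
  ⊖-homo zero    (suc n) = sym (+-identityˡ _)
  ⊖-homo (suc m) (suc n) = begin
    ⟦ suc m ⊖ suc n ⟧                      ≡⟨ ≡.cong ⟦_⟧ (ℤ.[1+m]⊖[1+n]≡m⊖n m n) ⟩
    ⟦ m ⊖ n ⟧                              ≈⟨ ⊖-homo m n ⟩
    m · 1# - n · 1#                        ≈⟨ +-congʳ (+-identityˡ _) ⟨
    (0# + m · 1#) - n · 1#                 ≈⟨ +-congʳ (+-congʳ (-‿inverseʳ 1#)) ⟨
    ((1# - 1#) + m · 1#) - n · 1#          ≈⟨ +-congʳ (trans (+-assoc _ _ _) (trans (+-congˡ (+-comm _ _)) (sym (+-assoc _ _ _)))) ⟩
    ((1# + m · 1#) - 1#) - n · 1#          ≈⟨ +-assoc _ _ _ ⟩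
    (1# + m · 1#) + (- 1# - n · 1#)        ≈⟨ +-congˡ (-‿+-comm 1# (n · 1#)) ⟩
    suc m · 1# - suc n · 1#                ∎

  neg-homo : ∀ i → ⟦ ℤ.- i ⟧ ≈ - ⟦ i ⟧
  neg-homo (+ zero)  = sym -0#≈0#
  neg-homo (+ suc k) = refl
  neg-homo -[1+ k ]  = sym (-‿involutive _)

  +-homo : ∀ i j → ⟦ i ℤ.+ j ⟧ ≈ ⟦ i ⟧ + ⟦ j ⟧
  +-homo (+ m)    (+ n)    = ×-homo-+ 1# m n
  +-homo (+ m)    -[1+ n ] = ⊖-homo m (suc n)
  +-homo -[1+ m ] (+ n)    = trans (⊖-homo n (suc m)) (+-comm _ _)
  +-homo -[1+ m ] -[1+ n ] = begin
    - (suc (suc (m ℕ.+ n)) · 1#)          ≡⟨ ≡.cong (λ k → - (k · 1#)) (≡.sym (ℕ.+-suc (suc m) n)) ⟩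
    - ((suc m ℕ.+ suc n) · 1#)            ≈⟨ -‿cong (×-homo-+ 1# (suc m) (suc n)) ⟩
    - (suc m · 1# + suc n · 1#)           ≈⟨ -‿+-comm _ _ ⟨
    - (suc m · 1#) - suc n · 1#           ∎

  -x*-y : ∀ x y → - x * - y ≈ x * y
  -x*-y x y = trans (sym (-‿distribˡ-* _ _)) (trans (-‿cong (sym (-‿distribʳ-* _ _))) (-‿involutive _))

  -◃-homo : ∀ k → ⟦ Sign.- ◃ k ⟧ ≈ - (k · 1#)
  -◃-homo zero    = sym -0#≈0#
  -◃-homo (suc k) = refl

  +◃-homo : ∀ k → ⟦ Sign.+ ◃ k ⟧ ≈ k · 1#
  +◃-homo zero    = refl
  +◃-homo (suc k) = refl

  *-homo : ∀ i j → ⟦ i ℤ.* j ⟧ ≈ ⟦ i ⟧ * ⟦ j ⟧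
  *-homo (+ m)    (+ n)    = trans (+◃-homo (m ℕ.* n)) (×1-homo-* m n)
  *-homo (+ m)    -[1+ n ] = trans (-◃-homo (m ℕ.* suc n)) (trans (-‿cong (×1-homo-* m (suc n))) (-‿distribʳ-* _ _))
  *-homo -[1+ m ] (+ n)    = trans (-◃-homo (suc m ℕ.* n)) (trans (-‿cong (×1-homo-* (suc m) n)) (-‿distribˡ-* _ _))
  *-homo -[1+ m ] -[1+ n ] = trans (+◃-homo (suc m ℕ.* suc n)) (trans (×1-homo-* (suc m) (suc n)) (sym (-x*-y _ _)))

  1-homo : ⟦ 1ℤ ⟧ ≈ 1#
  1-homo = +-identityʳ 1#

  private
    solverRing = fromCommutativeRing R

    -- Coefficients for the ring solver. With `·′` the integers 0 and 1 reduce to `0#` and `1#`,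
    -- whereas `1 · 1#` is `1# + 0#`; so `0-homo` and `1-homo` hold by `refl`.
    ⟦_⟧′ : ℤ → Carrier
    ⟦ + k ⟧′      = k ·′ 1#
    ⟦ -[1+ k ] ⟧′ = - (suc k ·′ 1#)

    ⟦⟧′≈⟦⟧ : ∀ i → ⟦ i ⟧′ ≈ ⟦ i ⟧
    ⟦⟧′≈⟦⟧ (+ k)    = sym (TCOptimised.×ᵤ≈× +-monoid k 1#)
    ⟦⟧′≈⟦⟧ -[1+ k ] = -‿cong (sym (TCOptimised.×ᵤ≈× +-monoid (suc k) 1#))

    morphism : ℤ.+-*-rawRing -Raw-AlmostCommutative⟶ solverRing
    morphism = record
      { ⟦_⟧    = ⟦_⟧′
      ; +-homo = λ i j → trans (⟦⟧′≈⟦⟧ (i ℤ.+ j)) (trans (+-homo i j) (sym (+-cong (⟦⟧′≈⟦⟧ i) (⟦⟧′≈⟦⟧ j))))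
      ; *-homo = λ i j → trans (⟦⟧′≈⟦⟧ (i ℤ.* j)) (trans (*-homo i j) (sym (*-cong (⟦⟧′≈⟦⟧ i) (⟦⟧′≈⟦⟧ j))))
      ; -‿homo = λ i → trans (⟦⟧′≈⟦⟧ (ℤ.- i)) (trans (neg-homo i) (-‿cong (sym (⟦⟧′≈⟦⟧ i))))
      ; 0-homo = refl
      ; 1-homo = refl
      }

    ⟦⟧′-≟ : ∀ i j → Maybe (⟦ i ⟧′ ≈ ⟦ j ⟧′)
    ⟦⟧′-≟ i j = Maybe.map (λ { ≡.refl → refl }) (dec⇒maybe (i ℤ.≟ j))

  module Solver = RingSolver ℤ.+-*-rawRing solverRing morphism ⟦⟧′-≟

-- Determinants

transposeˡ : ∀ {n} (p q : Fin n) → transpose p q p ≡ q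
transposeˡ p q rewrite dec-true (p Fin.≟ p) ≡.refl = ≡.refl

transposeʳ : ∀ {n} (p q : Fin n) → transpose p q q ≡ p
transposeʳ p q with q Fin.≟ p
... | yes q≡p = q≡p
... | no  _ rewrite dec-true (q Fin.≟ q) ≡.refl = ≡.refl

transpose-≢ : ∀ {n} {p q k : Fin n} → k ≢ p → k ≢ q → transpose p q k ≡ k
transpose-≢ {p = p} {q} {k} k≢p k≢q
  rewrite dec-false (k Fin.≟ p) k≢p | dec-false (k Fin.≟ q) k≢q = ≡.refl

transpose-involutive : ∀ {n} (p q k : Fin n) → transpose p q (transpose p q k) ≡ k
transpose-involutive p q k with k Fin.≟ p
... | yes ≡.refl = transposeʳ p q
... | no k≢p with k Fin.≟ q
...   | yes ≡.refl = transposeˡ p q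
...   | no k≢q = transpose-≢ k≢p k≢q

-- Deleting a column other than the neighbours `k` and `k + 1` leaves them neighbours. This keeps
-- the induction in `alternating-adjacent` within adjacent pairs.
adjacent? : ∀ {n} (k : Fin (suc n)) (j : Fin (suc (suc n))) →
  j ≡ inject₁ k ⊎ j ≡ suc k ⊎
  ∃[ l ] (punchIn j (inject₁ l) ≡ inject₁ k × punchIn j (suc l) ≡ suc k)
adjacent? zero zero = inj₁ ≡.refl
adjacent? zero (suc zero) = inj₂ (inj₁ ≡.refl)
adjacent? {suc n} zero (suc (suc j)) = inj₂ (inj₂ (zero , ≡.refl , ≡.refl))
adjacent? {suc n} (suc k) zero = inj₂ (inj₂ (k , ≡.refl , ≡.refl))
adjacent? {suc n} (suc k) (suc j) with adjacent? k j
... | inj₁ eq = inj₁ (≡.cong suc eq)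
... | inj₂ (inj₁ eq) = inj₂ (inj₁ (≡.cong suc eq))
... | inj₂ (inj₂ (l , eq , eq′)) = inj₂ (inj₂ (suc l , ≡.cong suc eq , ≡.cong suc eq′))

-- Deleting one or the other of two neighbouring columns leaves the same columns in the same places,
-- except for the survivor of the pair. If the two columns are equal, so are the minors.
punchIn-adjacent : ∀ {n} (k l : Fin n) → punchIn (inject₁ k) l ≡ punchIn (suc k) l ⊎
  (punchIn (inject₁ k) l ≡ suc k × punchIn (suc k) l ≡ inject₁ k)
punchIn-adjacent zero zero = inj₂ (≡.refl , ≡.refl)
punchIn-adjacent zero (suc l) = inj₁ ≡.refl
punchIn-adjacent (suc k) zero = inj₁ ≡.refl
punchIn-adjacent (suc k) (suc l) with punchIn-adjacent k l
... | inj₁ eq = inj₁ (≡.cong suc eq)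
... | inj₂ (eq , eq′) = inj₂ (≡.cong suc eq , ≡.cong suc eq′)

≢⇒punchIn : ∀ {n} {i j : Fin (suc n)} → i ≢ j → ∃[ k ] punchIn i k ≡ j
≢⇒punchIn i≢j = punchOut i≢j , Fin.punchIn-punchOut i≢j

module DeterminantTheory {c ℓ} (R : CommutativeRing c ℓ) where
  open CommutativeRing R hiding (zero)
  open RingProperties ring
  open Determinant rawRing public using (det)
  open SemiringDefinitions (Semiring.rawSemiring semiring) using (_^_)
  open SemiringSum semiring
  open IntegerScalars R
  open Solver using (solve; _:=_; _:+_; _:*_)
  open SetoidReasoning setoid

  Mat : ℕ → Set c
  Mat n = Fin n → Fin n → Carrier

  minor : ∀ {n} → Mat (suc n) → Fin (suc n) → Mat n
  minor M j i k = M (suc i) (punchIn j k)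

  laplaceTerm : ∀ {n} → Mat (suc n) → Fin (suc n) → Carrier
  laplaceTerm M j = (- 1#) ^ toℕ j * (M zero j * det (minor M j))

  sum-zero : ∀ {n} {f : Fin n → Carrier} → (∀ i → f i ≈ 0#) → sum f ≈ 0#
  sum-zero {n} f≈0 = trans (sum-cong-≋ f≈0) (sum-replicate-zero n)

  sum-single : ∀ {n} {f : Fin n → Carrier} (j : Fin n) → (∀ i → i ≢ j → f i ≈ 0#) → sum f ≈ f j
  sum-single {suc n} {f} j f≈0 = trans (sum-remove {i = j} f)
    (trans (+-congˡ (sum-zero λ i → f≈0 (punchIn j i) (Fin.punchInᵢ≢i j i))) (+-identityʳ _))

  sum-linear : ∀ {n} a b (f g : Fin n → Carrier) →
    sum (λ i → a * f i + b * g i) ≈ a * sum f + b * sum g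
  sum-linear a b f g = trans (∑-distrib-+ (λ i → a * f i) (λ i → b * g i))
    (+-cong (sym (*-distribˡ-sum a f)) (sym (*-distribˡ-sum b g)))

  sum-adjacent : ∀ {n} {f : Fin (suc n) → Carrier} (k : Fin n) →
    (∀ j → j ≢ inject₁ k → j ≢ suc k → f j ≈ 0#) → sum f ≈ f (inject₁ k) + f (suc k)
  sum-adjacent {suc n} zero f≈0 = +-congˡ
    (trans (+-congˡ (sum-zero λ j → f≈0 (suc (suc j)) (λ ()) (λ ()))) (+-identityʳ _))
  sum-adjacent {suc n} (suc k) f≈0 = trans
    (+-cong (f≈0 zero (λ ()) (λ ()))
      (sum-adjacent k λ j j≢ j≢′ → f≈0 (suc j) (j≢ ∘ Fin.suc-injective) (j≢′ ∘ Fin.suc-injective)))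
    (+-identityˡ _)

  det-cong : ∀ {n} {M N : Mat n} → (∀ i j → M i j ≈ N i j) → det M ≈ det N
  det-cong {zero} M≈N = refl
  det-cong {suc n} M≈N = sum-cong-≋ λ j → *-congˡ {(- 1#) ^ toℕ j} (*-cong (M≈N zero j)
    (det-cong λ i k → M≈N (suc i) (punchIn j k)))

  private
    linear-entry : ∀ s a m b n d → s * ((a * m + b * n) * d) ≈ a * (s * (m * d)) + b * (s * (n * d))
    linear-entry = solve 6 (λ s a m b n d → s :* ((a :* m :+ b :* n) :* d) := a :* (s :* (m :* d)) :+ b :* (s :* (n :* d))) refl

    linear-minor : ∀ s l a m b n → s * (l * (a * m + b * n)) ≈ a * (s * (l * m)) + b * (s * (l * n))
    linear-minor = solve 6 (λ s l a m b n → s :* (l :* (a :* m :+ b :* n)) := a :* (s :* (l :* m)) :+ b :* (s :* (l :* n))) refl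

  -- Three matrices are compared entry by entry, instead of one being updated in a row, so that each
  -- use may present its matrices as it likes. For row zero linearity comes from the entries, for
  -- lower rows from the minors.
  det-row-linear : ∀ {n} (u : Fin n) {a b} {L M N : Mat n} →
    (∀ i → i ≢ u → ∀ j → L i j ≈ M i j) → (∀ i → i ≢ u → ∀ j → L i j ≈ N i j) →
    (∀ j → L u j ≈ a * M u j + b * N u j) → det L ≈ a * det M + b * det N
  det-row-linear {suc n} zero {a} {b} {L} {M} {N} L≈M L≈N lin = trans
    (sum-cong-≋ λ j → begin
      laplaceTerm L j
        ≈⟨ *-congˡ (*-congʳ (lin j)) ⟩
      (- 1#) ^ toℕ j * ((a * M zero j + b * N zero j) * det (minor L j))
        ≈⟨ linear-entry _ _ _ _ _ _ ⟩
      a * ((- 1#) ^ toℕ j * (M zero j * det (minor L j))) + b * ((- 1#) ^ toℕ j * (N zero j * det (minor L j)))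
        ≈⟨ +-cong (*-congˡ (*-congˡ (*-congˡ (det-cong λ i k → L≈M (suc i) (λ ()) (punchIn j k)))))
                  (*-congˡ (*-congˡ (*-congˡ (det-cong λ i k → L≈N (suc i) (λ ()) (punchIn j k))))) ⟩
      a * laplaceTerm M j + b * laplaceTerm N j ∎)
    (sum-linear a b (laplaceTerm M) (laplaceTerm N))
  det-row-linear {suc n} (suc u) {a} {b} {L} {M} {N} L≈M L≈N lin = trans
    (sum-cong-≋ λ j → begin
      laplaceTerm L j
        ≈⟨ *-congˡ (*-congˡ (det-row-linear u
             (λ i i≢u k → L≈M (suc i) (i≢u ∘ Fin.suc-injective) (punchIn j k))
             (λ i i≢u k → L≈N (suc i) (i≢u ∘ Fin.suc-injective) (punchIn j k))
             (λ k → lin (punchIn j k)))) ⟩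
      (- 1#) ^ toℕ j * (L zero j * (a * det (minor M j) + b * det (minor N j)))
        ≈⟨ linear-minor _ _ _ _ _ _ ⟩
      a * ((- 1#) ^ toℕ j * (L zero j * det (minor M j))) + b * ((- 1#) ^ toℕ j * (L zero j * det (minor N j)))
        ≈⟨ +-cong (*-congˡ (*-congˡ (*-congʳ (L≈M zero (λ ()) j)))) (*-congˡ (*-congˡ (*-congʳ (L≈N zero (λ ()) j)))) ⟩
      a * laplaceTerm M j + b * laplaceTerm N j ∎)
    (sum-linear a b (laplaceTerm M) (laplaceTerm N))

  det-col-linear : ∀ {n} (v : Fin n) {a b} {L M N : Mat n} →
    (∀ i j → j ≢ v → L i j ≈ M i j) → (∀ i j → j ≢ v → L i j ≈ N i j) →
    (∀ i → L i v ≈ a * M i v + b * N i v) → det L ≈ a * det M + b * det N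
  det-col-linear {suc n} v {a} {b} {L} {M} {N} L≈M L≈N lin = trans
    (sum-cong-≋ term) (sum-linear a b (laplaceTerm M) (laplaceTerm N))
    where
    term : ∀ j → laplaceTerm L j ≈ a * laplaceTerm M j + b * laplaceTerm N j
    term j with j Fin.≟ v
    ... | yes ≡.refl = begin
      laplaceTerm L j
        ≈⟨ *-congˡ (*-congʳ (lin zero)) ⟩
      (- 1#) ^ toℕ j * ((a * M zero j + b * N zero j) * det (minor L j))
        ≈⟨ linear-entry _ _ _ _ _ _ ⟩
      a * ((- 1#) ^ toℕ j * (M zero j * det (minor L j))) + b * ((- 1#) ^ toℕ j * (N zero j * det (minor L j)))
        ≈⟨ +-cong (*-congˡ (*-congˡ (*-congˡ (det-cong λ i k → L≈M (suc i) (punchIn j k) (Fin.punchInᵢ≢i j k)))))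
                  (*-congˡ (*-congˡ (*-congˡ (det-cong λ i k → L≈N (suc i) (punchIn j k) (Fin.punchInᵢ≢i j k))))) ⟩
      a * laplaceTerm M j + b * laplaceTerm N j ∎
    ... | no j≢v with ≢⇒punchIn j≢v
    ...   | w , ≡.refl = begin
      laplaceTerm L j
        ≈⟨ *-congˡ (*-congˡ (det-col-linear w
             (λ i k k≢w → L≈M (suc i) (punchIn j k) (k≢w ∘ Fin.punchIn-injective j k w))
             (λ i k k≢w → L≈N (suc i) (punchIn j k) (k≢w ∘ Fin.punchIn-injective j k w))
             (λ i → lin (suc i)))) ⟩
      (- 1#) ^ toℕ j * (L zero j * (a * det (minor M j) + b * det (minor N j)))
        ≈⟨ linear-minor _ _ _ _ _ _ ⟩
      a * ((- 1#) ^ toℕ j * (L zero j * det (minor M j))) + b * ((- 1#) ^ toℕ j * (L zero j * det (minor N j)))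
        ≈⟨ +-cong (*-congˡ (*-congˡ (*-congʳ (L≈M zero j j≢v)))) (*-congˡ (*-congˡ (*-congʳ (L≈N zero j j≢v)))) ⟩
      a * laplaceTerm M j + b * laplaceTerm N j ∎

  private
    0x+0y : ∀ {x y} → 0# * x + 0# * y ≈ 0#
    0x+0y = trans (+-cong (zeroˡ _) (zeroˡ _)) (+-identityʳ _)

  -- A zero row equals `0# * M u j + 0# * M u j`, so linearity in that row applies with `M` in all
  -- three places.
  det-zero-row : ∀ {n} (u : Fin n) {M : Mat n} → (∀ j → M u j ≈ 0#) → det M ≈ 0#
  det-zero-row u {M} Mu≈0 = trans
    (det-row-linear u {0#} {0#} {M} {M} {M} (λ _ _ _ → refl) (λ _ _ _ → refl) (λ j → trans (Mu≈0 j) (sym 0x+0y)))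
    0x+0y

  det-zero-col : ∀ {n} (v : Fin n) {M : Mat n} → (∀ i → M i v ≈ 0#) → det M ≈ 0#
  det-zero-col v {M} Mv≈0 = trans
    (det-col-linear v {0#} {0#} {M} {M} {M} (λ _ _ _ → refl) (λ _ _ _ → refl) (λ i → trans (Mv≈0 i) (sym 0x+0y)))
    0x+0y

  private
    term-entry≈0 : ∀ {n} (M : Mat (suc n)) {j} → M zero j ≈ 0# → laplaceTerm M j ≈ 0#
    term-entry≈0 M M≈0 = trans (*-congˡ (trans (*-congʳ M≈0) (zeroˡ _))) (zeroʳ _)

    term-minor≈0 : ∀ {n} (M : Mat (suc n)) {j} → det (minor M j) ≈ 0# → laplaceTerm M j ≈ 0#
    term-minor≈0 M d≈0 = trans (*-congˡ (trans (*-congˡ d≈0) (zeroʳ _))) (zeroʳ _)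

  -- Alternation is proved below for columns only. Of proportional rows just this case is needed,
  -- and it passes to minors: either the common column `v` survives, or its deletion leaves a zero
  -- row.
  det-two-rows-one-col : ∀ {n} {u w v : Fin n} {M : Mat n} → u ≢ w →
    (∀ j → j ≢ v → M u j ≈ 0#) → (∀ j → j ≢ v → M w j ≈ 0#) → det M ≈ 0#
  det-two-rows-one-col {u = zero} {zero} u≢w _ _ = contradiction ≡.refl u≢w
  det-two-rows-one-col {suc n} {zero} {suc w} {v} {M} _ Mu Mw = sum-zero term
    where
    term : ∀ j → laplaceTerm M j ≈ 0#
    term j with j Fin.≟ v
    ... | no j≢v = term-entry≈0 M (Mu j j≢v)
    ... | yes ≡.refl = term-minor≈0 M (det-zero-row w (λ k → Mw (punchIn v k) (Fin.punchInᵢ≢i v k)))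
  det-two-rows-one-col {suc n} {suc u} {zero} {v} {M} _ Mu Mw = sum-zero term
    where
    term : ∀ j → laplaceTerm M j ≈ 0#
    term j with j Fin.≟ v
    ... | no j≢v = term-entry≈0 M (Mw j j≢v)
    ... | yes ≡.refl = term-minor≈0 M (det-zero-row u (λ k → Mu (punchIn v k) (Fin.punchInᵢ≢i v k)))
  det-two-rows-one-col {suc n} {suc u} {suc w} {v} {M} u≢w Mu Mw = sum-zero term
    where
    term : ∀ j → laplaceTerm M j ≈ 0#
    term j with j Fin.≟ v
    ... | yes ≡.refl = term-minor≈0 M (det-zero-row u (λ k → Mu (punchIn v k) (Fin.punchInᵢ≢i v k)))
    ... | no j≢v with ≢⇒punchIn j≢v
    ...   | v′ , ≡.refl = term-minor≈0 M (det-two-rows-one-col {v = v′} (u≢w ∘ ≡.cong suc)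
            (λ k k≢v′ → Mu (punchIn j k) (k≢v′ ∘ Fin.punchIn-injective j k v′))
            (λ k k≢v′ → Mw (punchIn j k) (k≢v′ ∘ Fin.punchIn-injective j k v′)))

  Alternating : ∀ {n} → Fin n → Fin n → Set _
  Alternating {n} p q = ∀ (M : Mat n) → (∀ i → M i p ≈ M i q) → det M ≈ 0#

  -- A term that deletes any other column has a minor with the same repetition. The two remaining
  -- terms have equal entries and equal minors, and their signs are consecutive powers of -1.
  alternating-adjacent : ∀ {n} (k : Fin n) → Alternating (inject₁ k) (suc k)
  alternating-adjacent {suc n} k M Mk≈ = begin
    det M                                                 ≈⟨ sum-adjacent k others ⟩
    laplaceTerm M (inject₁ k) + laplaceTerm M (suc k)     ≈⟨ +-congʳ (*-cong s-inject₁ (*-cong (Mk≈ zero) (det-cong minors))) ⟩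
    s * (m * d) + (- 1# * s) * (m * d)                    ≈⟨ +-congˡ (trans (*-congʳ (-1*x≈-x s)) (sym (-‿distribˡ-* s _))) ⟩
    s * (m * d) - s * (m * d)                             ≈⟨ -‿inverseʳ _ ⟩
    0#                                                    ∎
    where
    s = (- 1#) ^ toℕ k
    m = M zero (suc k)
    d = det (minor M (suc k))

    s-inject₁ : (- 1#) ^ toℕ (inject₁ k) ≈ s
    s-inject₁ = reflexive (≡.cong ((- 1#) ^_) (Fin.toℕ-inject₁ k))

    minors : ∀ i l → minor M (inject₁ k) i l ≈ minor M (suc k) i l
    minors i l with punchIn-adjacent k l
    ... | inj₁ eq = reflexive (≡.cong (M (suc i)) eq)
    ... | inj₂ (eq , eq′) = trans (reflexive (≡.cong (M (suc i)) eq))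
            (trans (sym (Mk≈ (suc i))) (reflexive (≡.cong (M (suc i)) (≡.sym eq′))))

    others : ∀ j → j ≢ inject₁ k → j ≢ suc k → laplaceTerm M j ≈ 0#
    others j j≢ j≢′ with adjacent? k j
    ... | inj₁ eq = contradiction eq j≢
    ... | inj₂ (inj₁ eq) = contradiction eq j≢′
    others j _ _ | inj₂ (inj₂ (l , eq , eq′)) = term-minor≈0 M (alternating-adjacent l (minor M j) λ i →
      trans (reflexive (≡.cong (M (suc i)) eq)) (trans (Mk≈ (suc i)) (reflexive (≡.cong (M (suc i)) (≡.sym eq′)))))

  module _ {n} {p q : Fin n} (p≢q : p ≢ q) (alt : Alternating p q) where

    private
      withCols : Mat n → (x y : Fin n → Carrier) → Mat n
      withCols M x y i j = if does (j Fin.≟ p) then x i else if does (j Fin.≟ q) then y i else M i j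

      withCols-p : ∀ M x y i → withCols M x y i p ≡ x i
      withCols-p M x y i rewrite dec-true (p Fin.≟ p) ≡.refl = ≡.refl

      withCols-q : ∀ M x y i → withCols M x y i q ≡ y i
      withCols-q M x y i rewrite dec-false (q Fin.≟ p) (p≢q ∘ ≡.sym) | dec-true (q Fin.≟ q) ≡.refl = ≡.refl

      withCols-≢p : ∀ M x x′ y i j → j ≢ p → withCols M x y i j ≡ withCols M x′ y i j
      withCols-≢p M x x′ y i j j≢p rewrite dec-false (j Fin.≟ p) j≢p = ≡.refl

      withCols-≢q : ∀ M x y y′ i j → j ≢ q → withCols M x y i j ≡ withCols M x y′ i j
      withCols-≢q M x y y′ i j j≢q rewrite dec-false (j Fin.≟ q) j≢q = ≡.refl

    -- Polarisation: `D a+b a+b` is zero and expands to `D a b + D b a`. Alternation is assumed for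
    -- this one pair of columns, so that adjacent pairs can be swapped before the general case is
    -- known.
    alternating⇒antisymmetric : ∀ (M N : Mat n) → (∀ i j → N i j ≈ M i (transpose p q j)) → det N ≈ - det M
    alternating⇒antisymmetric M N N≈ = begin
      det N     ≈⟨ det-cong (λ i j → trans (N≈ i j) (swapped i j)) ⟩
      D b a     ≈⟨ +-identityˡ _ ⟨
      0# + D b a ≈⟨ +-congʳ (-‿inverseˡ (D a b)) ⟨
      (- D a b + D a b) + D b a ≈⟨ +-assoc _ _ _ ⟩
      - D a b + (D a b + D b a) ≈⟨ +-cong (-‿cong (det-cong original)) vanish ⟩
      - det M + 0#              ≈⟨ +-identityʳ _ ⟩
      - det M                   ∎
      where
      a b : Fin n → Carrier
      a i = M i p
      b i = M i q

      D : (x y : Fin n → Carrier) → Carrier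
      D x y = det (withCols M x y)

      swapped : ∀ i j → M i (transpose p q j) ≈ withCols M b a i j
      swapped i j with j Fin.≟ p
      ... | yes _ = refl
      ... | no _ with j Fin.≟ q
      ...   | yes _ = refl
      ...   | no _ = refl

      original : ∀ i j → withCols M a b i j ≈ M i j
      original i j with j Fin.≟ p
      ... | yes ≡.refl = refl
      ... | no _ with j Fin.≟ q
      ...   | yes ≡.refl = refl
      ...   | no _ = refl

      same : ∀ x → D x x ≈ 0#
      same x = alt (withCols M x x) λ i → reflexive (≡.trans (withCols-p M x x i) (≡.sym (withCols-q M x x i)))

      a+b : Fin n → Carrier
      a+b i = a i + b i

      1x+1y : ∀ {x y z x′ y′} → z ≡ x + y → x′ ≡ x → y′ ≡ y → z ≈ 1# * x′ + 1# * y′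
      1x+1y ≡.refl ≡.refl ≡.refl = sym (+-cong (*-identityˡ _) (*-identityˡ _))

      additiveˡ : ∀ y → D a+b y ≈ D a y + D b y
      additiveˡ y = trans
        (det-col-linear p {1#} {1#}
          (λ i j j≢p → reflexive (withCols-≢p M a+b a y i j j≢p))
          (λ i j j≢p → reflexive (withCols-≢p M a+b b y i j j≢p))
          (λ i → 1x+1y (withCols-p M a+b y i) (withCols-p M a y i) (withCols-p M b y i)))
        (+-cong (*-identityˡ _) (*-identityˡ _))

      additiveʳ : ∀ x → D x a+b ≈ D x a + D x b
      additiveʳ x = trans
        (det-col-linear q {1#} {1#}
          (λ i j j≢q → reflexive (withCols-≢q M x a+b a i j j≢q))
          (λ i j j≢q → reflexive (withCols-≢q M x a+b b i j j≢q))
          (λ i → 1x+1y (withCols-q M x a+b i) (withCols-q M x a i) (withCols-q M x b i)))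
        (+-cong (*-identityˡ _) (*-identityˡ _))

      vanish : D a b + D b a ≈ 0#
      vanish = begin
        D a b + D b a                       ≈⟨ +-cong (sym (+-identityˡ _)) (sym (+-identityʳ _)) ⟩
        (0# + D a b) + (D b a + 0#)         ≈⟨ +-cong (+-congʳ (same a)) (+-congˡ (same b)) ⟨
        (D a a + D a b) + (D b a + D b b)   ≈⟨ +-cong (additiveʳ a) (additiveʳ b) ⟨
        D a a+b + D b a+b                   ≈⟨ additiveˡ a+b ⟨
        D a+b a+b                           ≈⟨ same a+b ⟩
        0#                                  ∎

  private
    -- By induction on the position of `q`: a swap with its left neighbour moves the repeated column
    -- towards `p` and only changes the sign of the determinant, until the two columns are adjacent.
    alternating-< : ∀ {n} m (p q : Fin n) → toℕ q ≡ m → toℕ p < m → Alternating p q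
    alternating-< (suc m) p (suc q) q≡m p<m M Mp≈Mq with p Fin.≟ inject₁ q
    ... | yes ≡.refl = alternating-adjacent q M Mp≈Mq
    ... | no p≢ = begin
      det M       ≈⟨ -‿involutive _ ⟨
      - - det M   ≈⟨ -‿cong (alternating⇒antisymmetric inject₁≢suc (alternating-adjacent q) M N (λ i j → refl)) ⟨
      - det N     ≈⟨ -‿cong (alternating-< m p (inject₁ q) toℕq p<m′ N Np≈Nq) ⟩
      - 0#        ≈⟨ -0#≈0# ⟩
      0#          ∎
      where
      N : Mat _
      N i j = M i (transpose (inject₁ q) (suc q) j)
      inject₁≢suc : inject₁ q ≢ suc q
      inject₁≢suc eq = ℕ.1+n≢n {toℕ q} (≡.trans (≡.sym (≡.cong toℕ eq)) (Fin.toℕ-inject₁ q))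
      toℕq : toℕ (inject₁ q) ≡ m
      toℕq = ≡.trans (Fin.toℕ-inject₁ q) (ℕ.suc-injective q≡m)
      p<m′ : toℕ p < m
      p<m′ = ℕ.≤∧≢⇒< (ℕ.≤-pred p<m) (λ eq → p≢ (Fin.toℕ-injective (≡.trans eq (≡.sym toℕq))))
      p≢sq : p ≢ suc q
      p≢sq eq = ℕ.<-irrefl (≡.trans (≡.cong toℕ eq) q≡m) p<m
      Np≈Nq : ∀ i → N i p ≈ N i (inject₁ q)
      Np≈Nq i = trans (reflexive (≡.cong (M i) (transpose-≢ p≢ p≢sq)))
        (trans (Mp≈Mq i) (reflexive (≡.cong (M i) (≡.sym (transposeˡ (inject₁ q) (suc q))))))

  det-alternating : ∀ {n} {p q : Fin n} → p ≢ q → Alternating p q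
  det-alternating {p = p} {q} p≢q M Mp≈Mq with ℕ.<-cmp (toℕ p) (toℕ q)
  ... | tri< p<q _ _ = alternating-< _ p q ≡.refl p<q M Mp≈Mq
  ... | tri≈ _ p≡q _ = contradiction (Fin.toℕ-injective p≡q) p≢q
  ... | tri> _ _ q<p = alternating-< _ q p ≡.refl q<p M (sym ∘ Mp≈Mq)

  det-antisymmetric : ∀ {n} {p q : Fin n} (M N : Mat n) → p ≢ q →
    (∀ i j → N i j ≈ M i (transpose p q j)) → det N ≈ - det M
  det-antisymmetric M N p≢q = alternating⇒antisymmetric p≢q (det-alternating p≢q) M N

  δ : ∀ {n} → Mat n
  δ i j = if does (i Fin.≟ j) then 1# else 0#

  δ-diag : ∀ {n} (i : Fin n) → δ i i ≡ 1#
  δ-diag i rewrite dec-true (i Fin.≟ i) ≡.refl = ≡.refl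

  δ-≢ : ∀ {n} {i j : Fin n} → i ≢ j → δ i j ≡ 0#
  δ-≢ {i = i} {j} i≢j rewrite dec-false (i Fin.≟ j) i≢j = ≡.refl

  det-δ : ∀ n → det (δ {n}) ≈ 1#
  det-δ zero = refl
  det-δ (suc n) = begin
    det (δ {suc n})       ≈⟨ sum-single {f = laplaceTerm (δ {suc n})} zero (λ { zero 0≢0 → contradiction ≡.refl 0≢0 ; (suc j) _ → term-entry≈0 δ {suc j} refl }) ⟩
    1# * (1# * det (δ {n})) ≈⟨ trans (*-identityˡ _) (*-identityˡ _) ⟩
    det (δ {n})           ≈⟨ det-δ n ⟩
    1#                    ∎

  -- The sign of a self-map of Fin n, which is 0# unless the map is bijective.
  sgn : ∀ {n} → (Fin n → Fin n) → Carrier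
  sgn ρ = det λ i j → δ (ρ i) j

  sgn-cong : ∀ {n} {ρ ρ′ : Fin n → Fin n} → ρ ≗ ρ′ → sgn ρ ≈ sgn ρ′
  sgn-cong eq = det-cong λ i j → reflexive (≡.cong (λ k → δ k j) (eq i))

  sgn-id : ∀ n → sgn {n} id ≈ 1#
  sgn-id = det-δ

  sgn-collision : ∀ {n} (ρ : Fin n → Fin n) {a b} → a ≢ b → ρ a ≡ ρ b → sgn ρ ≈ 0#
  sgn-collision ρ {a} {b} a≢b ρa≡ρb = det-two-rows-one-col {v = ρ a} a≢b
    (λ j j≢ → reflexive (δ-≢ (j≢ ∘ ≡.sym)))
    (λ j j≢ → reflexive (δ-≢ (λ eq → j≢ (≡.trans (≡.sym eq) (≡.sym ρa≡ρb)))))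

  sgn-miss : ∀ {n} {ρ : Fin n → Fin n} w → (∀ i → ρ i ≢ w) → sgn ρ ≈ 0#
  sgn-miss w miss = det-zero-col w λ i → reflexive (δ-≢ (miss i))

  sgn-transposeˡ : ∀ {n} {p q : Fin n} (ρ : Fin n → Fin n) → p ≢ q → sgn (transpose p q ∘ ρ) ≈ - sgn ρ
  sgn-transposeˡ {p = p} {q} ρ p≢q = det-antisymmetric (λ i j → δ (ρ i) j) (λ i j → δ (transpose p q (ρ i)) j) p≢q λ i j → reflexive (δ-move (ρ i) j)
    where
    δ-move : ∀ k j → δ (transpose p q k) j ≡ δ k (transpose p q j)
    δ-move k j with transpose p q k Fin.≟ j
    ... | yes ≡.refl = ≡.sym (≡.trans (≡.cong (δ k) (transpose-involutive p q k)) (δ-diag k))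
    ... | no τk≢j = ≡.sym (δ-≢ {i = k} {transpose p q j} λ k≡τj → τk≢j (≡.trans (≡.cong (transpose p q) k≡τj) (transpose-involutive p q j)))

  collision? : ∀ {n} (ρ : Fin n → Fin n) → Dec (∃[ a ] ∃[ b ] (a ≢ b × ρ a ≡ ρ b))
  collision? ρ = Fin.any? λ a → Fin.any? λ b → ¬? (a Fin.≟ b) ×-dec (ρ a Fin.≟ ρ b)

  -- Precomposition permutes rows, for which no antisymmetry has been shown. An injective `ρ` turns
  -- the transposition into one on the other side, where it permutes columns; if `ρ` has a
  -- collision, both signs are zero.
  sgn-transposeʳ : ∀ {n} {p q : Fin n} (ρ : Fin n → Fin n) → p ≢ q → sgn (ρ ∘ transpose p q) ≈ - sgn ρ
  sgn-transposeʳ {p = p} {q} ρ p≢q with collision? ρ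
  ... | yes (a , b , a≢b , ρa≡ρb) = begin
    sgn (ρ ∘ τ) ≈⟨ sgn-collision (ρ ∘ τ) {τ a} {τ b}
                     (λ eq → a≢b (≡.trans (≡.sym (transpose-involutive p q a)) (≡.trans (≡.cong τ eq) (transpose-involutive p q b))))
                     (≡.trans (≡.cong ρ (transpose-involutive p q a)) (≡.trans ρa≡ρb (≡.cong ρ (≡.sym (transpose-involutive p q b))))) ⟩
    0#          ≈⟨ -0#≈0# ⟨
    - 0#        ≈⟨ -‿cong (sgn-collision ρ a≢b ρa≡ρb) ⟨
    - sgn ρ     ∎
    where τ = transpose p q
  ... | no injective = trans (sgn-cong conj) (sgn-transposeˡ ρ ρp≢ρq)
    where
    ρ-≢ : ∀ {a b} → a ≢ b → ρ a ≢ ρ b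
    ρ-≢ {a} {b} a≢b eq = injective (a , b , a≢b , eq)
    ρp≢ρq : ρ p ≢ ρ q
    ρp≢ρq = ρ-≢ p≢q
    conj : ρ ∘ transpose p q ≗ transpose (ρ p) (ρ q) ∘ ρ
    conj i with i Fin.≟ p
    ... | yes ≡.refl = ≡.sym (transposeˡ (ρ p) (ρ q))
    ... | no i≢p with i Fin.≟ q
    ...   | yes ≡.refl = ≡.sym (transposeʳ (ρ p) (ρ q))
    ...   | no i≢q = ≡.sym (transpose-≢ (ρ-≢ i≢p) (ρ-≢ i≢q))

module _ {a ℓ₁ b ℓ₂} (R : CommutativeRing a ℓ₁) (S : CommutativeRing b ℓ₂)
  {f : CommutativeRing.Carrier R → CommutativeRing.Carrier S}
  (f-homo : IsRingHomomorphism (CommutativeRing.rawRing R) (CommutativeRing.rawRing S) f) where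

  private
    module R = CommutativeRing R
    module S = CommutativeRing S
    open module f = IsRingHomomorphism f-homo
    open SemiringDefinitions (Semiring.rawSemiring R.semiring) using () renaming (_^_ to _^ᴿ_; sum to sumᴿ)
    open SemiringDefinitions (Semiring.rawSemiring S.semiring) using () renaming (_^_ to _^ˢ_; sum to sumˢ)

  ^-homo : ∀ x k → f (x ^ᴿ k) S.≈ f x ^ˢ k
  ^-homo x zero = f.1#-homo
  ^-homo x (suc k) = S.trans (f.*-homo _ _) (S.*-congˡ (^-homo x k))

  sum-homo : ∀ {n} (t : Fin n → R.Carrier) → f (sumᴿ t) S.≈ sumˢ (f ∘ t)
  sum-homo {zero} t = f.0#-homo
  sum-homo {suc n} t = S.trans (f.+-homo _ _) (S.+-congˡ (sum-homo (t ∘ suc)))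

  det-homo : ∀ {n} (M : Fin n → Fin n → R.Carrier) →
    f (Determinant.det R.rawRing M) S.≈ Determinant.det S.rawRing (λ i j → f (M i j))
  det-homo {zero} M = f.1#-homo
  det-homo {suc n} M = S.trans (sum-homo λ j → (R.- R.1#) ^ᴿ toℕ j R.* (M Fin.zero j R.* Determinant.det R.rawRing (λ i k → M (suc i) (punchIn j k)))) (SemiringSum.sum-cong-≋ S.semiring λ j →
    S.trans (f.*-homo _ _) (S.*-cong
      (S.trans (^-homo _ (toℕ j)) (^-cong (toℕ j) (S.trans (f.-‿homo _) (S.-‿cong f.1#-homo))))
      (S.trans (f.*-homo (M Fin.zero j) (Determinant.det R.rawRing (λ i k → M (suc i) (punchIn j k)))) (S.*-congˡ (det-homo λ i k → M (suc i) (punchIn j k))))))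
    where
    ^-cong : ∀ k {x y} → x S.≈ y → x ^ˢ k S.≈ y ^ˢ k
    ^-cong zero x≈y = S.refl
    ^-cong (suc k) x≈y = S.*-cong x≈y (^-cong k x≈y)

module _ {c ℓ} (R : CommutativeRing c ℓ) where
  open CommutativeRing R

  -- The field axiom in the form on which elimination and the treatment of roots branch. As a
  -- property of a commutative ring it leaves all ring constructions applicable.
  ZeroOrUnit : Set (c ⊔ ℓ)
  ZeroOrUnit = ∀ x → x ≈ 0# ⊎ ∃[ y ] y * x ≈ 1#

  Nontrivial : Set ℓ
  Nontrivial = ¬ 1# ≈ 0#

-- Cramer's rule and Gaussian elimination

module DeterminantKernel {c ℓ} (R : CommutativeRing c ℓ) where
  open CommutativeRing R hiding (zero)
  open RingProperties ring
  open SemiringDefinitions (Semiring.rawSemiring semiring) using (_^_)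
  open SemiringSum semiring
  open DeterminantTheory R
  open IntegerScalars R
  open Solver using (solve; _:=_; _:+_; _:*_; :-_; _:-_)
  open SetoidReasoning setoid

  private
    setCol : ∀ {n} → Mat n → Fin n → (Fin n → Carrier) → Mat n
    setCol M v x i j = if does (j Fin.≟ v) then x i else M i j

    setCol-at : ∀ {n} (M : Mat n) v x i → setCol M v x i v ≡ x i
    setCol-at M v x i rewrite dec-true (v Fin.≟ v) ≡.refl = ≡.refl

    setCol-≢ : ∀ {n} (M : Mat n) {v} x i {j} → j ≢ v → setCol M v x i j ≡ M i j
    setCol-≢ M {v} x i {j} j≢v rewrite dec-false (j Fin.≟ v) j≢v = ≡.refl

    setCol-setCol : ∀ {n} (M : Mat n) {v} x y i j → j ≢ v → setCol M v x i j ≈ setCol M v y i j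
    setCol-setCol M x y i j j≢v = reflexive (≡.trans (setCol-≢ M x i j≢v) (≡.sym (setCol-≢ M y i j≢v)))

  det-col-sum : ∀ {m n} (M : Mat n) v (a : Fin m → Carrier) (C : Fin m → Fin n → Carrier) →
    det (setCol M v λ i → sum λ k → a k * C k i) ≈ sum λ k → a k * det (setCol M v (C k))
  det-col-sum {zero} M v a C = det-zero-col v λ i → reflexive (setCol-at M v (λ _ → 0#) i)
  det-col-sum {suc m} M v a C = begin
    det (setCol M v entry)
      ≈⟨ det-col-linear v (setCol-setCol M entry (C zero)) (setCol-setCol M entry rest) (λ i → begin
           setCol M v entry i v       ≡⟨ setCol-at M v entry i ⟩
           a zero * C zero i + rest i ≈⟨ +-cong (*-congˡ (reflexive (≡.sym (setCol-at M v (C zero) i))))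
                                          (trans (sym (*-identityˡ _)) (*-congˡ (reflexive (≡.sym (setCol-at M v rest i))))) ⟩
           a zero * setCol M v (C zero) i v + 1# * setCol M v rest i v ∎) ⟩
    a zero * det (setCol M v (C zero)) + 1# * det (setCol M v rest)
      ≈⟨ +-congˡ (trans (*-identityˡ _) (det-col-sum M v (a ∘ suc) (C ∘ suc))) ⟩
    (sum λ k → a k * det (setCol M v (C k))) ∎
    where
    rest entry : Fin _ → Carrier
    entry i = a zero * C zero i + rest i
    rest i = sum λ k → a (suc k) * C (suc k) i

  -- Cramer's rule: with column `p` replaced by `M v` the determinant is `v p * det M`, because
  -- every other summand repeats a column. The replaced column is zero.
  kernel⇒det : ∀ {n} (M : Mat n) (v : Fin n → Carrier) p →
    (∀ i → sum (λ j → M i j * v j) ≈ 0#) → v p * det M ≈ 0#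
  kernel⇒det M v p Mv≈0 = begin
    v p * det M                        ≈⟨ *-congˡ (det-cong restore) ⟨
    v p * det (setCol M p (λ i → M i p)) ≈⟨ sum-single p (λ k k≢p → trans (*-congˡ (det-alternating k≢p (setCol M p λ i → M i k) λ i →
                                            reflexive (≡.trans (setCol-≢ M (λ i → M i k) i k≢p) (≡.sym (setCol-at M p (λ i → M i k) i))))) (zeroʳ _)) ⟨
    (sum λ k → v k * det (setCol M p λ i → M i k)) ≈⟨ det-col-sum M p v (λ k i → M i k) ⟨
    det (setCol M p λ i → sum λ k → v k * M i k)   ≈⟨ det-zero-col p (λ i → trans (reflexive (setCol-at M p (λ i → sum λ k → v k * M i k) i))
                                                        (trans (sum-cong-≋ λ k → *-comm (v k) (M i k)) (Mv≈0 i))) ⟩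
    0#                                 ∎
    where
    restore : ∀ i j → setCol M p (λ i → M i p) i j ≈ M i j
    restore i j with j Fin.≟ p
    ... | yes ≡.refl = refl
    ... | no _ = refl

  private
    upTo′ : ∀ {n} → (Fin n → Carrier) → ℕ → Fin n → Carrier
    upTo′ c t k = if does (toℕ k ℕ.<? t) then c k else 0#

    upTo′-< : ∀ {n} (c : Fin n → Carrier) {t k} → toℕ k < t → upTo′ c t k ≡ c k
    upTo′-< c {t} {k} k<t rewrite dec-true (toℕ k ℕ.<? t) k<t = ≡.refl

    upTo′-≮ : ∀ {n} (c : Fin n → Carrier) {t k} → ¬ toℕ k < t → upTo′ c t k ≡ 0#
    upTo′-≮ c {t} {k} k≮t rewrite dec-false (toℕ k ℕ.<? t) k≮t = ≡.refl

    upTo′-suc : ∀ {n} (c : Fin n → Carrier) {t k} → toℕ k ≢ t → upTo′ c (suc t) k ≡ upTo′ c t k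
    upTo′-suc c {t} {k} k≢t with toℕ k ℕ.<? t
    ... | yes k<t = ≡.trans (upTo′-< c (ℕ.m<n⇒m<1+n k<t)) (≡.sym (upTo′-< c k<t))
    ... | no k≮t = ≡.trans (upTo′-≮ c λ k<1+t → k≮t (ℕ.≤∧≢⇒< (ℕ.≤-pred k<1+t) k≢t)) (≡.sym (upTo′-≮ c k≮t))

  -- `N t` carries out the operation in the columns below `t`. Doing the next column `k` changes the
  -- determinant by a multiple of one in which column `j` is repeated; column `j` itself stays as it
  -- is since `c j` is zero.
  det-col-ops : ∀ {n} (M : Mat n) (j : Fin n) (c : Fin n → Carrier) → c j ≈ 0# →
    det (λ i k → M i k - c k * M i j) ≈ det M
  det-col-ops {n} M j c cj≈0 = begin
    det (λ i k → M i k - c k * M i j) ≈⟨ det-cong (λ i k → +-congˡ (-‿cong (*-congʳ (reflexive (≡.sym (upTo′-< c (Fin.toℕ<n k))))))) ⟩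
    det (N n)                         ≈⟨ unchanged n ℕ.≤-refl ⟩
    det (N 0)                         ≈⟨ det-cong {M = N 0} {N = M} (λ i k → trans (+-congˡ (trans (-‿cong (zeroˡ (M i j))) -0#≈0#)) (+-identityʳ _)) ⟩
    det M                             ∎
    where
    N : ℕ → Mat n
    N t i k = M i k - upTo′ c t k * M i j

    Nj : ∀ t i → N t i j ≈ M i j
    Nj t i = trans (+-congˡ (trans (-‿cong (trans (*-congʳ z) (zeroˡ _))) -0#≈0#)) (+-identityʳ _)
      where
      z : upTo′ c t j ≈ 0#
      z with toℕ j ℕ.<? t
      ... | yes j<t = trans (reflexive (upTo′-< c j<t)) cj≈0
      ... | no j≮t = reflexive (upTo′-≮ c j≮t)

    step : ∀ k → det (N (suc (toℕ k))) ≈ det (N (toℕ k))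
    step k with k Fin.≟ j
    ... | yes ≡.refl = det-cong λ i l → same i l
      where
      same : ∀ i l → N (suc (toℕ k)) i l ≈ N (toℕ k) i l
      same i l with l Fin.≟ j
      ... | yes ≡.refl = trans (Nj (suc (toℕ k)) i) (sym (Nj (toℕ k) i))
      ... | no l≢j = +-congˡ (-‿cong (*-congʳ (reflexive (upTo′-suc c (l≢j ∘ Fin.toℕ-injective)))))
    ... | no k≢j = begin
      det (N (suc (toℕ k)))  ≈⟨ det-col-linear k (λ i l l≢k → others i l l≢k)
                            (λ i l l≢k → trans (others i l l≢k) (reflexive (≡.sym (setCol-≢ (N (toℕ k)) (λ i → M i j) i l≢k))))
                            (λ i → begin
                               M i k - upTo′ c (suc (toℕ k)) k * M i j   ≈⟨ +-congˡ (-‿cong (*-congʳ (reflexive (upTo′-< c ℕ.≤-refl)))) ⟩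
                               M i k - c k * M i j                 ≈⟨ +-cong (sym (trans (*-identityˡ _) (Nk i))) (trans (-‿distribˡ-* _ _) (*-congˡ (reflexive (≡.sym (setCol-at (N (toℕ k)) k (λ i → M i j) i))))) ⟩
                               1# * N (toℕ k) i k + - c k * P i k        ∎) ⟩
      1# * det (N (toℕ k)) + - c k * det P ≈⟨ +-cong (*-identityˡ _) (trans (*-congˡ (det-alternating k≢j P λ i →
                                            trans (reflexive (setCol-at (N (toℕ k)) k (λ i → M i j) i)) (trans (sym (Nj (toℕ k) i)) (reflexive (≡.sym (setCol-≢ (N (toℕ k)) (λ i → M i j) i (k≢j ∘ ≡.sym))))))) (zeroʳ _)) ⟩
      det (N (toℕ k)) + 0#   ≈⟨ +-identityʳ _ ⟩
      det (N (toℕ k))        ∎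
      where
      P : Mat n
      P = setCol (N (toℕ k)) k (λ i → M i j)
      others : ∀ i l → l ≢ k → N (suc (toℕ k)) i l ≈ N (toℕ k) i l
      others i l l≢k = +-congˡ (-‿cong (*-congʳ (reflexive (upTo′-suc c (l≢k ∘ Fin.toℕ-injective)))))
      Nk : ∀ i → N (toℕ k) i k ≈ M i k
      Nk i = trans (+-congˡ (trans (-‿cong (trans (*-congʳ (reflexive (upTo′-≮ c (ℕ.<-irrefl ≡.refl)))) (zeroˡ _))) -0#≈0#)) (+-identityʳ _)

    unchanged : ∀ t → t ≤ n → det (N t) ≈ det (N 0)
    unchanged zero _ = refl
    unchanged (suc t) t<n = trans (≡.subst (λ u → det (N (suc u)) ≈ det (N u)) (Fin.toℕ-fromℕ< t<n) (step (Fin.fromℕ< t<n))) (unchanged t (ℕ.<⇒≤ t<n))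

  -- Signs are cancelled by multiplying twice, which avoids any case distinction on the parity of
  -- `k`.
  -1^k-involutive : ∀ k x → (- 1#) ^ k * ((- 1#) ^ k * x) ≈ x
  -1^k-involutive zero x = trans (*-identityˡ _) (*-identityˡ _)
  -1^k-involutive (suc k) x = begin
    (- 1# * s) * ((- 1# * s) * x) ≈⟨ solve 3 (λ e s x → (e :* s) :* ((e :* s) :* x) := (e :* e) :* (s :* (s :* x))) refl (- 1#) s x ⟩
    (- 1# * - 1#) * (s * (s * x)) ≈⟨ *-cong (trans (-x*-y 1# 1#) (*-identityˡ 1#)) (-1^k-involutive k x) ⟩
    1# * x                        ≈⟨ *-identityˡ x ⟩
    x                             ∎
    where s = (- 1#) ^ k

  NontrivialKernel : ∀ {m n} → (Fin m → Fin n → Carrier) → Set _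
  NontrivialKernel {n = n} W = Σ[ v ∈ (Fin n → Carrier) ]
    (∃[ p ] ¬ v p ≈ 0#) × (∀ i → sum (λ j → W i j * v j) ≈ 0#)

  module _ (zero-or-unit : ZeroOrUnit R) (1≉0 : Nontrivial R) where

    pivot? : ∀ {n} (r : Fin n → Carrier) → (∀ j → r j ≈ 0#) ⊎ ∃[ j ] ∃[ y ] y * r j ≈ 1#
    pivot? {zero} r = inj₁ λ ()
    pivot? {suc n} r with zero-or-unit (r zero) | pivot? (r ∘ suc)
    ... | inj₂ u | _ = inj₂ (zero , u)
    ... | inj₁ _ | inj₂ (j , u) = inj₂ (suc j , u)
    ... | inj₁ r₀≈0 | inj₁ r≈0 = inj₁ λ { zero → r₀≈0 ; (suc j) → r≈0 j }

    module _ {m n} (W : Fin (suc m) → Fin (suc n) → Carrier) (j : Fin (suc n)) {y} (unit : y * W zero j ≈ 1#) where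

      pivotCoefficient : Fin n → Carrier
      pivotCoefficient k = W zero (punchIn j k) * y

      pivoted : Fin (suc m) → Fin n → Carrier
      pivoted i k = W i (punchIn j k) - pivotCoefficient k * W i j

      pivoted-zero : ∀ k → pivoted zero k ≈ 0#
      pivoted-zero k = trans (+-congˡ (-‿cong (trans (*-assoc _ _ _) (trans (*-congˡ unit) (*-identityʳ _))))) (-‿inverseʳ _)

      -- Back substitution: `vⱼ` is the value that the first row forces on the pivot coordinate, and
      -- with it each row of `W` acts on `v` as the pivoted row acts on `w`.
      unpivot : NontrivialKernel (pivoted ∘ suc) → NontrivialKernel W
      unpivot (w , (p , wp≉0) , Ww≈0) = v , (punchIn j p , λ v≈0 → wp≉0 (trans (sym (v-punchIn p)) v≈0)) , λ i → trans (row i) (pivoted-row i)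
        where
        vⱼ = - sum λ k → pivotCoefficient k * w k
        v : Fin (suc n) → Carrier
        v k with j Fin.≟ k
        ... | yes _ = vⱼ
        ... | no j≢k = w (punchOut j≢k)
        v-j : v j ≈ vⱼ
        v-j with j Fin.≟ j
        ... | yes _ = refl
        ... | no j≢j = contradiction ≡.refl j≢j
        v-punchIn : ∀ k → v (punchIn j k) ≈ w k
        v-punchIn k with j Fin.≟ punchIn j k
        ... | yes j≡ = contradiction (≡.sym j≡) (Fin.punchInᵢ≢i j k)
        ... | no j≢ = reflexive (≡.cong w (≡.trans (Fin.punchOut-cong j ≡.refl) (Fin.punchOut-punchIn j)))
        row : ∀ i → sum (λ k → W i k * v k) ≈ sum (λ k → pivoted i k * w k)
        row i = begin
          sum (λ k → W i k * v k)
            ≈⟨ sum-remove {i = j} (λ k → W i k * v k) ⟩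
          W i j * v j + sum (λ k → W i (punchIn j k) * v (punchIn j k))
            ≈⟨ +-cong (*-congˡ v-j) (sum-cong-≋ λ k → *-congˡ (v-punchIn k)) ⟩
          W i j * vⱼ + sum (λ k → W i (punchIn j k) * w k)
            ≈⟨ +-cong (trans (sym (-‿distribʳ-* _ _)) (-‿distribˡ-* _ _)) (sym (*-identityˡ _)) ⟩
          - W i j * sum (λ k → pivotCoefficient k * w k) + 1# * sum (λ k → W i (punchIn j k) * w k)
            ≈⟨ sum-linear (- W i j) 1# (λ k → pivotCoefficient k * w k) (λ k → W i (punchIn j k) * w k) ⟨
          sum (λ k → - W i j * (pivotCoefficient k * w k) + 1# * (W i (punchIn j k) * w k))
            ≈⟨ sum-cong-≋ (λ k → trans (+-congˡ (*-identityˡ _)) (solve 4 (λ a c w b → :- a :* (c :* w) :+ b :* w := (b :- c :* a) :* w) refl (W i j) (pivotCoefficient k) (w k) (W i (punchIn j k)))) ⟩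
          sum (λ k → pivoted i k * w k) ∎
        pivoted-row : ∀ i → sum (λ k → pivoted i k * w k) ≈ 0#
        pivoted-row zero = sum-zero λ k → trans (*-congʳ (pivoted-zero k)) (zeroˡ _)
        pivoted-row (suc i) = Ww≈0 i

    -- A pivot in the first row removes one row and one column, a zero first row only a row, so
    -- there remain more columns than rows. Without rows every vector is in the kernel.
    wide-kernel : ∀ {m n} (W : Fin m → Fin n → Carrier) → m < n → NontrivialKernel W
    wide-kernel {zero} {suc n} W _ = (λ _ → 1#) , (zero , 1≉0) , λ ()
    wide-kernel {suc m} {suc n} W m<n with pivot? (W zero)
    ... | inj₂ (j , y , unit) = unpivot W j unit (wide-kernel (pivoted W j unit ∘ suc) (ℕ.≤-pred m<n))
    ... | inj₁ W₀≈0 with wide-kernel (W ∘ suc) (ℕ.<-trans ℕ.≤-refl m<n)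
    ...   | v , v≉0 , Wv≈0 = v , v≉0 , λ where
            zero → sum-zero λ j → trans (*-congʳ {v j} (W₀≈0 j)) (zeroˡ _)
            (suc i) → Wv≈0 i

    -- Column operations clear the first row apart from its pivot, so `det M` is up to sign the
    -- pivot times the determinant of `pivoted`, to which the induction applies. A zero first row
    -- leaves fewer equations than unknowns.
    det⇒kernel : ∀ {n} (M : Mat n) → det M ≈ 0# → NontrivialKernel M
    det⇒kernel {zero} M 1≈0 = contradiction 1≈0 1≉0
    det⇒kernel {suc n} M det≈0 with pivot? (M zero)
    ... | inj₁ M₀≈0 with wide-kernel (M ∘ suc) ℕ.≤-refl
    ...   | v , v≉0 , Mv≈0 = v , v≉0 , λ where
            zero → sum-zero λ j → trans (*-congʳ {v j} (M₀≈0 j)) (zeroˡ _)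
            (suc i) → Mv≈0 i
    det⇒kernel {suc n} M det≈0 | inj₂ (j , y , unit) = unpivot M j unit (det⇒kernel (pivoted M j unit ∘ suc) pivoted≈0)
      where
      -- The operation must leave the pivot column alone, so its multiplier is `0#` there.
      c′ : Fin (suc n) → Carrier
      c′ k = if does (k Fin.≟ j) then 0# else M zero k * y

      c′-j : c′ j ≈ 0#
      c′-j rewrite dec-true (j Fin.≟ j) ≡.refl = refl

      c′-punchIn : ∀ k → c′ (punchIn j k) ≡ pivotCoefficient M j unit k
      c′-punchIn k rewrite dec-false (punchIn j k Fin.≟ j) (Fin.punchInᵢ≢i j k) = ≡.refl

      N : Mat (suc n)
      N i k = M i k - c′ k * M i j

      N-punchIn : ∀ i k → N i (punchIn j k) ≈ pivoted M j unit i k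
      N-punchIn i k = +-congˡ (-‿cong (*-congʳ (reflexive (c′-punchIn k))))

      N₀ : ∀ k → k ≢ j → N zero k ≈ 0#
      N₀ k k≢j with ≢⇒punchIn (k≢j ∘ ≡.sym)
      ... | l , ≡.refl = trans (N-punchIn zero l) (pivoted-zero M j unit l)

      N₀ⱼ : N zero j ≈ M zero j
      N₀ⱼ = trans (+-congˡ (trans (-‿cong (trans (*-congʳ c′-j) (zeroˡ _))) -0#≈0#)) (+-identityʳ _)

      s = (- 1#) ^ toℕ j
      d = det (pivoted M j unit ∘ suc)

      expansion : s * (M zero j * d) ≈ 0#
      expansion = begin
        s * (M zero j * d)  ≈⟨ *-congˡ (*-cong N₀ⱼ (det-cong λ i k → N-punchIn (suc i) k)) ⟨
        laplaceTerm N j     ≈⟨ sum-single {f = laplaceTerm N} j (λ k k≢j → trans (*-congˡ (trans (*-congʳ (N₀ k k≢j)) (zeroˡ _))) (zeroʳ _)) ⟨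
        det N               ≈⟨ det-col-ops M j c′ c′-j ⟩
        det M               ≈⟨ det≈0 ⟩
        0#                  ∎

      pivoted≈0 : d ≈ 0#
      pivoted≈0 = begin
        d                             ≈⟨ *-identityˡ d ⟨
        1# * d                        ≈⟨ *-congʳ unit ⟨
        (y * M zero j) * d            ≈⟨ *-assoc _ _ _ ⟩
        y * (M zero j * d)            ≈⟨ *-congˡ (-1^k-involutive (toℕ j) _) ⟨
        y * (s * (s * (M zero j * d))) ≈⟨ *-congˡ (trans (*-congˡ expansion) (zeroʳ _)) ⟩
        y * 0#                        ≈⟨ zeroʳ y ⟩
        0#                            ∎

-- Polynomials

module _ {a ℓ₁ b ℓ₂} (R : RawRing a ℓ₁) (S : RawRing b ℓ₂) where
  private
    module R = RawRing R
    module S = RawRing S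

  mkRingHomomorphism : ∀ {f : R.Carrier → S.Carrier} →
    (∀ {x y} → x R.≈ y → f x S.≈ f y) →
    (∀ x y → f (x R.+ y) S.≈ f x S.+ f y) →
    (∀ x y → f (x R.* y) S.≈ f x S.* f y) →
    (∀ x → f (R.- x) S.≈ S.- f x) →
    f R.0# S.≈ S.0# → f R.1# S.≈ S.1# → IsRingHomomorphism R S f
  mkRingHomomorphism cong +-homo *-homo -‿homo 0-homo 1-homo = record
    { isSemiringHomomorphism = record
      { isNearSemiringHomomorphism = record
        { +-isMonoidHomomorphism = record
          { isMagmaHomomorphism = record { isRelHomomorphism = record { cong = cong } ; homo = +-homo }
          ; ε-homo = 0-homo
          }
        ; *-homo = *-homo
        }
      ; 1#-homo = 1-homo
      }
    ; -‿homo = -‿homo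
    }

module Convolution {c ℓ} (R : CommutativeRing c ℓ) where
  open CommutativeRing R hiding (zero)
  open IntegerScalars R
  open Solver using (solve; _:=_; _:+_; _:*_)
  open SetoidReasoning setoid

  -- The Cauchy product of coefficient sequences. The laws of multiplication are proved for
  -- sequences, where lengths and trailing zeros do not matter, and reach `Poly` through `coeff-*`.
  conv : (f g : ℕ → Carrier) → ℕ → Carrier
  conv f g zero    = f 0 * g 0
  conv f g (suc k) = f 0 * g (suc k) + conv (f ∘ suc) g k

  conv-cong : ∀ {f f′ g g′} → (∀ k → f k ≈ f′ k) → (∀ k → g k ≈ g′ k) → ∀ k → conv f g k ≈ conv f′ g′ k
  conv-cong f≈ g≈ zero    = *-cong (f≈ 0) (g≈ 0)
  conv-cong f≈ g≈ (suc k) = +-cong (*-cong (f≈ 0) (g≈ (suc k))) (conv-cong (f≈ ∘ suc) g≈ k)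

  conv-zeroˡ : ∀ g k → conv (λ _ → 0#) g k ≈ 0#
  conv-zeroˡ g zero    = zeroˡ _
  conv-zeroˡ g (suc k) = trans (+-cong (zeroˡ _) (conv-zeroˡ g k)) (+-identityˡ _)

  -- The shape `a * f j + f′ j` is that of `conv f g (suc j)` with `a` as `f 0`, which is how the
  -- inner product appears in `conv-assoc`.
  conv-linearˡ : ∀ a f f′ g k → conv (λ j → a * f j + f′ j) g k ≈ a * conv f g k + conv f′ g k
  conv-linearˡ a f f′ g zero    = solve 4 (λ a f f′ g → (a :* f :+ f′) :* g := a :* (f :* g) :+ f′ :* g) refl _ _ _ _
  conv-linearˡ a f f′ g (suc k) = trans (+-congˡ (conv-linearˡ a (f ∘ suc) (f′ ∘ suc) g k))
    (solve 6 (λ a f f′ g x y → (a :* f :+ f′) :* g :+ (a :* x :+ y) := a :* (f :* g :+ x) :+ (f′ :* g :+ y)) refl _ _ _ _ _ _)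

  conv-+ˡ : ∀ f f′ g k → conv (λ j → f j + f′ j) g k ≈ conv f g k + conv f′ g k
  conv-+ˡ f f′ g k = trans (conv-cong (λ j → +-congʳ (sym (*-identityˡ (f j)))) (λ j → refl) k)
    (trans (conv-linearˡ 1# f f′ g k) (+-congʳ (*-identityˡ _)))

  conv-sucʳ : ∀ f g k → conv f g (suc k) ≈ conv f (g ∘ suc) k + f (suc k) * g 0
  conv-sucʳ f g zero    = refl
  conv-sucʳ f g (suc k) = trans (+-congˡ (conv-sucʳ (f ∘ suc) g k)) (sym (+-assoc _ _ _))

  conv-comm : ∀ f g k → conv f g k ≈ conv g f k
  conv-comm f g zero    = *-comm _ _
  conv-comm f g (suc k) = trans (+-comm _ _) (trans (+-cong (conv-comm (f ∘ suc) g k) (*-comm _ _)) (sym (conv-sucʳ g f k)))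

  conv-assoc : ∀ f g h k → conv (conv f g) h k ≈ conv f (conv g h) k
  conv-assoc f g h zero    = *-assoc _ _ _
  conv-assoc f g h (suc k) = begin
    (f 0 * g 0) * h (suc k) + conv (λ j → f 0 * g (suc j) + conv (f ∘ suc) g j) h k
      ≈⟨ +-congˡ (conv-linearˡ (f 0) (g ∘ suc) (conv (f ∘ suc) g) h k) ⟩
    (f 0 * g 0) * h (suc k) + (f 0 * conv (g ∘ suc) h k + conv (conv (f ∘ suc) g) h k)
      ≈⟨ +-congˡ (+-congˡ (conv-assoc (f ∘ suc) g h k)) ⟩
    (f 0 * g 0) * h (suc k) + (f 0 * conv (g ∘ suc) h k + conv (f ∘ suc) (conv g h) k)
      ≈⟨ solve 5 (λ a b c x y → (a :* b) :* c :+ (a :* x :+ y) := a :* (b :* c :+ x) :+ y) refl _ _ _ _ _ ⟩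
    f 0 * (g 0 * h (suc k) + conv (g ∘ suc) h k) + conv (f ∘ suc) (conv g h) k ∎

module PolynomialRing {c ℓ} (R : CommutativeRing c ℓ) where
  open CommutativeRing R hiding (zero)
  open RingProperties ring
  open Polynomial rawRing public hiding (_^ₚ_; _∣ₚ_; _∤ₚ_; sumₚ)
  open Convolution R
  open SemiringDefinitions (Semiring.rawSemiring semiring) using (_^_)
  open IntegerScalars R using (module Solver)
  open Solver using (solve; _:=_; _:+_; _:*_; :-_; _:-_)
  open SetoidReasoning setoid

  coeff-+ : ∀ p q k → coeff (p +ₚ q) k ≈ coeff p k + coeff q k
  coeff-+ []      q       k       = sym (+-identityˡ _)
  coeff-+ (a ∷ p) []      k       = sym (+-identityʳ _)
  coeff-+ (a ∷ p) (b ∷ q) zero    = refl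
  coeff-+ (a ∷ p) (b ∷ q) (suc k) = coeff-+ p q k

  coeff-scale : ∀ a p k → coeff (map (a *_) p) k ≈ a * coeff p k
  coeff-scale a []      k       = sym (zeroʳ a)
  coeff-scale a (b ∷ p) zero    = refl
  coeff-scale a (b ∷ p) (suc k) = coeff-scale a p k

  coeff-neg : ∀ p k → coeff (map (-_) p) k ≈ - coeff p k
  coeff-neg []      k       = sym -0#≈0#
  coeff-neg (b ∷ p) zero    = refl
  coeff-neg (b ∷ p) (suc k) = coeff-neg p k

  coeff-* : ∀ p q k → coeff (p *ₚ q) k ≈ conv (coeff p) (coeff q) k
  coeff-* []      q k       = sym (conv-zeroˡ (coeff q) k)
  coeff-* (a ∷ p) q zero    = trans (coeff-+ (map (a *_) q) (0# ∷ p *ₚ q) zero)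
    (trans (+-identityʳ _) (coeff-scale a q zero))
  coeff-* (a ∷ p) q (suc k) = trans (coeff-+ (map (a *_) q) (0# ∷ p *ₚ q) (suc k))
    (+-cong (coeff-scale a q (suc k)) (coeff-* p q k))

  coeff-const* : ∀ a q k → coeff (const a *ₚ q) k ≈ a * coeff q k
  coeff-const* a q zero    = coeff-* (const a) q 0
  coeff-const* a q (suc k) = trans (coeff-* (const a) q (suc k)) (trans (+-congˡ (conv-zeroˡ (coeff q) k)) (+-identityʳ _))

  private
    viaConv : ∀ {p q p′ q′} → (∀ k → conv (coeff p) (coeff q) k ≈ conv (coeff p′) (coeff q′) k) → p *ₚ q ≈ₚ p′ *ₚ q′
    viaConv {p} {q} {p′} {q′} eq k = trans (coeff-* p q k) (trans (eq k) (sym (coeff-* p′ q′ k)))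

    distribʳ-ₚ : ∀ r p q → (p +ₚ q) *ₚ r ≈ₚ p *ₚ r +ₚ q *ₚ r
    distribʳ-ₚ r p q k = begin
      coeff ((p +ₚ q) *ₚ r) k                                       ≈⟨ coeff-* (p +ₚ q) r k ⟩
      conv (coeff (p +ₚ q)) (coeff r) k                             ≈⟨ conv-cong (coeff-+ p q) (λ _ → refl) k ⟩
      conv (λ j → coeff p j + coeff q j) (coeff r) k                ≈⟨ conv-+ˡ (coeff p) (coeff q) (coeff r) k ⟩
      conv (coeff p) (coeff r) k + conv (coeff q) (coeff r) k       ≈⟨ +-cong (coeff-* p r k) (coeff-* q r k) ⟨
      coeff (p *ₚ r) k + coeff (q *ₚ r) k                           ≈⟨ coeff-+ (p *ₚ r) (q *ₚ r) k ⟨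
      coeff (p *ₚ r +ₚ q *ₚ r) k                                    ∎

    *ₚ-comm : ∀ p q → p *ₚ q ≈ₚ q *ₚ p
    *ₚ-comm p q = viaConv {p} {q} {q} {p} (conv-comm (coeff p) (coeff q))

    *ₚ-identityˡ : ∀ p → (1# ∷ []) *ₚ p ≈ₚ p
    *ₚ-identityˡ p k = trans (coeff-const* 1# p k) (*-identityˡ _)

    transₚ : ∀ {p q r} → p ≈ₚ q → q ≈ₚ r → p ≈ₚ r
    transₚ p≈q q≈r k = trans (p≈q k) (q≈r k)

  polyRing : CommutativeRing c ℓ
  polyRing = record
    { Carrier = Poly ; _≈_ = _≈ₚ_ ; _+_ = _+ₚ_ ; _*_ = _*ₚ_ ; -_ = map (-_) ; 0# = [] ; 1# = 1# ∷ []
    ; isCommutativeRing = record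
      { isRing = record
        { +-isAbelianGroup = record
          { isGroup = record
            { isMonoid = record
              { isSemigroup = record
                { isMagma = record
                  { isEquivalence = record
                    { refl = λ _ → refl
                    ; sym = λ eq k → sym (eq k)
                    ; trans = λ {p} {q} {r} → transₚ {p} {q} {r}
                    }
                  ; ∙-cong = λ {p} {p′} {q} {q′} p≈ q≈ k → trans (coeff-+ p q k) (trans (+-cong (p≈ k) (q≈ k)) (sym (coeff-+ p′ q′ k)))
                  }
                ; assoc = λ p q r k → trans (trans (coeff-+ (p +ₚ q) r k) (+-congʳ (coeff-+ p q k)))
                    (trans (+-assoc _ _ _) (sym (trans (coeff-+ p (q +ₚ r) k) (+-congˡ (coeff-+ q r k)))))
                }
              ; identity = (λ p k → refl) , (λ p k → trans (coeff-+ p [] k) (+-identityʳ _))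
              }
            ; inverse = (λ p k → trans (coeff-+ (map (-_) p) p k) (trans (+-congʳ (coeff-neg p k)) (-‿inverseˡ _)))
                      , (λ p k → trans (coeff-+ p (map (-_) p) k) (trans (+-congˡ (coeff-neg p k)) (-‿inverseʳ _)))
            ; ⁻¹-cong = λ {p} {q} p≈q k → trans (coeff-neg p k) (trans (-‿cong (p≈q k)) (sym (coeff-neg q k)))
            }
          ; comm = λ p q k → trans (coeff-+ p q k) (trans (+-comm _ _) (sym (coeff-+ q p k)))
          }
        ; *-cong = λ {p} {p′} {q} {q′} p≈ q≈ → viaConv {p} {q} {p′} {q′} (conv-cong p≈ q≈)
        ; *-assoc = λ p q r → viaConv {p *ₚ q} {r} {p} {q *ₚ r} λ k → begin
            conv (coeff (p *ₚ q)) (coeff r) k               ≈⟨ conv-cong (coeff-* p q) (λ _ → refl) k ⟩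
            conv (conv (coeff p) (coeff q)) (coeff r) k     ≈⟨ conv-assoc (coeff p) (coeff q) (coeff r) k ⟩
            conv (coeff p) (conv (coeff q) (coeff r)) k     ≈⟨ conv-cong (λ _ → refl) (coeff-* q r) k ⟨
            conv (coeff p) (coeff (q *ₚ r)) k               ∎
        ; *-identity = *ₚ-identityˡ , λ p → transₚ {p *ₚ (1# ∷ [])} {(1# ∷ []) *ₚ p} {p} (*ₚ-comm p (1# ∷ [])) (*ₚ-identityˡ p)
        ; distrib = (λ r p q k → trans (*ₚ-comm r (p +ₚ q) k) (trans (distribʳ-ₚ r p q k)
                      (trans (coeff-+ (p *ₚ r) (q *ₚ r) k) (trans (+-cong (*ₚ-comm p r k) (*ₚ-comm q r k)) (sym (coeff-+ (r *ₚ p) (r *ₚ q) k))))))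
                  , distribʳ-ₚ
        }
      ; *-comm = *ₚ-comm
      }
    }

  evalHomomorphism : ∀ x → IsRingHomomorphism polyRawRing rawRing (λ p → eval p x)
  evalHomomorphism x = mkRingHomomorphism polyRawRing rawRing (λ {p} {q} → ev-cong p q) ev-+ ev-* ev-neg refl
    (trans (+-congˡ (zeroʳ x)) (+-identityʳ _))
    where
    ev : Poly → Carrier
    ev p = eval p x
    ev-zero : ∀ p → p ≈ₚ [] → ev p ≈ 0#
    ev-zero []      p≈0 = refl
    ev-zero (a ∷ p) p≈0 = trans (+-cong (p≈0 0) (*-congˡ (ev-zero p (p≈0 ∘ suc)))) (trans (+-identityˡ _) (zeroʳ x))
    ev-cong : ∀ p q → p ≈ₚ q → ev p ≈ ev q
    ev-cong []      q       p≈q = sym (ev-zero q (λ k → sym (p≈q k)))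
    ev-cong (a ∷ p) []      p≈q = ev-zero (a ∷ p) p≈q
    ev-cong (a ∷ p) (b ∷ q) p≈q = +-cong (p≈q 0) (*-congˡ (ev-cong p q (p≈q ∘ suc)))
    ev-+ : ∀ p q → ev (p +ₚ q) ≈ ev p + ev q
    ev-+ []      q       = sym (+-identityˡ _)
    ev-+ (a ∷ p) []      = sym (+-identityʳ _)
    ev-+ (a ∷ p) (b ∷ q) = trans (+-congˡ (*-congˡ (ev-+ p q)))
      (solve 5 (λ a b x p q → (a :+ b) :+ x :* (p :+ q) := (a :+ x :* p) :+ (b :+ x :* q)) refl a b x (ev p) (ev q))
    ev-scale : ∀ a q → ev (map (a *_) q) ≈ a * ev q
    ev-scale a []      = sym (zeroʳ a)
    ev-scale a (b ∷ q) = trans (+-congˡ (*-congˡ (ev-scale a q)))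
      (solve 4 (λ a b x q → a :* b :+ x :* (a :* q) := a :* (b :+ x :* q)) refl a b x (ev q))
    ev-* : ∀ p q → ev (p *ₚ q) ≈ ev p * ev q
    ev-* []      q = sym (zeroˡ _)
    ev-* (a ∷ p) q = begin
      ev (map (a *_) q +ₚ (0# ∷ p *ₚ q))          ≈⟨ ev-+ (map (a *_) q) (0# ∷ p *ₚ q) ⟩
      ev (map (a *_) q) + (0# + x * ev (p *ₚ q))  ≈⟨ +-cong (ev-scale a q) (trans (+-identityˡ _) (*-congˡ (ev-* p q))) ⟩
      a * ev q + x * (ev p * ev q)                ≈⟨ solve 4 (λ a x p q → a :* q :+ x :* (p :* q) := (a :+ x :* p) :* q) refl a x (ev p) (ev q) ⟩
      (a + x * ev p) * ev q                       ∎
    ev-neg : ∀ p → ev (map (-_) p) ≈ - ev p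
    ev-neg []      = sym -0#≈0#
    ev-neg (a ∷ p) = trans (+-congˡ (*-congˡ (ev-neg p)))
      (solve 3 (λ a x p → :- a :+ x :* (:- p) := :- (a :+ x :* p)) refl a x (ev p))

  -- Substitution of - X for X.
  reflect : Poly → Poly
  reflect []      = []
  reflect (a ∷ p) = a ∷ map (-_) (reflect p)

  coeff-reflect : ∀ p k → coeff (reflect p) k ≈ (- 1#) ^ k * coeff p k
  coeff-reflect []      k       = sym (zeroʳ _)
  coeff-reflect (a ∷ p) zero    = sym (*-identityˡ a)
  coeff-reflect (a ∷ p) (suc k) = begin
    coeff (map (-_) (reflect p)) k    ≈⟨ coeff-neg (reflect p) k ⟩
    - coeff (reflect p) k           ≈⟨ -‿cong (coeff-reflect p k) ⟩
    - ((- 1#) ^ k * coeff p k)      ≈⟨ -1*x≈-x _ ⟨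
    - 1# * ((- 1#) ^ k * coeff p k) ≈⟨ *-assoc _ _ _ ⟨
    - 1# * (- 1#) ^ k * coeff p k   ∎

  private
    conv-alternate : ∀ f g k → (- 1#) ^ k * conv f g k ≈ conv (λ j → (- 1#) ^ j * f j) (λ j → (- 1#) ^ j * g j) k
    conv-alternate f g zero = trans (*-identityˡ _) (sym (*-cong (*-identityˡ _) (*-identityˡ _)))
    conv-alternate f g (suc k) = begin
      (- 1# * s) * (f 0 * g (suc k) + conv (f ∘ suc) g k)
        ≈⟨ solve 5 (λ e s a b c → (e :* s) :* (a :* b :+ c) := a :* ((e :* s) :* b) :+ e :* (s :* c)) refl (- 1#) s (f 0) (g (suc k)) (conv (f ∘ suc) g k) ⟩
      f 0 * ((- 1# * s) * g (suc k)) + - 1# * (s * conv (f ∘ suc) g k)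
        ≈⟨ +-cong (*-congʳ (sym (*-identityˡ _))) (*-congˡ (conv-alternate (f ∘ suc) g k)) ⟩
      1# * f 0 * ((- 1# * s) * g (suc k)) + - 1# * conv (λ j → (- 1#) ^ j * f (suc j)) g′ k
        ≈⟨ +-congˡ (trans (sym (+-identityʳ _)) (+-congˡ (sym (conv-zeroˡ g′ k)))) ⟩
      1# * f 0 * ((- 1# * s) * g (suc k)) + (- 1# * conv (λ j → (- 1#) ^ j * f (suc j)) g′ k + conv (λ _ → 0#) g′ k)
        ≈⟨ +-congˡ (conv-linearˡ (- 1#) _ _ g′ k) ⟨
      1# * f 0 * ((- 1# * s) * g (suc k)) + conv (λ j → - 1# * ((- 1#) ^ j * f (suc j)) + 0#) g′ k
        ≈⟨ +-congˡ (conv-cong (λ j → trans (+-identityʳ _) (sym (*-assoc _ _ _))) (λ _ → refl) k) ⟩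
      1# * f 0 * ((- 1# * s) * g (suc k)) + conv (λ j → (- 1# * (- 1#) ^ j) * f (suc j)) g′ k ∎
      where
      s = (- 1#) ^ k
      g′ : ℕ → Carrier
      g′ j = (- 1#) ^ j * g j

  reflectHomomorphism : IsRingHomomorphism polyRawRing polyRawRing reflect
  reflectHomomorphism = mkRingHomomorphism polyRawRing polyRawRing
    (λ {p} {q} p≈q k → trans (coeff-reflect p k) (trans (*-congˡ (p≈q k)) (sym (coeff-reflect q k))))
    (λ p q k → begin
      coeff (reflect (p +ₚ q)) k               ≈⟨ coeff-reflect (p +ₚ q) k ⟩
      (- 1#) ^ k * coeff (p +ₚ q) k            ≈⟨ *-congˡ (coeff-+ p q k) ⟩
      (- 1#) ^ k * (coeff p k + coeff q k)     ≈⟨ distribˡ _ _ _ ⟩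
      (- 1#) ^ k * coeff p k + (- 1#) ^ k * coeff q k ≈⟨ +-cong (coeff-reflect p k) (coeff-reflect q k) ⟨
      coeff (reflect p) k + coeff (reflect q) k ≈⟨ coeff-+ (reflect p) (reflect q) k ⟨
      coeff (reflect p +ₚ reflect q) k         ∎)
    (λ p q k → begin
      coeff (reflect (p *ₚ q)) k               ≈⟨ coeff-reflect (p *ₚ q) k ⟩
      (- 1#) ^ k * coeff (p *ₚ q) k            ≈⟨ *-congˡ (coeff-* p q k) ⟩
      (- 1#) ^ k * conv (coeff p) (coeff q) k  ≈⟨ conv-alternate (coeff p) (coeff q) k ⟩
      conv (λ j → (- 1#) ^ j * coeff p j) (λ j → (- 1#) ^ j * coeff q j) k ≈⟨ conv-cong (coeff-reflect p) (coeff-reflect q) k ⟨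
      conv (coeff (reflect p)) (coeff (reflect q)) k ≈⟨ coeff-* (reflect p) (reflect q) k ⟨
      coeff (reflect p *ₚ reflect q) k         ∎)
    (λ p k → begin
      coeff (reflect (map (-_) p)) k             ≈⟨ coeff-reflect (map (-_) p) k ⟩
      (- 1#) ^ k * coeff (map (-_) p) k          ≈⟨ *-congˡ (coeff-neg p k) ⟩
      (- 1#) ^ k * - coeff p k                 ≈⟨ -‿distribʳ-* _ _ ⟨
      - ((- 1#) ^ k * coeff p k)               ≈⟨ -‿cong (coeff-reflect p k) ⟨
      - coeff (reflect p) k                    ≈⟨ coeff-neg (reflect p) k ⟨
      coeff (map (-_) (reflect p)) k             ∎)
    (λ k → refl) (λ { zero → refl ; (suc k) → refl })

module _ {a ℓ₁ b ℓ₂} (R : CommutativeRing a ℓ₁) (S : CommutativeRing b ℓ₂)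
  {f : CommutativeRing.Carrier R → CommutativeRing.Carrier S}
  (f-homo : IsRingHomomorphism (CommutativeRing.rawRing R) (CommutativeRing.rawRing S) f) where

  private
    module R = CommutativeRing R
    module S = CommutativeRing S
    module f = IsRingHomomorphism f-homo
    module R[X] = PolynomialRing R
    module S[X] = PolynomialRing S
    open Convolution

  coeff-map : ∀ p k → S[X].coeff (map f p) k S.≈ f (R[X].coeff p k)
  coeff-map []      k       = S.sym f.0#-homo
  coeff-map (a ∷ p) zero    = S.refl
  coeff-map (a ∷ p) (suc k) = coeff-map p k

  private
    conv-homo : ∀ u v k → f (conv R u v k) S.≈ conv S (f ∘ u) (f ∘ v) k
    conv-homo u v zero    = f.*-homo _ _
    conv-homo u v (suc k) = S.trans (f.+-homo _ _) (S.+-cong (f.*-homo _ _) (conv-homo (u ∘ suc) v k))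

  mapHomomorphism : IsRingHomomorphism R[X].polyRawRing S[X].polyRawRing (map f)
  mapHomomorphism = mkRingHomomorphism R[X].polyRawRing S[X].polyRawRing
    (λ {p} {q} p≈q k → S.trans (coeff-map p k) (S.trans (f.⟦⟧-cong (p≈q k)) (S.sym (coeff-map q k))))
    (λ p q k → begin
      S[X].coeff (map f (p R[X].+ₚ q)) k             ≈⟨ coeff-map (p R[X].+ₚ q) k ⟩
      f (R[X].coeff (p R[X].+ₚ q) k)                 ≈⟨ S.trans (f.⟦⟧-cong (R[X].coeff-+ p q k)) (f.+-homo _ _) ⟩
      f (R[X].coeff p k) S.+ f (R[X].coeff q k)      ≈⟨ S.+-cong (coeff-map p k) (coeff-map q k) ⟨
      S[X].coeff (map f p) k S.+ S[X].coeff (map f q) k ≈⟨ S[X].coeff-+ (map f p) (map f q) k ⟨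
      S[X].coeff (map f p S[X].+ₚ map f q) k         ∎)
    (λ p q k → begin
      S[X].coeff (map f (p R[X].*ₚ q)) k             ≈⟨ coeff-map (p R[X].*ₚ q) k ⟩
      f (R[X].coeff (p R[X].*ₚ q) k)                 ≈⟨ f.⟦⟧-cong (R[X].coeff-* p q k) ⟩
      f (conv R (R[X].coeff p) (R[X].coeff q) k)     ≈⟨ conv-homo (R[X].coeff p) (R[X].coeff q) k ⟩
      conv S (f ∘ R[X].coeff p) (f ∘ R[X].coeff q) k ≈⟨ conv-cong S (coeff-map p) (coeff-map q) k ⟨
      conv S (S[X].coeff (map f p)) (S[X].coeff (map f q)) k ≈⟨ S[X].coeff-* (map f p) (map f q) k ⟨
      S[X].coeff (map f p S[X].*ₚ map f q) k         ∎)
    (λ p k → begin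
      S[X].coeff (map f (map (R.-_) p)) k              ≈⟨ coeff-map (map (R.-_) p) k ⟩
      f (R[X].coeff (map (R.-_) p) k)                  ≈⟨ S.trans (f.⟦⟧-cong (R[X].coeff-neg p k)) (f.-‿homo _) ⟩
      S.- f (R[X].coeff p k)                         ≈⟨ S.-‿cong (coeff-map p k) ⟨
      S.- S[X].coeff (map f p) k                     ≈⟨ S[X].coeff-neg (map f p) k ⟨
      S[X].coeff (map (S.-_) (map f p)) k              ∎)
    (λ k → S.refl) (λ { zero → f.1#-homo ; (suc k) → S.refl })
    where open SetoidReasoning S.setoid

-- Divisibility by powers of linear factors

module PowerDivisibility {c ℓ} (R : CommutativeRing c ℓ) where
  open CommutativeRing R hiding (zero)
  open SemiringDefinitions (Semiring.rawSemiring semiring) using (_^_)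
  open SemiringDivisibility semiring public
  open IntegerScalars R
  open Solver using (solve; _:=_; _:*_)

  -- Only linear factors are ever cancelled. Cancellability of such a single element holds over
  -- every commutative ring, so polynomials need not be shown to form an integral domain.
  Cancellable : Carrier → Set _
  Cancellable x = ∀ a b → x * a ≈ x * b → a ≈ b

  ^∣-uncons : ∀ {x p q} k → Cancellable x → x * q ≈ p → x ^ suc k ∣ p → x ^ k ∣ q
  ^∣-uncons {x} {p} {q} k cancel xq≈p (r , eq) = r , cancel (r * x ^ k) q
    (trans (solve 3 (λ x r y → x :* (r :* y) := r :* (x :* y)) refl x r (x ^ k)) (trans eq (sym xq≈p)))

  ^∣-cons : ∀ {x p q} k → x * q ≈ p → x ^ k ∣ q → x ^ suc k ∣ p
  ^∣-cons {x} {p} {q} k xq≈p (r , eq) = r ,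
    trans (solve 3 (λ x r y → r :* (x :* y) := x :* (r :* y)) refl x r (x ^ k)) (trans (*-congˡ eq) xq≈p)

  ^∣-* : ∀ {x y p q} k → y * q ≈ p → x ^ k ∣ q → x ^ k ∣ p
  ^∣-* k yq≈p d = ∣ʳ-respʳ-≈ yq≈p (x∣ʳy⇒x∣ʳzy _ d)

  ^∣^ : ∀ x {m k} → m ≤ k → x ^ m ∣ x ^ k
  ^∣^ x {k = k} z≤n = x ^ k , *-identityʳ _
  ^∣^ x (s≤s {m} m≤k) = ^∣-cons m refl (^∣^ x m≤k)

  ^∣-≤ : ∀ {x p m k} → m ≤ k → x ^ k ∣ p → x ^ m ∣ p
  ^∣-≤ {x} m≤k = ∣ʳ-trans (^∣^ x m≤k)

  ^-congˡ : ∀ {x y} k → x ≈ y → x ^ k ≈ y ^ k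
  ^-congˡ zero x≈y = refl
  ^-congˡ (suc k) x≈y = *-cong x≈y (^-congˡ k x≈y)

  ^∣-respˡ : ∀ {x y p} k → x ≈ y → x ^ k ∣ p → y ^ k ∣ p
  ^∣-respˡ k x≈y = ∣ʳ-respˡ-≈ (^-congˡ k x≈y)

  factor⇒∣ : ∀ x {q p} → x * q ≈ p → x ^ 1 ∣ p
  factor⇒∣ x {q} xq≈p = q , trans (trans (*-congˡ (*-identityʳ x)) (*-comm _ _)) xq≈p

  ∣⇒factor : ∀ {x p} k → (d : x ^ suc k ∣ p) → ∃[ q ] x * q ≈ p
  ∣⇒factor {x} k (r , eq) = r * x ^ k , trans (solve 3 (λ x r y → x :* (r :* y) := r :* (x :* y)) refl x r (x ^ k)) eq

  ^-∣-scale : ∀ {u x y p} k → y ≈ u * x → y ^ k ∣ p → x ^ k ∣ p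
  ^-∣-scale {u} {x} {y} k y≈ux (r , eq) = r * u ^ k ,
    trans (*-assoc _ _ _) (trans (*-congˡ (sym (trans (^-congˡ k y≈ux) (CommutativeSemiringExp.^-distrib-* commutativeSemiring u x k)))) eq)

module _ {a ℓ₁ b ℓ₂} (R : CommutativeRing a ℓ₁) (S : CommutativeRing b ℓ₂)
  {f : CommutativeRing.Carrier R → CommutativeRing.Carrier S}
  (f-homo : IsRingHomomorphism (CommutativeRing.rawRing R) (CommutativeRing.rawRing S) f) where

  private
    module R = CommutativeRing R
    module S = CommutativeRing S
    open module f = IsRingHomomorphism f-homo
    open SemiringDefinitions (Semiring.rawSemiring R.semiring) using () renaming (_^_ to _^ᴿ_)
    open SemiringDefinitions (Semiring.rawSemiring S.semiring) using () renaming (_^_ to _^ˢ_)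
    open PowerDivisibility using (_∣_)
    open PowerDivisibility S using (_,_)

  ^∣-homo : ∀ {x p} k → _∣_ R (x ^ᴿ k) p → _∣_ S (f x ^ˢ k) (f p)
  ^∣-homo {x} k (r , eq) = f r , S.trans (S.*-congˡ (S.sym (^-homo R S f-homo x k)))
    (S.trans (S.sym (f.*-homo r (x ^ᴿ k))) (f.⟦⟧-cong eq))

module LinearFactors {c ℓ} (R : CommutativeRing c ℓ) where
  open CommutativeRing R hiding (zero)
  open RingProperties ring
  open PolynomialRing R public
  open Polynomial rawRing public using (_^ₚ_; _∣ₚ_; _∤ₚ_)
  open IntegerScalars R using (module Solver)
  open Solver using (solve; _:=_; _:+_; _:*_; :-_; _:-_)
  open SetoidReasoning setoid
  module P = CommutativeRing polyRing
  module PD = PowerDivisibility polyRing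

  linear : Carrier → Poly
  linear μ = X +ₚ const (- μ)

  linear-cong : ∀ {μ ν} → μ ≈ ν → linear μ ≈ₚ linear ν
  linear-cong μ≈ν zero = +-congˡ (-‿cong μ≈ν)
  linear-cong μ≈ν (suc k) = refl

  coeff-linear*-0 : ∀ μ q → coeff (linear μ *ₚ q) 0 ≈ - μ * coeff q 0
  coeff-linear*-0 μ q = trans (coeff-* (linear μ) q 0) (*-congʳ (+-identityˡ _))

  coeff-linear*-suc : ∀ μ q k → coeff (linear μ *ₚ q) (suc k) ≈ - μ * coeff q (suc k) + coeff q k
  coeff-linear*-suc μ q k = trans (coeff-* (linear μ) q (suc k)) (+-cong (*-congʳ (+-identityˡ _))
    (trans (sym (coeff-* (const 1#) q k)) (trans (coeff-const* 1# q k) (*-identityˡ _))))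

  -- The length of a list is no degree, because trailing zeros are allowed; hence a bound on
  -- coefficients.
  Degree≤ : Poly → ℕ → Set _
  Degree≤ p d = ∀ k → d < k → coeff p k ≈ 0#

  coeff-length : ∀ p k → length p ≤ k → coeff p k ≈ 0#
  coeff-length [] k _ = refl
  coeff-length (a ∷ p) (suc k) (s≤s l≤k) = coeff-length p k l≤k

  -- The leading coefficient of `linear μ` is one, so coefficient `k` of a cofactor is determined by
  -- the product and by its coefficient `k + 1`. Facts about cofactors therefore spread downwards
  -- from beyond the length of the list, where all coefficients are zero.
  downward : ∀ {ℓ′} {P : ℕ → Set ℓ′} N → (∀ k → N ≤ k → P k) → (∀ k → P (suc k) → P k) → ∀ k → P k
  downward zero above step k = above k z≤n
  downward (suc N) above step k = downward N
    (λ j N≤j → step j (above (suc j) (s≤s N≤j))) step k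

  linear-cancel : ∀ μ → PD.Cancellable (linear μ)
  linear-cancel μ p q eq = downward (length p ℕ.⊔ length q)
    (λ k N≤k → trans (coeff-length p k (ℕ.m⊔n≤o⇒m≤o (length p) (length q) N≤k))
                     (sym (coeff-length q k (ℕ.m⊔n≤o⇒n≤o (length p) (length q) N≤k))))
    (λ k pq → begin
      coeff p k                                             ≈⟨ solve 2 (λ x y → x := (:- y) :+ (y :+ x)) refl (coeff p k) (- μ * coeff p (suc k)) ⟩
      - (- μ * coeff p (suc k)) + (- μ * coeff p (suc k) + coeff p k) ≈⟨ +-cong (-‿cong (*-congˡ pq)) (sym (coeff-linear*-suc μ p k)) ⟩
      - (- μ * coeff q (suc k)) + coeff (linear μ *ₚ p) (suc k) ≈⟨ +-congˡ (trans (eq (suc k)) (coeff-linear*-suc μ q k)) ⟩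
      - (- μ * coeff q (suc k)) + (- μ * coeff q (suc k) + coeff q k) ≈⟨ solve 2 (λ x y → x := (:- y) :+ (y :+ x)) refl (coeff q k) (- μ * coeff q (suc k)) ⟨
      coeff q k ∎)

  linear-degree : ∀ μ {p q d} → linear μ *ₚ q ≈ₚ p → Degree≤ p (suc d) → Degree≤ q d
  linear-degree μ {p} {q} {d} eq p≤ = downward (length q) (λ k l≤k _ → coeff-length q k l≤k) λ k above d<k → begin
    coeff q k                              ≈⟨ +-identityˡ _ ⟨
    0# + coeff q k                         ≈⟨ +-congʳ (trans (*-congˡ (above (ℕ.m<n⇒m<1+n d<k))) (zeroʳ _)) ⟨
    - μ * coeff q (suc k) + coeff q k      ≈⟨ coeff-linear*-suc μ q k ⟨
    coeff (linear μ *ₚ q) (suc k)          ≈⟨ eq (suc k) ⟩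
    coeff p (suc k)                        ≈⟨ p≤ (suc k) (s≤s d<k) ⟩
    0#                                     ∎

  linear-leading : ∀ μ {p q d} → linear μ *ₚ q ≈ₚ p → Degree≤ p (suc d) → coeff q d ≈ coeff p (suc d)
  linear-leading μ {p} {q} {d} eq p≤ = begin
    coeff q d                              ≈⟨ +-identityˡ _ ⟨
    0# + coeff q d                         ≈⟨ +-congʳ (trans (*-congˡ (linear-degree μ {p} {q} eq p≤ (suc d) ℕ.≤-refl)) (zeroʳ _)) ⟨
    - μ * coeff q (suc d) + coeff q d      ≈⟨ coeff-linear*-suc μ q d ⟨
    coeff (linear μ *ₚ q) (suc d)          ≈⟨ eq (suc d) ⟩
    coeff p (suc d)                        ∎

  module eval {x : Carrier} = IsRingHomomorphism (evalHomomorphism x)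

  eval-linear : ∀ μ x → eval (linear μ) x ≈ x - μ
  eval-linear μ x = trans (+-cong (+-identityˡ _) (trans (*-congˡ (trans (+-congˡ (zeroʳ x)) (+-identityʳ _))) (*-identityʳ x))) (+-comm _ _)

  factor⇒root : ∀ μ {p} q → linear μ *ₚ q ≈ₚ p → eval p μ ≈ 0#
  factor⇒root μ {p} q eq = begin
    eval p μ                         ≈⟨ eval.⟦⟧-cong {μ} {linear μ *ₚ q} {p} eq ⟨
    eval (linear μ *ₚ q) μ           ≈⟨ eval.*-homo (linear μ) q ⟩
    eval (linear μ) μ * eval q μ     ≈⟨ *-congʳ (trans (eval-linear μ μ) (-‿inverseʳ μ)) ⟩
    0# * eval q μ                    ≈⟨ zeroˡ _ ⟩
    0#                               ∎

  -- Horner's scheme.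
  divide : Carrier → Poly → Poly
  divide μ []      = []
  divide μ (a ∷ p) = eval p μ ∷ divide μ p

  divide-correct : ∀ μ p → linear μ *ₚ divide μ p +ₚ const (eval p μ) ≈ₚ p
  divide-correct μ p zero = trans (coeff-+ (linear μ *ₚ divide μ p) (const (eval p μ)) 0)
    (trans (+-congʳ (coeff-linear*-0 μ (divide μ p))) (low p))
    where
    low : ∀ p → - μ * coeff (divide μ p) 0 + eval p μ ≈ coeff p 0
    low [] = trans (+-identityʳ _) (zeroʳ _)
    low (a ∷ p) = solve 3 (λ m e a → :- m :* e :+ (a :+ m :* e) := a) refl μ (eval p μ) a
  divide-correct μ p (suc k) = trans (coeff-+ (linear μ *ₚ divide μ p) (const (eval p μ)) (suc k))
    (trans (+-identityʳ _) (trans (coeff-linear*-suc μ (divide μ p) k) (high p k)))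
    where
    high : ∀ p k → - μ * coeff (divide μ p) (suc k) + coeff (divide μ p) k ≈ coeff p (suc k)
    high [] k = trans (+-identityʳ _) (zeroʳ _)
    -- This is the equation that `low` gives for `p`, recovered from the constant coefficient of
    -- `divide-correct μ p`.
    high (a ∷ p) zero = trans (sym (trans (coeff-+ (linear μ *ₚ divide μ p) (const (eval p μ)) 0) (+-congʳ (coeff-linear*-0 μ (divide μ p))))) (divide-correct μ p zero)
    high (a ∷ p) (suc k) = high p k

  root⇒factor : ∀ μ p → eval p μ ≈ 0# → linear μ *ₚ divide μ p ≈ₚ p
  root⇒factor μ p root k = begin
    coeff (linear μ *ₚ divide μ p) k                                   ≈⟨ +-identityʳ _ ⟨
    coeff (linear μ *ₚ divide μ p) k + 0#                              ≈⟨ +-congˡ (zero-const k) ⟨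
    coeff (linear μ *ₚ divide μ p) k + coeff (const (eval p μ)) k      ≈⟨ coeff-+ (linear μ *ₚ divide μ p) (const (eval p μ)) k ⟨
    coeff (linear μ *ₚ divide μ p +ₚ const (eval p μ)) k               ≈⟨ divide-correct μ p k ⟩
    coeff p k                                                          ∎
    where
    zero-const : ∀ k → coeff (const (eval p μ)) k ≈ 0#
    zero-const zero = root
    zero-const (suc k) = refl

  reflect-linear : ∀ μ → reflect (linear (- μ)) ≈ₚ const (- 1#) *ₚ linear μ
  reflect-linear μ zero = trans (solve 2 (λ o m → o :+ :- (:- m) := o :+ m) refl 0# μ)
    (sym (trans (coeff-const* (- 1#) (linear μ) 0) (trans (-1*x≈-x _) (trans (-‿cong (+-identityˡ _)) (trans (-‿involutive μ) (sym (+-identityˡ μ)))))))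
  reflect-linear μ (suc zero) = sym (trans (coeff-const* (- 1#) (linear μ) 1) (*-identityʳ _))
  reflect-linear μ (suc (suc k)) = sym (trans (coeff-const* (- 1#) (linear μ) (suc (suc k))) (zeroʳ _))

  -- Substitution of - X turns the factor at `- μ` into minus the factor at `μ`, and the sign is
  -- absorbed by the quotient.
  reflect-∣ : ∀ μ {p} k → linear (- μ) ^ₚ k ∣ₚ p → linear μ ^ₚ k ∣ₚ reflect p
  reflect-∣ μ {p} k d = PD.^-∣-scale {const (- 1#)} {linear μ} {reflect (linear (- μ))} {reflect p} k (reflect-linear μ)
    (^∣-homo polyRing polyRing reflectHomomorphism {linear (- μ)} {p} k d)

-- Roots and multiplicities over a field

module FieldRoots {c ℓ} (R : CommutativeRing c ℓ)
  (zero-or-unit : ZeroOrUnit R) (1≉0 : Nontrivial R) where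
  open CommutativeRing R hiding (zero)
  open RingProperties ring
  open LinearFactors R
  open PD using (_,_)
  open SetoidReasoning setoid

  unit⇒≉0 : ∀ {x} → ∃[ y ] y * x ≈ 1# → ¬ x ≈ 0#
  unit⇒≉0 (y , yx≈1) x≈0 = 1≉0 (trans (sym yx≈1) (trans (*-congˡ x≈0) (zeroʳ y)))

  zero-product : ∀ {x y} → ¬ x ≈ 0# → x * y ≈ 0# → y ≈ 0#
  zero-product {x} {y} x≉0 xy≈0 with zero-or-unit x
  ... | inj₁ x≈0 = contradiction x≈0 x≉0
  ... | inj₂ (z , zx≈1) = begin
    y             ≈⟨ *-identityˡ y ⟨
    1# * y        ≈⟨ *-congʳ zx≈1 ⟨
    z * x * y     ≈⟨ *-assoc z x y ⟩
    z * (x * y)   ≈⟨ trans (*-congˡ xy≈0) (zeroʳ z) ⟩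
    0#            ∎

  -- Induction on the degree bound: dividing out a root lowers both the bound and the multiplicity
  -- by one, and at a non-root the multiplicity is 0. With bound 0 a root would make the nonzero
  -- constant vanish.
  multiplicity-exists : ∀ μ d p → Degree≤ p d → ¬ coeff p d ≈ 0# →
    ∃[ m ] (linear μ ^ₚ m ∣ₚ p × linear μ ^ₚ suc m ∤ₚ p)
  multiplicity-exists μ d p p≤d lead≉0 with zero-or-unit (eval p μ)
  ... | inj₂ unit = 0 , (p , P.*-identityʳ p) , λ d →
    let q , eq = PD.∣⇒factor {linear μ} {p} 0 d in unit⇒≉0 unit (factor⇒root μ {p} q eq)
  multiplicity-exists μ zero p p≤d lead≉0 | inj₁ root = contradiction
    (begin
      coeff p 0                       ≈⟨ trans (+-congˡ (zeroʳ μ)) (+-identityʳ _) ⟨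
      eval (const (coeff p 0)) μ      ≈⟨ eval.⟦⟧-cong {μ} {p} {const (coeff p 0)} (λ { zero → refl ; (suc k) → p≤d (suc k) (s≤s z≤n) }) ⟨
      eval p μ                        ≈⟨ root ⟩
      0#                              ∎)
    lead≉0
  multiplicity-exists μ (suc d) p p≤d lead≉0 | inj₁ root
    with multiplicity-exists μ d q (linear-degree μ {p} {q} eq p≤d) (λ q≈0 → lead≉0 (trans (sym (linear-leading μ {p} {q} eq p≤d)) q≈0))
    where
    q = divide μ p
    eq = root⇒factor μ p root
  ... | m , m∣ , m∤ = suc m , PD.^∣-cons {linear μ} {p} {divide μ p} m (root⇒factor μ p root) m∣ ,
    λ d → m∤ (PD.^∣-uncons {linear μ} {p} {divide μ p} (suc m) (linear-cancel μ) (root⇒factor μ p root) d)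

  -- Induction on `k`: `ν` is a root of `p` but not of `linear μ`, hence of `q`, and one factor
  -- `linear ν` can be cancelled from both `p` and `q`.
  coprime-linear : ∀ {μ ν} → ¬ ν ≈ μ → ∀ k {p q} → linear μ *ₚ q ≈ₚ p → linear ν ^ₚ k ∣ₚ p → linear ν ^ₚ k ∣ₚ q
  coprime-linear ν≉μ zero {q = q} eq d = q , P.*-identityʳ q
  coprime-linear {μ} {ν} ν≉μ (suc k) {p} {q} eq d =
    PD.^∣-cons {linear ν} {q} {q′} k q≈ (coprime-linear ν≉μ k {linear μ *ₚ q′} {q′} (λ _ → refl)
      (PD.^∣-uncons {linear ν} {p} {linear μ *ₚ q′} k (linear-cancel ν) p≈ d))
    where
    factor = PD.∣⇒factor {linear ν} {p} k d
    root : eval q ν ≈ 0#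
    root = zero-product (λ ν-μ≈0 → ν≉μ (x∙y⁻¹≈ε⇒x≈y ν μ ν-μ≈0)) (begin
      (ν - μ) * eval q ν               ≈⟨ *-congʳ (eval-linear μ ν) ⟨
      eval (linear μ) ν * eval q ν     ≈⟨ eval.*-homo (linear μ) q ⟨
      eval (linear μ *ₚ q) ν           ≈⟨ eval.⟦⟧-cong {ν} {linear μ *ₚ q} {p} eq ⟩
      eval p ν                         ≈⟨ factor⇒root ν {p} (proj₁ factor) (proj₂ factor) ⟩
      0#                               ∎)
    q′ = divide ν q
    q≈ : linear ν *ₚ q′ ≈ₚ q
    q≈ = root⇒factor ν q root
    p≈ : linear ν *ₚ (linear μ *ₚ q′) ≈ₚ p
    p≈ = P.trans {linear ν *ₚ (linear μ *ₚ q′)} {linear μ *ₚ (linear ν *ₚ q′)} {p}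
      (x∙yz≈y∙xz (linear ν) (linear μ) q′)
      (P.trans {linear μ *ₚ (linear ν *ₚ q′)} {linear μ *ₚ q} {p} (P.*-congˡ {linear μ} {linear ν *ₚ q′} {q} q≈) eq)
      where open CommutativeSemigroupProperties P.*-commutativeSemigroup using (x∙yz≈y∙xz)

  module _ (closed : ∀ p k → ¬ coeff p (suc k) ≈ 0# → ∃[ x ] eval p x ≈ 0#) where

    -- The roots of p are stripped from both polynomials one at a time.
    determined-by-roots : ∀ d p q → Degree≤ p d → Degree≤ q d →
      coeff p d ≈ coeff q d → ¬ coeff p d ≈ 0# →
      (∀ μ k → linear μ ^ₚ k ∣ₚ p → linear μ ^ₚ k ∣ₚ q) → p ≈ₚ q
    determined-by-roots zero p q p≤ q≤ lead _ _ zero = lead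
    determined-by-roots zero p q p≤ q≤ lead _ _ (suc k) = trans (p≤ (suc k) (s≤s z≤n)) (sym (q≤ (suc k) (s≤s z≤n)))
    determined-by-roots (suc d) p q p≤ q≤ lead lead≉0 roots =
      P.trans {p} {linear μ *ₚ p′} {q} (P.sym {linear μ *ₚ p′} {p} p≈)
        (P.trans {linear μ *ₚ p′} {linear μ *ₚ q′} {q} (P.*-congˡ {linear μ} {p′} {q′} p′≈q′) q≈)
      where
      μ = proj₁ (closed p d lead≉0)
      root = proj₂ (closed p d lead≉0)
      p′ = divide μ p
      p≈ = root⇒factor μ p root
      q-factor = PD.∣⇒factor {linear μ} {q} 0 (roots μ 1 (PD.factor⇒∣ (linear μ) {p′} {p} p≈))
      q′ = proj₁ q-factor
      q≈ = proj₂ q-factor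
      p′-lead = linear-leading μ {p} {p′} p≈ p≤
      roots′ : ∀ ν k → linear ν ^ₚ k ∣ₚ p′ → linear ν ^ₚ k ∣ₚ q′
      roots′ ν k d with zero-or-unit (ν - μ)
      ... | inj₁ ν-μ≈0 = PD.^∣-respˡ {linear μ} {linear ν} k (linear-cong (sym ν≈μ))
            (PD.^∣-uncons {linear μ} {q} {q′} k (linear-cancel μ) q≈ (roots μ (suc k)
              (PD.^∣-cons {linear μ} {p} {p′} k p≈ (PD.^∣-respˡ {linear ν} {linear μ} k (linear-cong ν≈μ) d))))
        where ν≈μ = x∙y⁻¹≈ε⇒x≈y ν μ ν-μ≈0
      ... | inj₂ unit = coprime-linear ν≉μ k {q} {q′} q≈ (roots ν k (PD.^∣-* {linear ν} {linear μ} {p} {p′} k p≈ d))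
        where
        ν≉μ : ¬ ν ≈ μ
        ν≉μ ν≈μ = unit⇒≉0 unit (trans (+-congʳ ν≈μ) (-‿inverseʳ μ))
      p′≈q′ : p′ ≈ₚ q′
      p′≈q′ = determined-by-roots d p′ q′ (linear-degree μ {p} {p′} p≈ p≤) (linear-degree μ {q} {q′} q≈ q≤)
        (trans p′-lead (trans lead (sym (linear-leading μ {q} {q′} q≈ q≤))))
        (λ p′≈0 → lead≉0 (trans (sym p′-lead) p′≈0)) roots′

-- Characteristic polynomials and symmetric spectra

module CharacteristicPolynomial {c ℓ} (R : CommutativeRing c ℓ) where
  open CommutativeRing R hiding (zero)
  open RingProperties ring
  open LinearFactors R
  open Convolution R
  open SemiringDefinitions (Semiring.rawSemiring semiring) using (_^_)
  open SemiringSum semiring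
  open DeterminantTheory R
  open Spectrum rawRing public using (charPoly)
  open SetoidReasoning setoid
  private
    module Det[X] = DeterminantTheory polyRing
    open SemiringDefinitions (RawRing.rawSemiring polyRawRing) using () renaming (sum to sumᵖ)

  conv-const : ∀ f g k → (∀ j → f (suc j) ≈ 0#) → conv f g k ≈ f 0 * g k
  conv-const f g zero    f≈0 = refl
  conv-const f g (suc k) f≈0 = trans (+-congˡ (trans (conv-cong f≈0 (λ _ → refl) k) (conv-zeroˡ g k))) (+-identityʳ _)

  coeff-affine*-suc : ∀ a q k → Degree≤ a 1 → coeff (a *ₚ q) (suc k) ≈ coeff a 0 * coeff q (suc k) + coeff a 1 * coeff q k
  coeff-affine*-suc a q k a≤1 = trans (coeff-* a q (suc k))
    (+-congˡ (conv-const (coeff a ∘ suc) (coeff q) k (λ j → a≤1 (suc (suc j)) (s≤s (s≤s z≤n)))))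

  coeff-sum : ∀ {n} (t : Fin n → Poly) k → coeff (sumᵖ t) k ≈ sum (λ i → coeff (t i) k)
  coeff-sum {zero} t k = refl
  coeff-sum {suc n} t k = trans (coeff-+ (t zero) _ k) (+-congˡ (coeff-sum (t ∘ suc) k))

  coeff-sign* : ∀ j q k → coeff ((map (-_) (1# ∷ [])) ^ₚ j *ₚ q) k ≈ (- 1#) ^ j * coeff q k
  coeff-sign* zero q k = coeff-const* 1# q k
  coeff-sign* (suc j) q k = begin
    coeff ((const (- 1#) *ₚ s) *ₚ q) k      ≈⟨ P.*-assoc (const (- 1#)) s q k ⟩
    coeff (const (- 1#) *ₚ (s *ₚ q)) k      ≈⟨ coeff-const* (- 1#) (s *ₚ q) k ⟩
    - 1# * coeff (s *ₚ q) k                 ≈⟨ *-congˡ (coeff-sign* j q k) ⟩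
    - 1# * ((- 1#) ^ j * coeff q k)         ≈⟨ *-assoc _ _ _ ⟨
    - 1# * (- 1#) ^ j * coeff q k           ∎
    where s = (map (-_) (1# ∷ [])) ^ₚ j

  AffineMatrix : ∀ {n} → Det[X].Mat n → Set _
  AffineMatrix M = ∀ i j → Degree≤ (M i j) 1

  coeff-det : ∀ {n} (M : Det[X].Mat (suc n)) k →
    coeff (Det[X].det M) k ≈ sum (λ j → (- 1#) ^ toℕ j * coeff (M zero j *ₚ Det[X].det (Det[X].minor M j)) k)
  coeff-det M k = trans (coeff-sum (Det[X].laplaceTerm M) k)
    (sum-cong-≋ λ j → coeff-sign* (toℕ j) (M zero j *ₚ Det[X].det (Det[X].minor M j)) k)

  det-degree : ∀ {n} (M : Det[X].Mat n) → AffineMatrix M → Degree≤ (Det[X].det M) n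
  det-degree {zero} M M≤1 (suc k) _ = refl
  det-degree {suc n} M M≤1 (suc k) (s≤s n<k) = trans (coeff-det M (suc k)) (sum-zero λ j →
    trans (*-congˡ {(- 1#) ^ toℕ j} (begin
      coeff (M zero j *ₚ D j) (suc k)                                     ≈⟨ coeff-affine*-suc (M zero j) (D j) k (M≤1 zero j) ⟩
      coeff (M zero j) 0 * coeff (D j) (suc k) + coeff (M zero j) 1 * coeff (D j) k
        ≈⟨ +-cong (trans (*-congˡ (minor≤ j (suc k) (ℕ.m<n⇒m<1+n n<k))) (zeroʳ _)) (trans (*-congˡ (minor≤ j k n<k)) (zeroʳ _)) ⟩
      0# + 0#                                                             ≈⟨ +-identityʳ 0# ⟩
      0#                                                                  ∎)) (zeroʳ _))
    where
    D = λ j → Det[X].det (Det[X].minor M j)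
    minor≤ : ∀ j → Degree≤ (D j) n
    minor≤ j = det-degree (Det[X].minor M j) λ i l → M≤1 (suc i) (punchIn j l)

  -- In each product of the expansion the power X^n arises only if every factor contributes its
  -- linear term. For `charMatrix` these terms form the identity matrix, so `charPoly` is monic.
  det-leading : ∀ {n} (M : Det[X].Mat n) → AffineMatrix M → coeff (Det[X].det M) n ≈ det (λ i j → coeff (M i j) 1)
  det-leading {zero} M M≤1 = refl
  det-leading {suc n} M M≤1 = trans (coeff-det M (suc n)) (sum-cong-≋ λ j → *-congˡ {(- 1#) ^ toℕ j} (begin
    coeff (M zero j *ₚ D j) (suc n)                                     ≈⟨ coeff-affine*-suc (M zero j) (D j) n (M≤1 zero j) ⟩
    coeff (M zero j) 0 * coeff (D j) (suc n) + coeff (M zero j) 1 * coeff (D j) n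
      ≈⟨ +-cong (trans (*-congˡ (det-degree (Det[X].minor M j) (minor-affine j) (suc n) ℕ.≤-refl)) (zeroʳ _))
                (*-congˡ (det-leading (Det[X].minor M j) (minor-affine j))) ⟩
    0# + coeff (M zero j) 1 * det (minor (λ i j → coeff (M i j) 1) j)   ≈⟨ +-identityˡ _ ⟩
    coeff (M zero j) 1 * det (minor (λ i j → coeff (M i j) 1) j)        ∎))
    where
    D = λ j → Det[X].det (Det[X].minor M j)
    minor-affine : ∀ j → AffineMatrix (Det[X].minor M j)
    minor-affine j i l = M≤1 (suc i) (punchIn j l)

  -- The matrix under the determinant in `charPoly`, named so that `charPoly A` is
  -- `det (charMatrix A)` by definition.
  charMatrix : ∀ {n} → Mat n → Det[X].Mat n
  charMatrix A i j = (if does (i Fin.≟ j) then X else []) +ₚ const (- A i j)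

  charMatrix-affine : ∀ {n} (A : Mat n) → AffineMatrix (charMatrix A)
  charMatrix-affine A i j with does (i Fin.≟ j)
  ... | true  = λ { (suc (suc k)) _ → refl ; (suc zero) (s≤s ()) }
  ... | false = λ { (suc (suc k)) _ → refl ; (suc zero) (s≤s ()) }

  charPoly-degree : ∀ {n} (A : Mat n) → Degree≤ (charPoly A) n
  charPoly-degree A = det-degree (charMatrix A) (charMatrix-affine A)

  charPoly-monic : ∀ {n} (A : Mat n) → coeff (charPoly A) n ≈ 1#
  charPoly-monic {n} A = trans (det-leading (charMatrix A) (charMatrix-affine A)) (trans (det-cong coeff-1) (det-δ n))
    where
    coeff-1 : ∀ i j → coeff (charMatrix A i j) 1 ≈ δ i j
    coeff-1 i j with does (i Fin.≟ j)
    ... | true = refl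
    ... | false = refl

  shifted : ∀ {n} → Mat n → Carrier → Mat n
  shifted A μ i j = (if does (i Fin.≟ j) then μ else 0#) - A i j

  eval-charPoly : ∀ {n} (A : Mat n) μ → eval (charPoly A) μ ≈ det (shifted A μ)
  eval-charPoly A μ = trans (det-homo polyRing R (evalHomomorphism μ) (charMatrix A)) (det-cong entry)
    where
    entry : ∀ i j → eval (charMatrix A i j) μ ≈ shifted A μ i j
    entry i j with does (i Fin.≟ j)
    ... | true = eval-linear (A i j) μ
    ... | false = trans (+-congˡ (zeroʳ μ)) (+-comm _ _)

  shifted-* : ∀ {n} (A : Mat n) μ (v : Fin n → Carrier) i →
    sum (λ j → shifted A μ i j * v j) ≈ μ * v i - sum (λ j → A i j * v j)
  shifted-* A μ v i = begin
    sum (λ j → shifted A μ i j * v j)                           ≈⟨ sum-cong-≋ (λ j → trans (distribʳ (v j) (diag j) (- A i j))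
                                                                      (+-cong (sym (*-identityˡ _)) (trans (sym (-‿distribˡ-* (A i j) (v j))) (sym (-1*x≈-x _))))) ⟩
    sum (λ j → 1# * (diag j * v j) + - 1# * (A i j * v j))       ≈⟨ sum-linear 1# (- 1#) (λ j → diag j * v j) (λ j → A i j * v j) ⟩
    1# * sum (λ j → diag j * v j) + - 1# * sum (λ j → A i j * v j) ≈⟨ +-cong (trans (*-identityˡ _) diagonal) (-1*x≈-x _) ⟩
    μ * v i - sum (λ j → A i j * v j)                            ∎
    where
    diag : Fin _ → Carrier
    diag j = if does (i Fin.≟ j) then μ else 0#
    diag-i : diag i ≡ μ
    diag-i rewrite dec-true (i Fin.≟ i) ≡.refl = ≡.refl
    diag-≢ : ∀ {j} → j ≢ i → diag j ≡ 0#
    diag-≢ {j} j≢i rewrite dec-false (i Fin.≟ j) (j≢i ∘ ≡.sym) = ≡.refl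
    diagonal : sum (λ j → diag j * v j) ≈ μ * v i
    diagonal = trans (sum-single {f = λ j → diag j * v j} i (λ j j≢i → trans (*-congʳ (reflexive (diag-≢ j≢i))) (zeroˡ _)))
      (*-congʳ (reflexive diag-i))

  -- p (x) = (-1)ⁿ p (- x).
  Alternates : ℕ → Poly → Set ℓ
  Alternates n p = ∀ k → coeff p k ≈ (- 1#) ^ n * ((- 1#) ^ k * coeff p k)

module FieldSpectrum {c ℓ} (R : CommutativeRing c ℓ)
  (zero-or-unit : ZeroOrUnit R) (1≉0 : Nontrivial R) where
  open CommutativeRing R hiding (zero)
  open RingProperties ring
  open LinearFactors R
  open CharacteristicPolynomial R
  open DeterminantTheory R using (Mat)
  open DeterminantKernel R
  open FieldRoots R zero-or-unit 1≉0
  open SemiringDefinitions (Semiring.rawSemiring semiring) using (_^_)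
  open SemiringSum semiring using (sum)
  open Spectrum rawRing using (IsEigenvalue; SymmetricSpectrum)

  -- `SymmetricSpectrum` with roots in place of eigenvalues; it depends on the polynomial alone.
  SymmetricRoots : Poly → Set _
  SymmetricRoots p = ∀ μ → eval p μ ≈ 0# → eval p (- μ) ≈ 0# ×
    ∃[ m ] ((linear μ ^ₚ m ∣ₚ p × linear μ ^ₚ suc m ∤ₚ p) × (linear (- μ) ^ₚ m ∣ₚ p × linear (- μ) ^ₚ suc m ∤ₚ p))

  module _ n (p : Poly) (p≤n : Degree≤ p n) (p-monic : coeff p n ≈ 1#) where

    private
      lead≉0 : ¬ coeff p n ≈ 0#
      lead≉0 lead≈0 = 1≉0 (trans (sym p-monic) lead≈0)

      -- The reflected polynomial, made monic again by the sign (-1)^n. `Alternates n p` says that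
      -- `p` and `q` agree.
      q = const ((- 1#) ^ n) *ₚ reflect p

      coeff-q : ∀ k → coeff q k ≈ (- 1#) ^ n * ((- 1#) ^ k * coeff p k)
      coeff-q k = trans (coeff-const* ((- 1#) ^ n) (reflect p) k) (*-congˡ (coeff-reflect p k))

      p∣⇒q∣ : ∀ μ k → linear (- μ) ^ₚ k ∣ₚ p → linear μ ^ₚ k ∣ₚ q
      p∣⇒q∣ μ k d = PD.^∣-* {linear μ} {const ((- 1#) ^ n)} {q} {reflect p} k (λ _ → refl) (reflect-∣ μ {p} k d)

    -- Since `p` agrees with its reflection, divisibility by a power of the factor at `μ` passes to
    -- `- μ`. Applied at `- μ` it comes back, so the two multiplicities bound each other.
    alternates⇒symmetricRoots : Alternates n p → SymmetricRoots p
    alternates⇒symmetricRoots alt μ root =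
      -root , m , (m∣ , m∤) , (∣-neg m m∣ , λ d → m∤ (PD.^∣-respˡ {linear (- - μ)} {linear μ} {p} (suc m) (linear-cong (-‿involutive μ)) (∣-neg (suc m) d)))
      where
      ∣-neg : ∀ {μ} k → linear μ ^ₚ k ∣ₚ p → linear (- μ) ^ₚ k ∣ₚ p
      ∣-neg {μ} k d = PD.∣ʳ-respʳ-≈ {linear (- μ) ^ₚ k} {q} {p} (λ j → trans (coeff-q j) (sym (alt j)))
        (p∣⇒q∣ (- μ) k (PD.^∣-respˡ {linear μ} {linear (- - μ)} {p} k (linear-cong (sym (-‿involutive μ))) d))
      -factor = PD.∣⇒factor {linear (- μ)} {p} 0 (∣-neg 1 (PD.factor⇒∣ (linear μ) {divide μ p} {p} (root⇒factor μ p root)))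
      -root : eval p (- μ) ≈ 0#
      -root = factor⇒root (- μ) {p} (proj₁ -factor) (proj₂ -factor)
      mult = multiplicity-exists μ n p p≤n lead≉0
      m = proj₁ mult
      m∣ = proj₁ (proj₂ mult)
      m∤ = proj₂ (proj₂ mult)

    module _ (closed : ∀ p k → ¬ coeff p (suc k) ≈ 0# → ∃[ x ] eval p x ≈ 0#) where

      -- A power of the factor at `μ` that divides `p` has its counterpart at `- μ` by symmetry, and
      -- reflection takes this to a divisor of `q` at `μ`. This one inclusion suffices, as both
      -- polynomials are monic of degree `n`.
      symmetricRoots⇒alternates : SymmetricRoots p → Alternates n p
      symmetricRoots⇒alternates symm k = trans (p≈q k) (coeff-q k)
        where
        p∣⇒q∣′ : ∀ μ k → linear μ ^ₚ k ∣ₚ p → linear μ ^ₚ k ∣ₚ q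
        -- For exponent 0 `μ` need not be a root, so the hypothesis gives nothing about it.
        p∣⇒q∣′ μ zero d = q , P.*-identityʳ q
          where open PD using (_,_)
        p∣⇒q∣′ μ (suc k) d = p∣⇒q∣ μ (suc k) (PD.^∣-≤ {linear (- μ)} {p} {suc k} {m} k<m -m∣)
          where
          factor = PD.∣⇒factor {linear μ} {p} k d
          symm-μ = proj₂ (symm μ (factor⇒root μ {p} (proj₁ factor) (proj₂ factor)))
          m = proj₁ symm-μ
          m∤ = proj₂ (proj₁ (proj₂ symm-μ))
          -m∣ = proj₁ (proj₂ (proj₂ symm-μ))
          -- Otherwise `suc m ≤ suc k`, and the power dividing `p` would exceed the multiplicity `m`
          -- of `μ`.
          k<m : k < m
          k<m = [ id , (λ m≤k → contradiction (PD.^∣-≤ {linear μ} {p} {suc m} {suc k} m≤k d) m∤) ]′ (ℕ.≤-<-connex (suc k) m)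
        p≈q : p ≈ₚ q
        p≈q = determined-by-roots closed n p q p≤n
          (λ k n<k → trans (coeff-q k) (trans (*-congˡ (trans (*-congˡ (p≤n k n<k)) (zeroʳ _))) (zeroʳ _)))
          (sym (trans (coeff-q n) (-1^k-involutive n (coeff p n)))) lead≉0 p∣⇒q∣′

  module _ {n} (A : Mat n) where

    private
      φ = charPoly A

    -- Cramer's rule is used at a coordinate where the eigenvector is nonzero, which can then be
    -- cancelled.
    eigenvalue⇒root : ∀ {μ} → IsEigenvalue A μ → eval φ μ ≈ 0#
    eigenvalue⇒root {μ} (v , (p , vp≉0) , Av≈μv) = trans (eval-charPoly A μ)
      (zero-product vp≉0 (kernel⇒det (shifted A μ) v p λ i →
        trans (shifted-* A μ v i) (trans (+-congˡ (-‿cong (Av≈μv i))) (-‿inverseʳ (μ * v i)))))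

    root⇒eigenvalue : ∀ {μ} → eval φ μ ≈ 0# → IsEigenvalue A μ
    root⇒eigenvalue {μ} root = v , proj₁ (proj₂ kernel) ,
      λ i → sym (x∙y⁻¹≈ε⇒x≈y (μ * v i) (sum λ j → A i j * v j) (trans (sym (shifted-* A μ v i)) (proj₂ (proj₂ kernel) i)))
      where
      kernel = det⇒kernel zero-or-unit 1≉0 (shifted A μ) (trans (sym (eval-charPoly A μ)) root)
      v = proj₁ kernel

    alternates⇒symmetricSpectrum : Alternates n φ → SymmetricSpectrum A
    alternates⇒symmetricSpectrum alt μ eig = root⇒eigenvalue (proj₁ symm) , proj₂ symm
      where symm = alternates⇒symmetricRoots n φ (charPoly-degree A) (charPoly-monic A) alt μ (eigenvalue⇒root eig)

    symmetricSpectrum⇒alternates : (∀ p k → ¬ coeff p (suc k) ≈ 0# → ∃[ x ] eval p x ≈ 0#) →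
      SymmetricSpectrum A → Alternates n φ
    symmetricSpectrum⇒alternates closed symm = symmetricRoots⇒alternates n φ (charPoly-degree A) (charPoly-monic A) closed
      λ μ root → eigenvalue⇒root (proj₁ (symm μ (root⇒eigenvalue root))) , proj₂ (symm μ (root⇒eigenvalue root))

-- Arcs and their signs

module _ {n : ℕ} where
  open CommutativeSemigroupProperties ℕ.+-commutativeSemigroup using (x∙yz≈y∙xz) renaming (interchange to +-interchange)

  Arc : Set
  Arc = Fin n × Fin n

  [_≟_] : Fin n → Fin n → ℕ
  [ i ≟ j ] = if does (i Fin.≟ j) then 1 else 0

  [≟]-refl : ∀ i → [ i ≟ i ] ≡ 1
  [≟]-refl i rewrite dec-true (i Fin.≟ i) ≡.refl = ≡.refl

  [≟]-≢ : ∀ {i j} → i ≢ j → [ i ≟ j ] ≡ 0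
  [≟]-≢ {i} {j} i≢j rewrite dec-false (i Fin.≟ j) i≢j = ≡.refl

  -- A loop contributes 2 to `deg`, as is needed once contraction has turned a cycle into a loop;
  -- `degree` would count it once.
  outdeg indeg deg : Fin n → List Arc → ℕ
  outdeg w []            = 0
  outdeg w ((a , b) ∷ L) = [ w ≟ a ] ℕ.+ outdeg w L
  indeg  w []            = 0
  indeg  w ((a , b) ∷ L) = [ w ≟ b ] ℕ.+ indeg w L
  deg    w []            = 0
  deg    w ((a , b) ∷ L) = [ w ≟ a ] ℕ.+ [ w ≟ b ] ℕ.+ deg w L

  deg≡out+in : ∀ w L → deg w L ≡ outdeg w L ℕ.+ indeg w L
  deg≡out+in w [] = ≡.refl
  deg≡out+in w ((a , b) ∷ L) = ≡.trans (≡.cong ([ w ≟ a ] ℕ.+ [ w ≟ b ] ℕ.+_) (deg≡out+in w L))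
    (+-interchange [ w ≟ a ] [ w ≟ b ] (outdeg w L) (indeg w L))

  -- Follows the first arc leaving a vertex; a vertex without one stays put.
  successor : List Arc → Fin n → Fin n
  successor []            i = i
  successor ((a , b) ∷ L) i = if does (i Fin.≟ a) then b else successor L i

  successor-here : ∀ a b L → successor ((a , b) ∷ L) a ≡ b
  successor-here a b L rewrite dec-true (a Fin.≟ a) ≡.refl = ≡.refl

  successor-there : ∀ {a i} b L → i ≢ a → successor ((a , b) ∷ L) i ≡ successor L i
  successor-there {a} {i} b L i≢a rewrite dec-false (i Fin.≟ a) i≢a = ≡.refl

  outdeg≡0⇒fixed : ∀ {w} L → outdeg w L ≡ 0 → successor L w ≡ w
  outdeg≡0⇒fixed [] _ = ≡.refl
  outdeg≡0⇒fixed {w} ((a , b) ∷ L) out≡0 with w Fin.≟ a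
  ... | no _ = outdeg≡0⇒fixed L out≡0

  successor-cases : ∀ L i → (outdeg i L ≡ 0 × successor L i ≡ i) ⊎ (1 ≤ outdeg i L × 1 ≤ indeg (successor L i) L)
  successor-cases [] i = inj₁ (≡.refl , ≡.refl)
  successor-cases ((a , b) ∷ L) i with i Fin.≟ a
  ... | yes _ = inj₂ (s≤s z≤n , ℕ.≤-trans (ℕ.≤-reflexive (≡.sym ([≟]-refl b))) (ℕ.m≤m+n [ b ≟ b ] _))
  ... | no _ with successor-cases L i
  ...   | inj₁ p = inj₁ p
  ...   | inj₂ (out , in′) = inj₂ (out , ℕ.≤-trans in′ (ℕ.m≤n+m _ [ successor L i ≟ b ]))

  SingleOut : List Arc → Set
  SingleOut L = ∀ w → outdeg w L ≤ 1

  abstract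
    -- Abstract, so that `arcSign` and `minorOf` do not unfold into a search through all vertices;
    -- only the outcome of the decision matters.
    singleOut? : ∀ L → Dec (SingleOut L)
    singleOut? L = Fin.all? λ w → outdeg w L ℕ.≤? 1

  singleOut-tail : ∀ e L → SingleOut (e ∷ L) → SingleOut L
  singleOut-tail (a , b) L single w = ℕ.≤-trans (ℕ.m≤n+m (outdeg w L) [ w ≟ a ]) (single w)

  singleOut-head : ∀ a b L → SingleOut ((a , b) ∷ L) → outdeg a L ≡ 0
  singleOut-head a b L single = ℕ.n≤0⇒n≡0 (ℕ.≤-pred (≡.subst (λ k → k ℕ.+ outdeg a L ≤ 1) ([≟]-refl a) (single a)))

  singleOut-cons : ∀ a b L → SingleOut L → outdeg a L ≡ 0 → SingleOut ((a , b) ∷ L)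
  singleOut-cons a b L single out≡0 w with w Fin.≟ a
  ... | yes ≡.refl = s≤s (ℕ.≤-reflexive out≡0)
  ... | no _ = single w

  -- The arc is demanded separately, because `successor L w ≡ w` also holds when no arc leaves `w`.
  Predecessor : List Arc → Fin n → Fin n → Set
  Predecessor L w a = 1 ≤ outdeg a L × successor L a ≡ w

  predecessor-here : ∀ a b L → Predecessor ((a , b) ∷ L) b a
  predecessor-here a b L = ℕ.≤-trans (ℕ.≤-reflexive (≡.sym ([≟]-refl a))) (ℕ.m≤m+n [ a ≟ a ] _) , successor-here a b L

  predecessor-there : ∀ a b L w c → SingleOut ((a , b) ∷ L) → Predecessor L w c → c ≢ a × Predecessor ((a , b) ∷ L) w c
  predecessor-there a b L w c single (1≤out , eq) =
    c≢a , ℕ.≤-trans 1≤out (ℕ.m≤n+m _ [ c ≟ a ]) , ≡.trans (successor-there b L c≢a) eq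
    where
    c≢a : c ≢ a
    c≢a ≡.refl = ℕ.<⇒≢ 1≤out (≡.sym (singleOut-head a b L single))

  indeg≥1⇒predecessor : ∀ w L → SingleOut L → 1 ≤ indeg w L → ∃[ a ] Predecessor L w a
  indeg≥1⇒predecessor w ((a , b) ∷ L) single 1≤in with w Fin.≟ b
  ... | yes ≡.refl = a , predecessor-here a b L
  ... | no _ with indeg≥1⇒predecessor w L (singleOut-tail (a , b) L single) 1≤in
  ...   | c , pred = c , proj₂ (predecessor-there a b L w c single pred)

  indeg≥2⇒collision : ∀ w L → SingleOut L → 2 ≤ indeg w L →
    ∃[ a ] ∃[ a′ ] (a ≢ a′ × Predecessor L w a × Predecessor L w a′)
  indeg≥2⇒collision w ((a , b) ∷ L) single 2≤in with w Fin.≟ b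
  ... | yes ≡.refl with indeg≥1⇒predecessor w L (singleOut-tail (a , b) L single) (ℕ.≤-pred 2≤in)
  ...   | c , pred with predecessor-there a b L w c single pred
  ...     | c≢a , pred′ = a , c , c≢a ∘ ≡.sym , predecessor-here a b L , pred′
  indeg≥2⇒collision w ((a , b) ∷ L) single 2≤in | no _
    with indeg≥2⇒collision w L (singleOut-tail (a , b) L single) 2≤in
  ... | c , c′ , c≢c′ , pred , pred′ = c , c′ , c≢c′ , proj₂ (predecessor-there a b L w c single pred) , proj₂ (predecessor-there a b L w c′ single pred′)

  outdeg-↭ : ∀ w {L L′} → L ↭ L′ → outdeg w L ≡ outdeg w L′
  outdeg-↭ w Perm.refl = ≡.refl
  outdeg-↭ w (Perm.prep (a , b) p) = ≡.cong ([ w ≟ a ] ℕ.+_) (outdeg-↭ w p)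
  outdeg-↭ w (Perm.swap (a , b) (a′ , b′) p) = ≡.trans (x∙yz≈y∙xz [ w ≟ a ] [ w ≟ a′ ] _)
    (≡.cong (λ k → [ w ≟ a′ ] ℕ.+ ([ w ≟ a ] ℕ.+ k)) (outdeg-↭ w p))
  outdeg-↭ w (Perm.trans p q) = ≡.trans (outdeg-↭ w p) (outdeg-↭ w q)

  singleOut-↭ : ∀ {L L′} → L ↭ L′ → SingleOut L → SingleOut L′
  singleOut-↭ p single w = ≡.subst (_≤ 1) (outdeg-↭ w p) (single w)

  -- Two arcs leaving the same vertex would make the successor depend on their order; `SingleOut`
  -- excludes this.
  successor-↭ : ∀ {L L′} → L ↭ L′ → SingleOut L → successor L ≗ successor L′
  successor-↭ Perm.refl single i = ≡.refl
  successor-↭ {_ ∷ L} (Perm.prep (a , b) p) single i with i Fin.≟ a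
  ... | yes _ = ≡.refl
  ... | no _ = successor-↭ p (singleOut-tail (a , b) L single) i
  successor-↭ {_ ∷ _ ∷ L} (Perm.swap (a , b) (a′ , b′) p) single i with i Fin.≟ a | i Fin.≟ a′
  ... | yes ≡.refl | yes ≡.refl = contradiction (singleOut-head a b ((a , b′) ∷ L) single)
          (λ eq → case ≡.trans (≡.sym (≡.cong (ℕ._+ outdeg a L) ([≟]-refl a))) eq of λ ())
  ... | yes _ | no _ = ≡.refl
  ... | no _ | yes _ = ≡.refl
  ... | no _ | no _ = successor-↭ p (singleOut-tail (a′ , b′) L (singleOut-tail (a , b) ((a′ , b′) ∷ L) single)) i
  successor-↭ (Perm.trans p q) single i = ≡.trans (successor-↭ p single i) (successor-↭ q (singleOut-↭ p single) i)

  -- Contraction of an edge between `u` and `v` by renaming `u` to `v`. The vertex `u` stays in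
  -- `Fin n` without arcs, so the successor maps before and after act on the same set and their
  -- signs can be compared.
  merge : Fin n → Fin n → Fin n → Fin n
  merge u v i = if does (i Fin.≟ u) then v else i

  mergeArcs : Fin n → Fin n → List Arc → List Arc
  mergeArcs u v = map λ e → merge u v (proj₁ e) , merge u v (proj₂ e)

  module _ {u v : Fin n} (u≢v : u ≢ v) where

    [≟]-merge-u : ∀ a → [ u ≟ merge u v a ] ≡ 0
    [≟]-merge-u a with a Fin.≟ u
    ... | yes _ = [≟]-≢ u≢v
    ... | no a≢u = [≟]-≢ (a≢u ∘ ≡.sym)

    [≟]-merge-v : ∀ a → [ v ≟ merge u v a ] ≡ [ u ≟ a ] ℕ.+ [ v ≟ a ]
    [≟]-merge-v a with a Fin.≟ u
    ... | yes ≡.refl = ≡.trans ([≟]-refl v) (≡.sym (≡.cong₂ ℕ._+_ ([≟]-refl a) ([≟]-≢ (u≢v ∘ ≡.sym))))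
    ... | no a≢u = ≡.sym (≡.cong (ℕ._+ [ v ≟ a ]) ([≟]-≢ (a≢u ∘ ≡.sym)))

    [≟]-merge-≢ : ∀ {w} a → w ≢ u → w ≢ v → [ w ≟ merge u v a ] ≡ [ w ≟ a ]
    [≟]-merge-≢ a w≢u w≢v with a Fin.≟ u
    ... | yes ≡.refl = ≡.trans ([≟]-≢ w≢v) (≡.sym ([≟]-≢ w≢u))
    ... | no _ = ≡.refl

    outdeg-merge-u : ∀ L → outdeg u (mergeArcs u v L) ≡ 0
    outdeg-merge-u [] = ≡.refl
    outdeg-merge-u ((a , b) ∷ L) = ≡.cong₂ ℕ._+_ ([≟]-merge-u a) (outdeg-merge-u L)

    outdeg-merge-v : ∀ L → outdeg v (mergeArcs u v L) ≡ outdeg u L ℕ.+ outdeg v L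
    outdeg-merge-v [] = ≡.refl
    outdeg-merge-v ((a , b) ∷ L) = ≡.trans (≡.cong₂ ℕ._+_ ([≟]-merge-v a) (outdeg-merge-v L)) (+-interchange [ u ≟ a ] [ v ≟ a ] (outdeg u L) (outdeg v L))

    outdeg-merge-≢ : ∀ {w} L → w ≢ u → w ≢ v → outdeg w (mergeArcs u v L) ≡ outdeg w L
    outdeg-merge-≢ [] _ _ = ≡.refl
    outdeg-merge-≢ ((a , b) ∷ L) w≢u w≢v = ≡.cong₂ ℕ._+_ ([≟]-merge-≢ a w≢u w≢v) (outdeg-merge-≢ L w≢u w≢v)

    indeg-merge-u : ∀ L → indeg u (mergeArcs u v L) ≡ 0
    indeg-merge-u [] = ≡.refl
    indeg-merge-u ((a , b) ∷ L) = ≡.cong₂ ℕ._+_ ([≟]-merge-u b) (indeg-merge-u L)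

    indeg-merge-v : ∀ L → indeg v (mergeArcs u v L) ≡ indeg u L ℕ.+ indeg v L
    indeg-merge-v [] = ≡.refl
    indeg-merge-v ((a , b) ∷ L) = ≡.trans (≡.cong₂ ℕ._+_ ([≟]-merge-v b) (indeg-merge-v L)) (+-interchange [ u ≟ b ] [ v ≟ b ] (indeg u L) (indeg v L))

    deg-merge-u : ∀ L → deg u (mergeArcs u v L) ≡ 0
    deg-merge-u L = ≡.trans (deg≡out+in u (mergeArcs u v L)) (≡.cong₂ ℕ._+_ (outdeg-merge-u L) (indeg-merge-u L))

    deg-merge-v : ∀ L → deg v (mergeArcs u v L) ≡ deg u L ℕ.+ deg v L
    deg-merge-v [] = ≡.refl
    deg-merge-v ((a , b) ∷ L) = ≡.trans (≡.cong₂ ℕ._+_ (≡.cong₂ ℕ._+_ ([≟]-merge-v a) ([≟]-merge-v b)) (deg-merge-v L))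
      (≡.trans (≡.cong (ℕ._+ (deg u L ℕ.+ deg v L)) (+-interchange [ u ≟ a ] [ v ≟ a ] [ u ≟ b ] [ v ≟ b ]))
        (+-interchange ([ u ≟ a ] ℕ.+ [ u ≟ b ]) ([ v ≟ a ] ℕ.+ [ v ≟ b ]) (deg u L) (deg v L)))

    deg-merge-≢ : ∀ {w} L → w ≢ u → w ≢ v → deg w (mergeArcs u v L) ≡ deg w L
    deg-merge-≢ [] _ _ = ≡.refl
    deg-merge-≢ ((a , b) ∷ L) w≢u w≢v = ≡.cong₂ ℕ._+_ (≡.cong₂ ℕ._+_ ([≟]-merge-≢ a w≢u w≢v) ([≟]-merge-≢ b w≢u w≢v)) (deg-merge-≢ L w≢u w≢v)

    transpose-merge : ∀ {b} → b ≢ v → transpose u v b ≡ merge u v b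
    transpose-merge {b} b≢v with b Fin.≟ u
    ... | yes _ = ≡.refl
    ... | no b≢u rewrite dec-false (b Fin.≟ v) b≢v = ≡.refl

    -- If no arc leaves u, merging u into v redirects the arcs into u and is
    -- undone by closing the path through the arc (u , v).
    successor-merge-in : ∀ L → outdeg u L ≡ 0 → indeg v L ≡ 0 → 1 ≤ outdeg v L →
      transpose u v ∘ successor ((u , v) ∷ L) ≗ successor (mergeArcs u v L)
    successor-merge-in L out-u in-v out-v i with i Fin.≟ u
    ... | yes ≡.refl = ≡.trans (transposeʳ u v) (≡.sym (outdeg≡0⇒fixed (mergeArcs u v L) (outdeg-merge-u L)))
    ... | no i≢u = go L out-u in-v (λ { ≡.refl → out-v })
      where
      τ = transpose u v
      -- If no arc left `v`, its successor would be `v` itself, which `τ` moves; hence the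
      -- hypothesis in the case of `v`.
      go : ∀ L → outdeg u L ≡ 0 → indeg v L ≡ 0 → (i ≡ v → 1 ≤ outdeg v L) → τ (successor L i) ≡ successor (mergeArcs u v L) i
      go [] _ _ out-v with i Fin.≟ v
      ... | yes i≡v = contradiction (out-v i≡v) λ ()
      ... | no i≢v = transpose-≢ i≢u i≢v
      go ((a , b) ∷ L) out-u in-v out-v with u Fin.≟ a | v Fin.≟ b
      ... | no u≢a | no v≢b rewrite dec-false (a Fin.≟ u) (u≢a ∘ ≡.sym) with i Fin.≟ a
      ...   | yes _ = transpose-merge (v≢b ∘ ≡.sym)
      go ((a , b) ∷ L) out-u in-v out-v | no u≢a | no v≢b | no i≢a = go L out-u in-v λ where
        ≡.refl → ≡.subst (λ k → 1 ≤ k ℕ.+ outdeg v L) ([≟]-≢ i≢a) (out-v ≡.refl)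

    -- The path now runs through the arc from `v` to `u` and goes on from `u`. After merging, the
    -- arc that left `u` leaves `v`, so this time the arguments of the successor map are exchanged,
    -- not its values.
    successor-merge-out : ∀ L → indeg u L ≡ 0 → outdeg v L ≡ 0 → 1 ≤ outdeg u L →
      successor ((v , u) ∷ L) ∘ transpose u v ≗ successor (mergeArcs u v L)
    successor-merge-out L in-u out-v out-u i with i Fin.≟ u
    ... | yes ≡.refl = ≡.trans (successor-here v u L) (≡.sym (outdeg≡0⇒fixed (mergeArcs u v L) (outdeg-merge-u L)))
    ... | no i≢u with i Fin.≟ v
    ...   | yes ≡.refl = ≡.trans (successor-there u L u≢v) (go L in-u out-v out-u)
      where
      go : ∀ L → indeg u L ≡ 0 → outdeg v L ≡ 0 → 1 ≤ outdeg u L → successor L u ≡ successor (mergeArcs u v L) v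
      go ((a , b) ∷ L) in-u out-v out-u with u Fin.≟ a | u Fin.≟ b | v Fin.≟ a
      ... | yes ≡.refl | no u≢b | no _ rewrite dec-true (u Fin.≟ u) ≡.refl | dec-true (v Fin.≟ v) ≡.refl
        | dec-false (b Fin.≟ u) (u≢b ∘ ≡.sym) = ≡.refl
      ... | no u≢a | no u≢b | no v≢a rewrite dec-false (a Fin.≟ u) (u≢a ∘ ≡.sym) | dec-false (v Fin.≟ a) v≢a = go L in-u out-v out-u
    ...   | no i≢v = ≡.trans (successor-there u L i≢v) (go L in-u)
      where
      go : ∀ L → indeg u L ≡ 0 → successor L i ≡ successor (mergeArcs u v L) i
      go [] _ = ≡.refl
      go ((a , b) ∷ L) in-u with u Fin.≟ b
      ... | no u≢b rewrite dec-false (b Fin.≟ u) (u≢b ∘ ≡.sym) with a Fin.≟ u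
      ...   | yes ≡.refl rewrite dec-false (i Fin.≟ a) i≢u | dec-false (i Fin.≟ v) i≢v = go L in-u
      ...   | no _ with i Fin.≟ a
      ...     | yes _ = ≡.refl
      ...     | no _ = go L in-u

module ArcSigns {c ℓ} (R : CommutativeRing c ℓ) {n : ℕ} where
  open CommutativeRing R hiding (zero)
  open RingProperties ring
  open SemiringDefinitions (Semiring.rawSemiring semiring) using (_^_)
  open DeterminantTheory R
  open SetoidReasoning setoid

  -- For a disjoint union of directed cycles, (-1) to the number of cycles;
  -- 0# for every other list of arcs.
  arcSign : List (Arc {n}) → Carrier
  arcSign L = if does (singleOut? L) then (- 1#) ^ length L * sgn (successor L) else 0#

  arcSign-single : ∀ L → SingleOut L → arcSign L ≈ (- 1#) ^ length L * sgn (successor L)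
  arcSign-single L single rewrite dec-true (singleOut? L) single = refl

  arcSign-multiple : ∀ L → ¬ SingleOut L → arcSign L ≈ 0#
  arcSign-multiple L ¬single rewrite dec-false (singleOut? L) ¬single = refl

  arcSign-two-out : ∀ w L → 2 ≤ outdeg w L → arcSign L ≈ 0#
  arcSign-two-out w L 2≤out = arcSign-multiple L λ single → ℕ.<⇒≱ 2≤out (single w)

  private
    sgn≈0⇒arcSign≈0 : ∀ L → (SingleOut L → sgn (successor L) ≈ 0#) → arcSign L ≈ 0#
    sgn≈0⇒arcSign≈0 L sgn≈0 with singleOut? L
    ... | no ¬single = refl
    ... | yes single = trans (*-congˡ (sgn≈0 single)) (zeroʳ _)

  arcSign-two-in : ∀ w L → 2 ≤ indeg w L → arcSign L ≈ 0#
  arcSign-two-in w L 2≤in = sgn≈0⇒arcSign≈0 L λ single →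
    let a , a′ , a≢a′ , (_ , eq) , (_ , eq′) = indeg≥2⇒collision w L single 2≤in
    in sgn-collision (successor L) a≢a′ (≡.trans eq (≡.sym eq′))

  arcSign-sink : ∀ w L → 1 ≤ indeg w L → outdeg w L ≡ 0 → arcSign L ≈ 0#
  arcSign-sink w L 1≤in out≡0 = sgn≈0⇒arcSign≈0 L λ single →
    let a , 1≤out , eq = indeg≥1⇒predecessor w L single 1≤in
    in sgn-collision (successor L) {a} {w}
         (λ a≡w → ℕ.<⇒≢ (≡.subst (λ k → 1 ≤ outdeg k L) a≡w 1≤out) (≡.sym out≡0))
         (≡.trans eq (≡.sym (outdeg≡0⇒fixed L out≡0)))

  arcSign-source : ∀ w L → 1 ≤ outdeg w L → indeg w L ≡ 0 → arcSign L ≈ 0#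
  arcSign-source w L 1≤out in≡0 = sgn≈0⇒arcSign≈0 L λ _ → sgn-miss w miss
    where
    miss : ∀ i → successor L i ≢ w
    miss i eq with successor-cases L i
    ... | inj₂ (_ , 1≤in) = ℕ.<⇒≢ (≡.subst (λ k → 1 ≤ indeg k L) eq 1≤in) (≡.sym in≡0)
    ... | inj₁ (out≡0 , fixed) = ℕ.<⇒≢ 1≤out (≡.sym (≡.subst (λ k → outdeg k L ≡ 0) (≡.trans (≡.sym fixed) eq) out≡0))

  -- In a disjoint union of directed cycles each vertex has equal outdegree and indegree, both 0 or
  -- both 1. Any other pair of values is a sink, a source or a repetition, and each of these kills
  -- the sign.
  arcSign-degree : ∀ w L → deg w L ≢ 0 → deg w L ≢ 2 → arcSign L ≈ 0#
  arcSign-degree w L deg≢0 deg≢2 with outdeg w L in out | indeg w L in in′ | deg≡out+in w L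
  ... | 0 | 0 | eq = contradiction eq deg≢0
  ... | 1 | 1 | eq = contradiction eq deg≢2
  ... | 0 | suc i | _ = arcSign-sink w L (≡.subst (1 ≤_) (≡.sym in′) (s≤s z≤n)) out
  ... | suc o | 0 | _ = arcSign-source w L (≡.subst (1 ≤_) (≡.sym out) (s≤s z≤n)) in′
  ... | suc (suc o) | suc i | _ = arcSign-two-out w L (≡.subst (2 ≤_) (≡.sym out) (s≤s (s≤s z≤n)))
  ... | 1 | suc (suc i) | _ = arcSign-two-in w L (≡.subst (2 ≤_) (≡.sym in′) (s≤s (s≤s z≤n)))

  arcSign-↭ : ∀ {L L′} → L ↭ L′ → arcSign L ≈ arcSign L′
  arcSign-↭ {L} {L′} p with singleOut? L
  ... | no ¬single = sym (arcSign-multiple L′ (¬single ∘ singleOut-↭ (Perm.↭-sym p)))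
  ... | yes single = trans
    (*-cong (reflexive (≡.cong ((- 1#) ^_) (Perm.↭-length p))) (sgn-cong (successor-↭ p single)))
    (sym (arcSign-single L′ (singleOut-↭ p single)))

  arcSign-[] : arcSign [] ≈ 1#
  arcSign-[] = trans (arcSign-single [] (λ _ → z≤n)) (trans (*-identityˡ _) (sgn-id n))

  -- The successor map already fixes `u`; only the number of arcs changes.
  arcSign-loop : ∀ u L → outdeg u L ≡ 0 → arcSign ((u , u) ∷ L) ≈ - arcSign L
  arcSign-loop u L out≡0 with singleOut? L
  ... | no ¬single = trans (arcSign-multiple ((u , u) ∷ L) (¬single ∘ singleOut-tail (u , u) L)) (sym -0#≈0#)
  ... | yes single = begin
    arcSign ((u , u) ∷ L)                               ≈⟨ arcSign-single ((u , u) ∷ L) (singleOut-cons u u L single out≡0) ⟩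
    - 1# * (- 1#) ^ length L * sgn (successor ((u , u) ∷ L)) ≈⟨ *-cong (-1*x≈-x _) (sgn-cong same) ⟩
    - (- 1#) ^ length L * sgn (successor L)             ≈⟨ -‿distribˡ-* _ _ ⟨
    - ((- 1#) ^ length L * sgn (successor L))           ∎
    where
    same : successor ((u , u) ∷ L) ≗ successor L
    same i with i Fin.≟ u
    ... | yes ≡.refl = ≡.sym (outdeg≡0⇒fixed L out≡0)
    ... | no _ = ≡.refl

  private
    -1*s*-t : ∀ s t → - 1# * s * - t ≈ s * t
    -1*s*-t s t = trans (*-congʳ (-1*x≈-x s)) (trans (sym (-‿distribˡ-* _ _)) (trans (-‿cong (sym (-‿distribʳ-* _ _))) (-‿involutive _)))

    -- Contraction takes away one arc and composes the successor map with a transposition. The two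
    -- changes of sign cancel.
    flip-sign : ∀ {L L′ e} → length L′ ≡ length L → SingleOut L′ → SingleOut (e ∷ L) →
      sgn (successor L′) ≈ - sgn (successor (e ∷ L)) → arcSign (e ∷ L) ≈ arcSign L′
    flip-sign {L} {L′} {e} len single′ single sgn≈ = begin
      arcSign (e ∷ L)                                         ≈⟨ arcSign-single (e ∷ L) single ⟩
      - 1# * (- 1#) ^ length L * sgn (successor (e ∷ L))      ≈⟨ *-congˡ (trans (sym (-‿involutive _)) (-‿cong (sym sgn≈))) ⟩
      - 1# * (- 1#) ^ length L * - sgn (successor L′)         ≈⟨ -1*s*-t _ _ ⟩
      (- 1#) ^ length L * sgn (successor L′)                  ≈⟨ *-congʳ (reflexive (≡.cong ((- 1#) ^_) len)) ⟨
      (- 1#) ^ length L′ * sgn (successor L′)                 ≈⟨ arcSign-single L′ single′ ⟨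
      arcSign L′                                              ∎

  module _ {u v : Fin n} (u≢v : u ≢ v) where

    private
      outdeg-≢ : ∀ {w} a b (L : List (Arc {n})) → w ≢ a → outdeg w ((a , b) ∷ L) ≡ outdeg w L
      outdeg-≢ a b L w≢a = ≡.cong (ℕ._+ _) ([≟]-≢ w≢a)

      outdeg-≡ : ∀ a b (L : List (Arc {n})) → outdeg a ((a , b) ∷ L) ≡ suc (outdeg a L)
      outdeg-≡ a b L = ≡.cong (ℕ._+ outdeg a L) ([≟]-refl a)

      indeg-≡ : ∀ a b (L : List (Arc {n})) → indeg b ((a , b) ∷ L) ≡ suc (indeg b L)
      indeg-≡ a b L = ≡.cong (ℕ._+ indeg b L) ([≟]-refl b)

    arcSign-merge-in : ∀ L → outdeg u L ≡ 0 → indeg v L ≡ 0 → 1 ≤ outdeg v L →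
      arcSign ((u , v) ∷ L) ≈ arcSign (mergeArcs u v L)
    arcSign-merge-in L out-u in-v out-v = by-cases (singleOut? L)
      where
      outdeg-same : ∀ w → outdeg w (mergeArcs u v L) ≡ outdeg w L
      outdeg-same w with w Fin.≟ u | w Fin.≟ v
      ... | yes ≡.refl | _ = ≡.trans (outdeg-merge-u u≢v L) (≡.sym out-u)
      ... | no _ | yes ≡.refl = ≡.trans (outdeg-merge-v u≢v L) (≡.cong (ℕ._+ outdeg v L) out-u)
      ... | no w≢u | no w≢v = outdeg-merge-≢ u≢v L w≢u w≢v
      by-cases : Dec (SingleOut L) → arcSign ((u , v) ∷ L) ≈ arcSign (mergeArcs u v L)
      by-cases (no ¬single) = trans (arcSign-multiple ((u , v) ∷ L) (¬single ∘ singleOut-tail (u , v) L))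
        (sym (arcSign-multiple (mergeArcs u v L) λ single → ¬single λ w → ≡.subst (_≤ 1) (outdeg-same w) (single w)))
      by-cases (yes single) = flip-sign (length-map _ L)
        (λ w → ≡.subst (_≤ 1) (≡.sym (outdeg-same w)) (single w))
        (singleOut-cons u v L single out-u)
        (trans (sgn-cong (λ i → ≡.sym (successor-merge-in u≢v L out-u in-v out-v i)))
          (sgn-transposeˡ (successor ((u , v) ∷ L)) u≢v))

    arcSign-merge-out : ∀ L → indeg u L ≡ 0 → outdeg v L ≡ 0 → 1 ≤ outdeg u L →
      arcSign ((v , u) ∷ L) ≈ arcSign (mergeArcs u v L)
    arcSign-merge-out L in-u out-v out-u = by-cases (singleOut? L)
      where
      merge-v : outdeg v (mergeArcs u v L) ≡ outdeg u L
      merge-v = ≡.trans (outdeg-merge-v u≢v L) (≡.trans (≡.cong (outdeg u L ℕ.+_) out-v) (ℕ.+-identityʳ _))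
      by-cases : Dec (SingleOut L) → arcSign ((v , u) ∷ L) ≈ arcSign (mergeArcs u v L)
      by-cases (no ¬single) = trans (arcSign-multiple ((v , u) ∷ L) (¬single ∘ singleOut-tail (v , u) L))
        (sym (arcSign-multiple (mergeArcs u v L) λ single → ¬single λ w → unmerge single w))
        where
        unmerge : SingleOut (mergeArcs u v L) → ∀ w → outdeg w L ≤ 1
        unmerge single w with w Fin.≟ u | w Fin.≟ v
        ... | yes ≡.refl | _ = ≡.subst (_≤ 1) merge-v (single v)
        ... | no _ | yes ≡.refl = ≡.subst (_≤ 1) (≡.sym out-v) z≤n
        ... | no w≢u | no w≢v = ≡.subst (_≤ 1) (outdeg-merge-≢ u≢v L w≢u w≢v) (single w)
      by-cases (yes single) = flip-sign (length-map _ L) merged (singleOut-cons v u L single out-v)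
        (trans (sgn-cong (λ i → ≡.sym (successor-merge-out u≢v L in-u out-v out-u i)))
          (sgn-transposeʳ (successor ((v , u) ∷ L)) u≢v))
        where
        merged : ∀ w → outdeg w (mergeArcs u v L) ≤ 1
        merged w with w Fin.≟ u | w Fin.≟ v
        ... | yes ≡.refl | _ = ≡.subst (_≤ 1) (≡.sym (outdeg-merge-u u≢v L)) z≤n
        ... | no _ | yes ≡.refl = ≡.subst (_≤ 1) (≡.sym merge-v) (single u)
        ... | no w≢u | no w≢v = ≡.subst (_≤ 1) (≡.sym (outdeg-merge-≢ u≢v L w≢u w≢v)) (single w)

    private
      deg≡1 : ∀ w (L : List (Arc {n})) → deg w L ≡ 1 → (outdeg w L ≡ 0 × indeg w L ≡ 1) ⊎ (outdeg w L ≡ 1 × indeg w L ≡ 0)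
      deg≡1 w L deg≡1 with outdeg w L | indeg w L | ≡.trans (≡.sym (deg≡out+in w L)) deg≡1
      ... | 0 | 1 | _ = inj₁ (≡.refl , ≡.refl)
      ... | 1 | 0 | _ = inj₂ (≡.refl , ≡.refl)
      ... | suc (suc _) | _ | ()
      ... | 1 | suc _ | ()

      1≤ : ∀ {k} → k ≡ 1 → 1 ≤ k
      1≤ ≡.refl = s≤s z≤n

      2≤suc : ∀ {k l} → k ≡ suc l → l ≡ 1 → 2 ≤ k
      2≤suc ≡.refl ≡.refl = s≤s (s≤s z≤n)

      2≤+ : ∀ {k l m} → k ≡ l ℕ.+ m → l ≡ 1 → m ≡ 1 → 2 ≤ k
      2≤+ ≡.refl ≡.refl ≡.refl = s≤s (s≤s z≤n)

    -- At most one of the two arcs can continue the path through u and v.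
    arcSign-contract : ∀ L → deg u L ≡ 1 → deg v L ≡ 1 →
      arcSign ((u , v) ∷ L) + arcSign ((v , u) ∷ L) ≈ arcSign (mergeArcs u v L)
    arcSign-contract L deg-u deg-v with deg≡1 u L deg-u | deg≡1 v L deg-v
    ... | inj₂ (out-u , in-u) | inj₂ (out-v , in-v) = trans
      (+-cong (arcSign-two-out u _ (2≤suc (outdeg-≡ u v L) out-u)) (arcSign-two-out v _ (2≤suc (outdeg-≡ v u L) out-v)))
      (trans (+-identityˡ 0#) (sym (arcSign-two-out v _ (2≤+ (outdeg-merge-v u≢v L) out-u out-v))))
    ... | inj₁ (out-u , in-u) | inj₁ (out-v , in-v) = trans
      (+-cong (arcSign-two-in v _ (2≤suc (indeg-≡ u v L) in-v)) (arcSign-two-in u _ (2≤suc (indeg-≡ v u L) in-u)))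
      (trans (+-identityˡ 0#) (sym (arcSign-two-in v _ (2≤+ (indeg-merge-v u≢v L) in-u in-v))))
    ... | inj₁ (out-u , in-u) | inj₂ (out-v , in-v) = trans
      (+-cong (arcSign-merge-in L out-u in-v (1≤ out-v)) (arcSign-two-out v _ (2≤suc (outdeg-≡ v u L) out-v)))
      (+-identityʳ _)
    ... | inj₂ (out-u , in-u) | inj₁ (out-v , in-v) = trans
      (+-cong (arcSign-two-out u _ (2≤suc (outdeg-≡ u v L) out-u)) (arcSign-merge-out L in-u out-v (1≤ out-u)))
      (+-identityˡ _)

    -- Two arcs do not change the power of -1, while the successor map, which fixed `u` and `v`, is
    -- composed with their transposition.
    arcSign-two-cycle : ∀ L → deg u L ≡ 0 → deg v L ≡ 0 → arcSign ((u , v) ∷ (v , u) ∷ L) ≈ - arcSign L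
    arcSign-two-cycle L deg-u deg-v = by-cases (singleOut? L)
      where
      M : List (Arc {n})
      M = (u , v) ∷ (v , u) ∷ L
      out-u : outdeg u L ≡ 0
      out-u = ℕ.m+n≡0⇒m≡0 (outdeg u L) (≡.trans (≡.sym (deg≡out+in u L)) deg-u)
      in-u : indeg u L ≡ 0
      in-u = ℕ.m+n≡0⇒n≡0 (outdeg u L) (≡.trans (≡.sym (deg≡out+in u L)) deg-u)
      out-v : outdeg v L ≡ 0
      out-v = ℕ.m+n≡0⇒m≡0 (outdeg v L) (≡.trans (≡.sym (deg≡out+in v L)) deg-v)
      in-v : indeg v L ≡ 0
      in-v = ℕ.m+n≡0⇒n≡0 (outdeg v L) (≡.trans (≡.sym (deg≡out+in v L)) deg-v)
      swapped : successor M ≗ transpose u v ∘ successor L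
      swapped i with i Fin.≟ u
      ... | yes ≡.refl = ≡.sym (≡.trans (≡.cong (transpose u v) (outdeg≡0⇒fixed L out-u)) (transposeˡ u v))
      ... | no i≢u with i Fin.≟ v
      ...   | yes ≡.refl = ≡.sym (≡.trans (≡.cong (transpose u v) (outdeg≡0⇒fixed L out-v)) (transposeʳ u v))
      ...   | no i≢v = ≡.sym (transpose-≢ (≢target i≢u in-u) (≢target i≢v in-v))
        where
        ≢target : ∀ {w} → i ≢ w → indeg w L ≡ 0 → successor L i ≢ w
        ≢target i≢w in≡0 eq with successor-cases L i
        ... | inj₁ (_ , fixed) = i≢w (≡.trans (≡.sym fixed) eq)
        ... | inj₂ (_ , 1≤in) = ℕ.<⇒≢ (≡.subst (λ k → 1 ≤ indeg k L) eq 1≤in) (≡.sym in≡0)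
      by-cases : Dec (SingleOut L) → arcSign M ≈ - arcSign L
      by-cases (no ¬single) = trans (arcSign-multiple M (¬single ∘ singleOut-tail (v , u) L ∘ singleOut-tail (u , v) ((v , u) ∷ L)))
        (trans (sym -0#≈0#) (-‿cong (sym (arcSign-multiple L ¬single))))
      by-cases (yes single) = begin
        arcSign M                                             ≈⟨ arcSign-single M (singleOut-cons u v ((v , u) ∷ L) (singleOut-cons v u L single out-v) (≡.trans (outdeg-≢ v u L u≢v) out-u)) ⟩
        - 1# * (- 1# * (- 1#) ^ length L) * sgn (successor M) ≈⟨ *-cong (trans (-1*x≈-x _) (trans (-‿cong (-1*x≈-x _)) (-‿involutive _)))
                                                                   (trans (sgn-cong swapped) (sgn-transposeˡ (successor L) u≢v)) ⟩
        (- 1#) ^ length L * - sgn (successor L)               ≈⟨ -‿distribʳ-* _ _ ⟨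
        - ((- 1#) ^ length L * sgn (successor L))             ≈⟨ -‿cong (arcSign-single L single) ⟨
        - arcSign L                                           ∎

    -- The two opposite arcs already give both ends degree 2, so a further arc at one of them is too
    -- many for `arcSign-degree`.
    arcSign-two-cycle-touching : ∀ L → deg u L ≢ 0 ⊎ deg v L ≢ 0 → arcSign ((u , v) ∷ (v , u) ∷ L) ≈ 0#
    arcSign-two-cycle-touching L touching = case touching of λ where
        (inj₁ deg≢0) → arcSign-degree u M (≢0 u deg-u) (deg≢0 ∘ ≢2 u deg-u)
        (inj₂ deg≢0) → arcSign-degree v M (≢0 v deg-v) (deg≢0 ∘ ≢2 v deg-v)
      where
      M : List (Arc {n})
      M = (u , v) ∷ (v , u) ∷ L
      deg-u : deg u M ≡ 2 ℕ.+ deg u L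
      deg-u = ≡.cong₂ (λ x y → x ℕ.+ y ℕ.+ (y ℕ.+ x ℕ.+ deg u L)) ([≟]-refl u) ([≟]-≢ u≢v)
      deg-v : deg v M ≡ 2 ℕ.+ deg v L
      deg-v = ≡.cong₂ (λ x y → x ℕ.+ y ℕ.+ (y ℕ.+ x ℕ.+ deg v L)) ([≟]-≢ (u≢v ∘ ≡.sym)) ([≟]-refl v)
      ≢0 : ∀ w → deg w M ≡ 2 ℕ.+ deg w L → deg w M ≢ 0
      ≢0 w eq eq′ = case ≡.trans (≡.sym eq) eq′ of λ ()
      ≢2 : ∀ w → deg w M ≡ 2 ℕ.+ deg w L → deg w M ≡ 2 → deg w L ≡ 0
      ≢2 w eq eq′ = ℕ.+-cancelˡ-≡ 2 _ _ (≡.trans (≡.sym eq) eq′)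

-- Connected components and contraction

module _ {n : ℕ} {ℓ₁ ℓ₂} {R : Fin n → Fin n → Set ℓ₁} {T : Fin n → Fin n → Set ℓ₂}
  (separated : ∀ {a a′ b} → T a b → T a′ b → R a a′) where

  -- Pigeonhole: each element of `as` has a partner in `bs`, and unrelated elements cannot share
  -- one. The partner of the head is removed before the recursive call.
  length-≤ : ∀ as bs → AllPairs (λ a a′ → ¬ R a a′) as → (∀ {a} → a ∈ as → ∃[ b ] (b ∈ bs × T a b)) → length as ≤ length bs
  length-≤ [] bs _ _ = z≤n
  length-≤ (a ∷ as) bs (¬R ∷ ¬Rs) represented with represented (here ≡.refl)
  ... | b , b∈bs , Tab with ∈-∃++ b∈bs
  ...   | ys , zs , ≡.refl = ℕ.≤-trans (s≤s (length-≤ as (ys ++ zs) ¬Rs rest)) (ℕ.≤-reflexive len)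
    where
    len : suc (length (ys ++ zs)) ≡ length (ys ++ b ∷ zs)
    len = ≡.trans (≡.cong suc (length-++ ys)) (≡.trans (≡.sym (ℕ.+-suc (length ys) (length zs))) (≡.sym (length-++ ys)))
    rest : ∀ {a′} → a′ ∈ as → ∃[ b′ ] (b′ ∈ ys ++ zs × T a′ b′)
    rest a′∈as with represented (there a′∈as)
    ... | b′ , b′∈bs , Ta′b′ with ∈-++⁻ ys b′∈bs
    ...   | inj₁ ∈ys = b′ , ∈-++⁺ˡ ∈ys , Ta′b′
    ...   | inj₂ (there ∈zs) = b′ , ∈-++⁺ʳ ys ∈zs , Ta′b′
    ...   | inj₂ (here ≡.refl) = contradiction (separated Tab Ta′b′) (All.lookup ¬R a′∈as)

module _ {n : ℕ} where

  Unique⇒length-≤ : ∀ {xs ys : List (Fin n)} → Unique xs → (∀ {x} → x ∈ xs → x ∈ ys) → length xs ≤ length ys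
  Unique⇒length-≤ {xs} {ys} uniq xs⊆ys = length-≤ {R = _≡_} {T = _≡_} (λ p q → ≡.trans p (≡.sym q)) xs ys uniq
    λ x∈xs → _ , xs⊆ys x∈xs , ≡.refl

  Unique⇒length-≡ : ∀ {xs ys : List (Fin n)} → Unique xs → Unique ys →
    (∀ {x} → x ∈ xs → x ∈ ys) → (∀ {x} → x ∈ ys → x ∈ xs) → length xs ≡ length ys
  Unique⇒length-≡ u v xs⊆ys ys⊆xs = ℕ.≤-antisym (Unique⇒length-≤ u xs⊆ys) (Unique⇒length-≤ v ys⊆xs)

  remove : Fin n → List (Fin n) → List (Fin n)
  remove u = filter λ w → ¬? (w Fin.≟ u)

  length-remove : ∀ {u xs} → Unique xs → u ∈ xs → length xs ≡ suc (length (remove u xs))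
  length-remove {u} {xs} uniq u∈xs = Unique⇒length-≡ uniq (All.map (λ w≢u → w≢u ∘ ≡.sym) (All.all-filter (λ w → ¬? (w Fin.≟ u)) xs) ∷ Unique.filter⁺ (λ w → ¬? (w Fin.≟ u)) uniq)
    split (λ { (here ≡.refl) → u∈xs ; (there p) → proj₁ (∈-filter⁻ (λ w → ¬? (w Fin.≟ u)) p) })
    where
    split : ∀ {x} → x ∈ xs → x ∈ u ∷ remove u xs
    split {x} x∈xs with x Fin.≟ u
    ... | yes ≡.refl = here ≡.refl
    ... | no x≢u = there (∈-filter⁺ (λ w → ¬? (w Fin.≟ u)) x∈xs x≢u)

  joined-sym : ∀ {E} {a b : Fin n} → Joined E a b → Joined E b a
  joined-sym = Star.reverse swap

  -- A description of component representatives independent of `deduplicate`. All such lists have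
  -- the same length, so components can be counted with whichever list is convenient.
  record Representatives (E : List (Fin n × Fin n)) (S reps : List (Fin n)) : Set where
    field
      unrelated   : AllPairs (λ a b → ¬ Joined E a b) reps
      sound       : ∀ {b} → b ∈ reps → b ∈ S
      represented : ∀ {a} → a ∈ S → ∃[ b ] (b ∈ reps × Joined E a b)

  open Representatives

  representatives-length : ∀ {E S reps reps′} → Representatives E S reps → Representatives E S reps′ → length reps ≡ length reps′
  representatives-length {E} r r′ = ℕ.≤-antisym (below r r′) (below r′ r)
    where
    below : ∀ {reps reps′} → Representatives E _ reps → Representatives E _ reps′ → length reps ≤ length reps′
    below {reps} {reps′} r r′ = length-≤ {R = Joined E} {T = Joined E} (λ p q → p ◅◅ joined-sym q) reps reps′ (unrelated r) (represented r′ ∘ sound r)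

  deduplicate-representatives : ∀ E S → Representatives E S (deduplicate (joined? E) S)
  deduplicate-representatives E S = record
    { unrelated = pairs S ; sound = ∈-deduplicate⁻ (joined? E) S ; represented = rep S }
    where
    pairs : ∀ S → AllPairs (λ a b → ¬ Joined E a b) (deduplicate (joined? E) S)
    pairs [] = []
    pairs (x ∷ S) = All.all-filter (¬? ∘ joined? E x) (deduplicate (joined? E) S) ∷ AllPairs.filter⁺ (¬? ∘ joined? E x) (pairs S)
    rep : ∀ S {a} → a ∈ S → ∃[ b ] (b ∈ deduplicate (joined? E) S × Joined E a b)
    rep (x ∷ S) (here ≡.refl) = x , here ≡.refl , ε
    rep (x ∷ S) (there a∈S) with rep S a∈S
    ... | b , b∈ , aJb with joined? E x b
    ...   | yes xJb = x , here ≡.refl , aJb ◅◅ joined-sym xJb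
    ...   | no ¬xJb = b , there (∈-filter⁺ (¬? ∘ joined? E x) b∈ ¬xJb) , aJb

  #components-≡ : ∀ {E S reps} → Representatives E S reps → #components ⟨ S , E ⟩ ≡ length reps
  #components-≡ {E} {S} = representatives-length (deduplicate-representatives E S)

  allPairs-map-∈ : ∀ {ℓ₁ ℓ₂} {P : Fin n → Fin n → Set ℓ₁} {Q : Fin n → Fin n → Set ℓ₂} {xs} →
    (∀ {x y} → x ∈ xs → y ∈ xs → P x y → Q x y) → AllPairs P xs → AllPairs Q xs
  allPairs-map-∈ f [] = []
  allPairs-map-∈ f (px ∷ pxs) = All.tabulate (λ y∈ → f (here ≡.refl) (there y∈) (All.lookup px y∈)) ∷ allPairs-map-∈ (λ x∈ y∈ → f (there x∈) (there y∈)) pxs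

  ∈⇒deg : ∀ {a b} {E : List (Fin n × Fin n)} → (a , b) ∈ᴱ E → 1 ≤ deg a E × 1 ≤ deg b E
  ∈⇒deg {a} {b} {_ ∷ E} (here ≡.refl) =
      ℕ.≤-trans (ℕ.≤-reflexive (≡.sym ([≟]-refl a))) (ℕ.≤-trans (ℕ.m≤m+n [ a ≟ a ] [ a ≟ b ]) (ℕ.m≤m+n _ (deg a E)))
    , ℕ.≤-trans (ℕ.≤-reflexive (≡.sym ([≟]-refl b))) (ℕ.≤-trans (ℕ.m≤n+m [ b ≟ b ] [ b ≟ a ]) (ℕ.m≤m+n _ (deg b E)))
  ∈⇒deg {a} {b} {(c , d) ∷ E} (there p) with ∈⇒deg {a} {b} {E} p
  ... | 1≤a , 1≤b = ℕ.≤-trans 1≤a (ℕ.m≤n+m (deg a E) _) , ℕ.≤-trans 1≤b (ℕ.m≤n+m (deg b E) _)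

  isolated : ∀ {u b} {E : List (Fin n × Fin n)} → deg u E ≡ 0 → Joined E u b → u ≡ b
  isolated deg≡0 ε = ≡.refl
  isolated {E = E} deg≡0 (inj₁ p ◅ _) = contradiction (≡.sym deg≡0) (ℕ.<⇒≢ (proj₁ (∈⇒deg {E = E} p)))
  isolated {E = E} deg≡0 (inj₂ p ◅ _) = contradiction (≡.sym deg≡0) (ℕ.<⇒≢ (proj₂ (∈⇒deg {E = E} p)))

  joined-there : ∀ {e} {E : List (Fin n × Fin n)} {a b} → Joined E a b → Joined (e ∷ E) a b
  joined-there = Star.map λ { (inj₁ p) → inj₁ (there p) ; (inj₂ p) → inj₂ (there p) }

  joined-unloop : ∀ {u} {E : List (Fin n × Fin n)} {a b} → Joined ((u , u) ∷ E) a b → Joined E a b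
  joined-unloop ε = ε
  joined-unloop (inj₁ (here ≡.refl) ◅ p) = joined-unloop p
  joined-unloop (inj₂ (here ≡.refl) ◅ p) = joined-unloop p
  joined-unloop (inj₁ (there q) ◅ p) = inj₁ q ◅ joined-unloop p
  joined-unloop (inj₂ (there q) ◅ p) = inj₂ q ◅ joined-unloop p

  merge-≢ : ∀ {u v w : Fin n} → w ≢ u → merge u v w ≡ w
  merge-≢ {u} {v} {w} w≢u rewrite dec-false (w Fin.≟ u) w≢u = ≡.refl

  module _ (u v : Fin n) (E : List (Fin n × Fin n)) where

    joined-merge : ∀ a → Joined ((u , v) ∷ E) a (merge u v a)
    joined-merge a with a Fin.≟ u
    ... | yes ≡.refl = inj₁ (here ≡.refl) ◅ ε
    ... | no _ = ε

    private
      adjacent-unmerge : ∀ {a b} → Adjacent (mergeArcs u v E) a b → Joined ((u , v) ∷ E) a b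
      adjacent-unmerge (inj₁ p) with ∈-map⁻ _ p
      ... | (c , d) , q , ≡.refl = joined-sym (joined-merge c) ◅◅ (inj₁ (there q) ◅ joined-merge d)
      adjacent-unmerge (inj₂ p) with ∈-map⁻ _ p
      ... | (c , d) , q , ≡.refl = joined-sym (joined-merge d) ◅◅ (inj₂ (there q) ◅ joined-merge c)

      merge-u : merge u v u ≡ v
      merge-u rewrite dec-true (u Fin.≟ u) ≡.refl = ≡.refl

      merge-v : merge u v v ≡ v
      merge-v with v Fin.≟ u
      ... | yes _ = ≡.refl
      ... | no _ = ≡.refl

    unmerge-joined : ∀ {a b} → Joined (mergeArcs u v E) a b → Joined ((u , v) ∷ E) a b
    unmerge-joined ε = ε
    unmerge-joined (p ◅ q) = adjacent-unmerge p ◅◅ unmerge-joined q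

    merge-joined : ∀ {a b} → Joined ((u , v) ∷ E) a b → Joined (mergeArcs u v E) (merge u v a) (merge u v b)
    merge-joined ε = ε
    merge-joined {b = b} (inj₁ (here ≡.refl) ◅ q) = ≡.subst (λ k → Joined (mergeArcs u v E) k (merge u v b)) (≡.trans merge-v (≡.sym merge-u)) (merge-joined q)
    merge-joined {b = b} (inj₂ (here ≡.refl) ◅ q) = ≡.subst (λ k → Joined (mergeArcs u v E) k (merge u v b)) (≡.trans merge-u (≡.sym merge-v)) (merge-joined q)
    merge-joined (inj₁ (there p) ◅ q) = inj₁ (∈-map⁺ _ p) ◅ merge-joined q
    merge-joined (inj₂ (there p) ◅ q) = inj₂ (∈-map⁺ _ p) ◅ merge-joined q

  record Covers (S : List (Fin n)) (H : List (Fin n × Fin n)) : Set where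
    field
      unique : Unique S
      on     : ∀ {w} → w ∈ S → deg w H ≡ 2
      off    : ∀ {w} → w ∉ S → deg w H ≡ 0

    deg≥1⇒∈ : ∀ {w} → 1 ≤ deg w H → w ∈ S
    deg≥1⇒∈ {w} 1≤deg with w ∈? S
    ... | yes w∈S = w∈S
    ... | no w∉S = contradiction (≡.sym (off w∉S)) (ℕ.<⇒≢ 1≤deg)

  private
    remove? : ∀ u → (w : Fin n) → Dec (w ≢ u)
    remove? u w = ¬? (w Fin.≟ u)

  covers-unloop : ∀ {S u H} → Covers S ((u , u) ∷ H) → u ∈ S × deg u H ≡ 0 × Covers (remove u S) H
  covers-unloop {S} {u} {H} covers = u∈S , deg-u , record
    { unique = Unique.filter⁺ (remove? u) unique
    ; on = λ w∈ → let w∈S , w≢u = ∈-filter⁻ (remove? u) w∈ in ≡.trans (≡.sym (deg-≢ w≢u)) (on w∈S)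
    ; off = off′
    }
    where
    open Covers covers
    deg-≢ : ∀ {w} → w ≢ u → deg w ((u , u) ∷ H) ≡ deg w H
    deg-≢ w≢u = ≡.cong₂ (λ x y → x ℕ.+ y ℕ.+ deg _ H) ([≟]-≢ w≢u) ([≟]-≢ w≢u)
    u∈S : u ∈ S
    u∈S = deg≥1⇒∈ (proj₁ (∈⇒deg {E = (u , u) ∷ H} (here ≡.refl)))
    deg-u : deg u H ≡ 0
    deg-u = ℕ.+-cancelˡ-≡ 2 _ _ (≡.trans (≡.sym (≡.cong (λ x → x ℕ.+ x ℕ.+ deg u H) ([≟]-refl u))) (on u∈S))
    off′ : ∀ {w} → w ∉ remove u S → deg w H ≡ 0
    off′ {w} w∉ with w Fin.≟ u
    ... | yes ≡.refl = deg-u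
    ... | no w≢u = ≡.trans (≡.sym (deg-≢ w≢u)) (off λ w∈S → w∉ (∈-filter⁺ (remove? u) w∈S w≢u))

  -- The loop exhausts the degree of `u`, so `u` is isolated in `H` and forms a component of its
  -- own.
  #components-unloop : ∀ {S u H} → Covers S ((u , u) ∷ H) →
    #components ⟨ S , (u , u) ∷ H ⟩ ≡ suc (#components ⟨ remove u S , H ⟩)
  #components-unloop {S} {u} {H} covers with covers-unloop covers
  ... | u∈S , deg-u , _ = #components-≡ record
    { unrelated = All.tabulate (λ b∈ uJb → proj₂ (∈-filter⁻ (remove? u) {xs = S} (sound reps b∈)) (≡.sym (isolated {E = H} deg-u (joined-unloop uJb))))
                ∷ AllPairs.map (λ ¬J → ¬J ∘ joined-unloop) (unrelated reps)
    ; sound = λ { (here ≡.refl) → u∈S ; (there b∈) → proj₁ (∈-filter⁻ (remove? u) (sound reps b∈)) }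
    ; represented = rep
    }
    where
    reps = deduplicate-representatives H (remove u S)
    rep : ∀ {a} → a ∈ S → ∃[ b ] (b ∈ u ∷ deduplicate (joined? H) (remove u S) × Joined ((u , u) ∷ H) a b)
    rep {a} a∈S with a Fin.≟ u
    ... | yes ≡.refl = u , here ≡.refl , ε
    ... | no a≢u with represented reps (∈-filter⁺ (remove? u) a∈S a≢u)
    ...   | b , b∈ , aJb = b , there b∈ , joined-there aJb

  module _ {S : List (Fin n)} {u v : Fin n} {H : List (Fin n × Fin n)} (u≢v : u ≢ v) (covers : Covers S ((u , v) ∷ H)) where
    open Covers covers

    covers-u∈ : u ∈ S
    covers-u∈ = deg≥1⇒∈ (proj₁ (∈⇒deg {E = (u , v) ∷ H} (here ≡.refl)))

    private
      v∈S : v ∈ S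
      v∈S = deg≥1⇒∈ (proj₂ (∈⇒deg {E = (u , v) ∷ H} (here ≡.refl)))

    covers-deg-u : deg u H ≡ 1
    covers-deg-u = ℕ.suc-injective (≡.trans (≡.sym (≡.cong₂ (λ x y → x ℕ.+ y ℕ.+ deg u H) ([≟]-refl u) ([≟]-≢ u≢v))) (on covers-u∈))

    covers-deg-v : deg v H ≡ 1
    covers-deg-v = ℕ.suc-injective (≡.trans (≡.sym (≡.cong₂ (λ x y → x ℕ.+ y ℕ.+ deg v H) ([≟]-≢ (u≢v ∘ ≡.sym)) ([≟]-refl v))) (on v∈S))

    covers-merge : Covers (remove u S) (mergeArcs u v H)
    covers-merge = record
      { unique = Unique.filter⁺ (remove? u) unique
      ; on = λ w∈ → let w∈S , w≢u = ∈-filter⁻ (remove? u) w∈ in on′ w∈S w≢u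
      ; off = off′
      }
      where
      deg-v : deg v (mergeArcs u v H) ≡ 2
      deg-v = ≡.trans (deg-merge-v u≢v H) (≡.cong₂ ℕ._+_ covers-deg-u covers-deg-v)
      deg-≢ : ∀ {w} → w ≢ u → w ≢ v → deg w (mergeArcs u v H) ≡ deg w ((u , v) ∷ H)
      deg-≢ w≢u w≢v = ≡.trans (deg-merge-≢ u≢v H w≢u w≢v) (≡.sym (≡.cong₂ (λ x y → x ℕ.+ y ℕ.+ deg _ H) ([≟]-≢ w≢u) ([≟]-≢ w≢v)))
      on′ : ∀ {w} → w ∈ S → w ≢ u → deg w (mergeArcs u v H) ≡ 2
      on′ {w} w∈S w≢u with w Fin.≟ v
      ... | yes ≡.refl = deg-v
      ... | no w≢v = ≡.trans (deg-≢ w≢u w≢v) (on w∈S)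
      off′ : ∀ {w} → w ∉ remove u S → deg w (mergeArcs u v H) ≡ 0
      off′ {w} w∉ with w Fin.≟ u | w Fin.≟ v
      ... | yes ≡.refl | _ = deg-merge-u u≢v H
      ... | no w≢u | yes ≡.refl = contradiction (∈-filter⁺ (remove? u) v∈S w≢u) w∉
      ... | no w≢u | no w≢v = ≡.trans (deg-≢ w≢u w≢v) (off λ w∈S → w∉ (∈-filter⁺ (remove? u) w∈S w≢u))

    -- Representatives chosen after the contraction also serve before it. None of them is `u`, so
    -- `merge` fixes them and a path between two of them survives the contraction; and every vertex
    -- is joined to its image under `merge`.
    #components-merge : #components ⟨ S , (u , v) ∷ H ⟩ ≡ #components ⟨ remove u S , mergeArcs u v H ⟩
    #components-merge = #components-≡ record
      { unrelated = allPairs-map-∈ (λ a∈ b∈ ¬J aJb → ¬J (≡.subst₂ (Joined (mergeArcs u v H)) (merge-≢ (≢u a∈)) (merge-≢ (≢u b∈)) (merge-joined u v H aJb))) (unrelated reps)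
      ; sound = λ b∈ → proj₁ (∈-filter⁻ (remove? u) (sound reps b∈))
      ; represented = rep
      }
      where
      reps = deduplicate-representatives (mergeArcs u v H) (remove u S)
      ≢u : ∀ {b} → b ∈ deduplicate (joined? (mergeArcs u v H)) (remove u S) → b ≢ u
      ≢u b∈ = proj₂ (∈-filter⁻ (remove? u) {xs = S} (sound reps b∈))
      merge∈ : ∀ {a} → a ∈ S → merge u v a ∈ remove u S
      merge∈ {a} a∈S with a Fin.≟ u
      ... | yes _ = ∈-filter⁺ (remove? u) v∈S (u≢v ∘ ≡.sym)
      ... | no a≢u = ∈-filter⁺ (remove? u) a∈S a≢u
      rep : ∀ {a} → a ∈ S → ∃[ b ] (b ∈ deduplicate (joined? (mergeArcs u v H)) (remove u S) × Joined ((u , v) ∷ H) a b)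
      rep {a} a∈S with represented reps (merge∈ a∈S)
      ... | b , b∈ , J = b , b∈ , joined-merge u v H a ◅◅ unmerge-joined u v H J

  data Orientation : List (Fin n × Fin n) → List (Fin n × Fin n) → Set where
    []   : Orientation [] []
    keep : ∀ {u v H o} → Orientation H o → Orientation ((u , v) ∷ H) ((u , v) ∷ o)
    flip : ∀ {u v H o} → Orientation H o → Orientation ((u , v) ∷ H) ((v , u) ∷ o)

  deg-orientation : ∀ w {H o} → Orientation H o → deg w o ≡ deg w H
  deg-orientation w [] = ≡.refl
  deg-orientation w {(u , v) ∷ _} (keep p) = ≡.cong ([ w ≟ u ] ℕ.+ [ w ≟ v ] ℕ.+_) (deg-orientation w p)
  deg-orientation w {(u , v) ∷ _} (flip p) = ≡.cong₂ ℕ._+_ (ℕ.+-comm [ w ≟ v ] [ w ≟ u ]) (deg-orientation w p)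

  length-orientation : ∀ {H o} → Orientation H o → length o ≡ length H
  length-orientation [] = ≡.refl
  length-orientation (keep p) = ≡.cong suc (length-orientation p)
  length-orientation (flip p) = ≡.cong suc (length-orientation p)

module _ {n : ℕ} where

  Loopless : List (Fin n × Fin n) → Set
  Loopless = All λ e → proj₁ e ≢ proj₂ e

-- Sums over orientations

module CycleSums {c ℓ} (R : CommutativeRing c ℓ) {n : ℕ} where
  open CommutativeRing R hiding (zero)
  open RingProperties ring
  open SemiringDefinitions (Semiring.rawSemiring semiring) using (_^_)
  open ArcSigns R {n}
  open SetoidReasoning setoid

  -- A loop is counted in both directions although these coincide: it stands for a contracted cycle,
  -- which has two orientations.
  sumOrientations : List (Arc {n}) → (List (Arc {n}) → Carrier) → Carrier
  sumOrientations []            f = f []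
  sumOrientations ((u , v) ∷ H) f = sumOrientations H λ o → f ((u , v) ∷ o) + f ((v , u) ∷ o)

  sumOrientations-cong : ∀ H {f g} → (∀ {o} → Orientation H o → f o ≈ g o) → sumOrientations H f ≈ sumOrientations H g
  sumOrientations-cong []            f≈g = f≈g []
  sumOrientations-cong ((u , v) ∷ H) f≈g = sumOrientations-cong H λ p → +-cong (f≈g (keep p)) (f≈g (flip p))

  sumOrientations-scale : ∀ H a f → sumOrientations H (λ o → a * f o) ≈ a * sumOrientations H f
  sumOrientations-scale []            a f = refl
  sumOrientations-scale ((u , v) ∷ H) a f = trans (sumOrientations-cong H λ _ → sym (distribˡ a _ _))
    (sumOrientations-scale H a (λ o → f ((u , v) ∷ o) + f ((v , u) ∷ o)))

  sumOrientations-+ : ∀ H f g → sumOrientations H (λ o → f o + g o) ≈ sumOrientations H f + sumOrientations H g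
  sumOrientations-+ []            f g = refl
  sumOrientations-+ ((u , v) ∷ H) f g = trans (sumOrientations-cong H λ _ → interchange _ _ _ _)
    (sumOrientations-+ H (λ o → f ((u , v) ∷ o) + f ((v , u) ∷ o)) (λ o → g ((u , v) ∷ o) + g ((v , u) ∷ o)))
    where open CommutativeSemigroupProperties +-commutativeSemigroup using (interchange)

  sumOrientations-zero : ∀ H {f} → (∀ {o} → Orientation H o → f o ≈ 0#) → sumOrientations H f ≈ 0#
  sumOrientations-zero []            f≈0 = f≈0 []
  sumOrientations-zero ((u , v) ∷ H) f≈0 = sumOrientations-zero H λ p → trans (+-cong (f≈0 (keep p)) (f≈0 (flip p))) (+-identityˡ 0#)

  sumOrientations-merge : ∀ u v H f → sumOrientations (mergeArcs u v H) f ≈ sumOrientations H (f ∘ mergeArcs u v)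
  sumOrientations-merge u v []      f = refl
  sumOrientations-merge u v (e ∷ H) f = sumOrientations-merge u v H _

  cycleSum : List (Arc {n}) → Carrier
  cycleSum H = sumOrientations H arcSign

  cycleSum-degree : ∀ w H → deg w H ≢ 0 → deg w H ≢ 2 → cycleSum H ≈ 0#
  cycleSum-degree w H deg≢0 deg≢2 = sumOrientations-zero H λ {o} p →
    arcSign-degree w o (deg≢0 ∘ ≡.trans (≡.sym (deg-orientation w p))) (deg≢2 ∘ ≡.trans (≡.sym (deg-orientation w p)))

  -2# : Carrier
  -2# = - (1# + 1#)

  private
    -x-x : ∀ x → - x + - x ≈ -2# * x
    -x-x x = trans (-‿+-comm x x) (trans (-‿cong (sym (trans (distribʳ x 1# 1#) (+-cong (*-identityˡ x) (*-identityˡ x))))) (-‿distribˡ-* _ _))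

    out≡0 : ∀ u (o : List (Arc {n})) → deg u o ≡ 0 → outdeg u o ≡ 0
    out≡0 u o deg≡0 = ℕ.m+n≡0⇒m≡0 (outdeg u o) (≡.trans (≡.sym (deg≡out+in u o)) deg≡0)

    covers-[] : ∀ {S : List (Fin n)} → Covers S [] → S ≡ []
    covers-[] {[]} _ = ≡.refl
    covers-[] {w ∷ S} covers = case Covers.on covers (here ≡.refl) of λ ()

    -- A loop contributes -1 in each of its directions and removes a component; any other edge is
    -- contracted, which changes neither side. Each step removes one vertex and one edge, so the
    -- equality of their numbers comes along. The induction is on `m` because the contracted list is
    -- not a sublist of `H`.
    cycleSum-covers′ : ∀ m H {S} → length H ≡ m → Covers S H →
      cycleSum H ≈ -2# ^ #components ⟨ S , H ⟩ × length S ≡ length H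
    cycleSum-covers′ m [] _ covers with ≡.refl ← covers-[] covers = arcSign-[] , ≡.refl
    cycleSum-covers′ (suc m) ((u , v) ∷ H) {S} len covers with u Fin.≟ v
    ... | yes ≡.refl with covers-unloop covers
    ...   | u∈S , deg-u , covers′ with cycleSum-covers′ m H (ℕ.suc-injective len) covers′
    ...     | sum≈ , len′ = (begin
      cycleSum ((u , u) ∷ H)                           ≈⟨ sumOrientations-cong H (λ {o} p →
                                                            let loop = arcSign-loop u o (out≡0 u o (≡.trans (deg-orientation u p) deg-u))
                                                            in trans (+-cong loop loop) (-x-x _)) ⟩
      sumOrientations H (λ o → -2# * arcSign o)        ≈⟨ sumOrientations-scale H -2# arcSign ⟩
      -2# * cycleSum H                                 ≈⟨ *-congˡ sum≈ ⟩
      -2# * -2# ^ #components ⟨ remove u S , H ⟩       ≡⟨ ≡.cong (-2# ^_) (≡.sym (#components-unloop covers)) ⟩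
      -2# ^ #components ⟨ S , (u , u) ∷ H ⟩            ∎)
      , ≡.trans (length-remove (Covers.unique covers) u∈S) (≡.cong suc len′)
    cycleSum-covers′ (suc m) ((u , v) ∷ H) {S} len covers | no u≢v
      with cycleSum-covers′ m (mergeArcs u v H) (≡.trans (length-map _ H) (ℕ.suc-injective len)) (covers-merge u≢v covers)
    ... | sum≈ , len′ = (begin
      cycleSum ((u , v) ∷ H)                                         ≈⟨ sumOrientations-cong H (λ {o} p → arcSign-contract u≢v o
                                                                          (≡.trans (deg-orientation u p) (covers-deg-u u≢v covers))
                                                                          (≡.trans (deg-orientation v p) (covers-deg-v u≢v covers))) ⟩
      sumOrientations H (arcSign ∘ mergeArcs u v)                    ≈⟨ sumOrientations-merge u v H arcSign ⟨
      cycleSum (mergeArcs u v H)                                     ≈⟨ sum≈ ⟩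
      -2# ^ #components ⟨ remove u S , mergeArcs u v H ⟩             ≡⟨ ≡.cong (-2# ^_) (≡.sym (#components-merge u≢v covers)) ⟩
      -2# ^ #components ⟨ S , (u , v) ∷ H ⟩                          ∎)
      , ≡.trans (length-remove (Covers.unique covers) (covers-u∈ u≢v covers)) (≡.cong suc (≡.trans len′ (length-map _ H)))

  cycleSum-covers : ∀ {S H} → Covers S H → cycleSum H ≈ -2# ^ #components ⟨ S , H ⟩
  cycleSum-covers {H = H} covers = proj₁ (cycleSum-covers′ (length H) H ≡.refl covers)

  covers-length : ∀ {S H} → Covers S H → length S ≡ length H
  covers-length {H = H} covers = proj₂ (cycleSum-covers′ (length H) H ≡.refl covers)

  doubled : List (Arc {n}) → List (Arc {n})
  doubled []            = []
  doubled ((u , v) ∷ F) = (u , v) ∷ (v , u) ∷ doubled F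

  Avoids : List (Arc {n}) → List (Arc {n}) → Set
  Avoids o = All λ e → deg (proj₁ e) o ≡ 0 × deg (proj₂ e) o ≡ 0

  private
    deg-doubled-zero : ∀ w F o → deg w o ≡ 0 → All (λ e → w ≢ proj₁ e × w ≢ proj₂ e) F → deg w (doubled F ++ o) ≡ 0
    deg-doubled-zero w [] o deg≡0 [] = deg≡0
    deg-doubled-zero w ((u , v) ∷ F) o deg≡0 ((w≢u , w≢v) ∷ rest) =
      ≡.trans (≡.cong₂ (λ x y → x ℕ.+ y ℕ.+ (y ℕ.+ x ℕ.+ deg w (doubled F ++ o))) ([≟]-≢ w≢u) ([≟]-≢ w≢v)) (deg-doubled-zero w F o deg≡0 rest)

    zero-deg-doubled : ∀ w F o → deg w (doubled F ++ o) ≡ 0 → deg w o ≡ 0 × All (λ e → w ≢ proj₁ e × w ≢ proj₂ e) F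
    zero-deg-doubled w [] o deg≡0 = deg≡0 , []
    zero-deg-doubled w ((u , v) ∷ F) o deg≡0 = proj₁ rest , (≢-of u sum≡0ˡ , ≢-of v sum≡0ʳ) ∷ proj₂ rest
      where
      head≡0 : [ w ≟ u ] ℕ.+ [ w ≟ v ] ≡ 0
      head≡0 = ℕ.m+n≡0⇒m≡0 ([ w ≟ u ] ℕ.+ [ w ≟ v ]) deg≡0
      sum≡0ˡ : [ w ≟ u ] ≡ 0
      sum≡0ˡ = ℕ.m+n≡0⇒m≡0 [ w ≟ u ] head≡0
      sum≡0ʳ : [ w ≟ v ] ≡ 0
      sum≡0ʳ = ℕ.m+n≡0⇒n≡0 [ w ≟ u ] head≡0
      ≢-of : ∀ z → [ w ≟ z ] ≡ 0 → w ≢ z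
      ≢-of z eq ≡.refl = case ≡.trans (≡.sym ([≟]-refl w)) eq of λ ()
      rest = zero-deg-doubled w F o (ℕ.m+n≡0⇒n≡0 ([ w ≟ v ] ℕ.+ [ w ≟ u ]) (ℕ.m+n≡0⇒n≡0 ([ w ≟ u ] ℕ.+ [ w ≟ v ]) deg≡0))

  arcSign-doubled : ∀ F o → Loopless F → AllPairs DisjointEdges F → Avoids o F →
    arcSign (doubled F ++ o) ≈ (- 1#) ^ length F * arcSign o
  arcSign-doubled [] o _ _ _ = sym (*-identityˡ _)
  arcSign-doubled ((u , v) ∷ F) o (u≢v ∷ loopless) (disj ∷ match) ((deg-u , deg-v) ∷ avoids) = begin
    arcSign ((u , v) ∷ (v , u) ∷ doubled F ++ o)    ≈⟨ arcSign-two-cycle u≢v (doubled F ++ o)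
                                                         (deg-doubled-zero u F o deg-u (All.map proj₁ disj))
                                                         (deg-doubled-zero v F o deg-v (All.map proj₂ disj)) ⟩
    - arcSign (doubled F ++ o)                      ≈⟨ -‿cong (arcSign-doubled F o loopless match avoids) ⟩
    - ((- 1#) ^ length F * arcSign o)               ≈⟨ trans (sym (-1*x≈-x _)) (sym (*-assoc _ _ _)) ⟩
    - 1# * (- 1#) ^ length F * arcSign o            ∎

  -- If the ends of the first edge meet no other arc, its 2-cycle is split off and the failure lies
  -- in the rest; otherwise one of its ends has too large a degree.
  arcSign-doubled-zero : ∀ F o → Loopless F → ¬ (AllPairs DisjointEdges F × Avoids o F) → arcSign (doubled F ++ o) ≈ 0#
  arcSign-doubled-zero [] o _ bad = contradiction ([] , []) bad
  arcSign-doubled-zero ((u , v) ∷ F) o (u≢v ∷ loopless) bad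
    with deg u (doubled F ++ o) ℕ.≟ 0 | deg v (doubled F ++ o) ℕ.≟ 0
  ... | no deg≢0 | _ = arcSign-two-cycle-touching u≢v (doubled F ++ o) (inj₁ deg≢0)
  ... | yes _ | no deg≢0 = arcSign-two-cycle-touching u≢v (doubled F ++ o) (inj₂ deg≢0)
  ... | yes deg-u | yes deg-v = trans (arcSign-two-cycle u≢v (doubled F ++ o) deg-u deg-v)
    (trans (-‿cong (arcSign-doubled-zero F o loopless λ (match , avoids) → bad
        ( All.zipWith id (proj₂ du , proj₂ dv) ∷ match , (proj₁ du , proj₁ dv) ∷ avoids)))
      -0#≈0#)
    where
    du = zero-deg-doubled u F o deg-u
    dv = zero-deg-doubled v F o deg-v

-- Expansion of the determinant along edges

module ListSums {c ℓ} (R : CommutativeRing c ℓ) where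
  open CommutativeRing R hiding (zero)
  open CommutativeSemigroupProperties +-commutativeSemigroup using (interchange)

  when : ∀ {p} {P : Set p} → Dec P → Carrier → Carrier
  when P? x = if does P? then x else 0#

  when-yes : ∀ {p} {P : Set p} (P? : Dec P) {x} → P → when P? x ≡ x
  when-yes P? p rewrite dec-true P? p = ≡.refl

  when-no : ∀ {p} {P : Set p} (P? : Dec P) {x} → ¬ P → when P? x ≡ 0#
  when-no P? ¬p rewrite dec-false P? ¬p = ≡.refl

  when-⇔ : ∀ {p q} {P : Set p} {Q : Set q} (P? : Dec P) (Q? : Dec Q) {x y} →
    (P → Q) → (Q → P) → (P → x ≈ y) → when P? x ≈ when Q? y
  when-⇔ (yes p) Q? P⇒Q Q⇒P x≈y = trans (x≈y p) (reflexive (≡.sym (when-yes Q? (P⇒Q p))))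
  when-⇔ (no ¬p) Q? P⇒Q Q⇒P x≈y = reflexive (≡.sym (when-no Q? (¬p ∘ Q⇒P)))

  when-* : ∀ {p} {P : Set p} (P? : Dec P) {x} a → a * when P? x ≈ when P? (a * x)
  when-* (yes p) a = refl
  when-* (no ¬p) a = zeroʳ a

  module _ {a} {A : Set a} where

    sumᴸ : (A → Carrier) → List A → Carrier
    sumᴸ f xs = foldr (λ x s → f x + s) 0# xs

    sumᴸ-cong-∈ : ∀ {ℓ′} {P : A → Set ℓ′} {f g} xs → All P xs → (∀ {x} → P x → f x ≈ g x) → sumᴸ f xs ≈ sumᴸ g xs
    sumᴸ-cong-∈ [] [] f≈g = refl
    sumᴸ-cong-∈ (x ∷ xs) (px ∷ pxs) f≈g = +-cong (f≈g px) (sumᴸ-cong-∈ xs pxs f≈g)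

    sumᴸ-cong : ∀ {f g} xs → (∀ x → f x ≈ g x) → sumᴸ f xs ≈ sumᴸ g xs
    sumᴸ-cong [] f≈g = refl
    sumᴸ-cong (x ∷ xs) f≈g = +-cong (f≈g x) (sumᴸ-cong xs f≈g)

    sumᴸ-zero : ∀ {f} xs → (∀ x → f x ≈ 0#) → sumᴸ f xs ≈ 0#
    sumᴸ-zero [] f≈0 = refl
    sumᴸ-zero (x ∷ xs) f≈0 = trans (+-cong (f≈0 x) (sumᴸ-zero xs f≈0)) (+-identityˡ 0#)

    sumᴸ-+ : ∀ f g xs → sumᴸ (λ x → f x + g x) xs ≈ sumᴸ f xs + sumᴸ g xs
    sumᴸ-+ f g [] = sym (+-identityˡ 0#)
    sumᴸ-+ f g (x ∷ xs) = trans (+-congˡ (sumᴸ-+ f g xs)) (interchange _ _ _ _)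

    sumᴸ-scale : ∀ a f xs → sumᴸ (λ x → a * f x) xs ≈ a * sumᴸ f xs
    sumᴸ-scale a f [] = sym (zeroʳ a)
    sumᴸ-scale a f (x ∷ xs) = trans (+-congˡ (sumᴸ-scale a f xs)) (sym (distribˡ a _ _))

    sumᴸ-++ : ∀ f xs ys → sumᴸ f (xs ++ ys) ≈ sumᴸ f xs + sumᴸ f ys
    sumᴸ-++ f [] ys = sym (+-identityˡ _)
    sumᴸ-++ f (x ∷ xs) ys = trans (+-congˡ (sumᴸ-++ f xs ys)) (sym (+-assoc _ _ _))

    sumᴸ-filter : ∀ {p} {P : A → Set p} (P? : ∀ x → Dec (P x)) f xs → sumᴸ f (filter P? xs) ≈ sumᴸ (λ x → when (P? x) (f x)) xs
    sumᴸ-filter P? f [] = refl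
    sumᴸ-filter P? f (x ∷ xs) with P? x
    ... | yes _ = +-congˡ (sumᴸ-filter P? f xs)
    ... | no _ = trans (sumᴸ-filter P? f xs) (sym (+-identityˡ _))

  sumᴸ-map : ∀ {a b} {A : Set a} {B : Set b} (f : B → Carrier) (g : A → B) xs → sumᴸ f (map g xs) ≈ sumᴸ (f ∘ g) xs
  sumᴸ-map f g [] = refl
  sumᴸ-map f g (x ∷ xs) = +-congˡ (sumᴸ-map f g xs)

  sumᴸ-comm : ∀ {a b} {A : Set a} {B : Set b} (f : A → B → Carrier) xs ys →
    sumᴸ (λ x → sumᴸ (f x) ys) xs ≈ sumᴸ (λ y → sumᴸ (λ x → f x y) xs) ys
  sumᴸ-comm f [] ys = sym (sumᴸ-zero ys λ _ → refl)
  sumᴸ-comm f (x ∷ xs) ys = trans (+-congˡ (sumᴸ-comm f xs ys)) (sym (sumᴸ-+ (f x) _ ys))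

  sumᴸ-sublists-∷ : ∀ {a} {A : Set a} (f : List A → Carrier) x xs →
    sumᴸ f (sublists (x ∷ xs)) ≈ sumᴸ (f ∘ (x ∷_)) (sublists xs) + sumᴸ f (sublists xs)
  sumᴸ-sublists-∷ f x xs = trans (sumᴸ-++ f (map (x ∷_) (sublists xs)) (sublists xs)) (+-congʳ (sumᴸ-map f (x ∷_) (sublists xs)))

module _ {c ℓ} (R : CommutativeRing c ℓ) {a} {A : Set a} where
  open CommutativeRing R

  -- With this an edge used in both directions has weight one, so the matchings in the expansion are
  -- unweighted.
  SquaresToOne : (A → Carrier) → Set (a ⊔ ℓ)
  SquaresToOne s = ∀ x → s x * s x ≈ 1#

module DeterminantExpansion {c ℓ} (R : CommutativeRing c ℓ) {n : ℕ}
  (x : CommutativeRing.Carrier R) (s : Fin n × Fin n → CommutativeRing.Carrier R) where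
  open CommutativeRing R hiding (zero)
  open RingProperties ring
  open SemiringDefinitions (Semiring.rawSemiring semiring) using (_^_)
  open DeterminantTheory R
  open DeterminantKernel R using (-1^k-involutive)
  open ArcSigns R {n}
  open CycleSums R {n}
  open ListSums R
  open IntegerScalars R
  open Solver using (solve; _:=_; _:+_; _:*_; :-_; _:-_)
  open SetoidReasoning setoid

  -- The matrix `x I - A` built up edge by edge, which allows an induction on the edge list. The
  -- weight `s (a , b)` serves both directions of the recorded edge.
  baseMatrix : List (Arc {n}) → Mat n
  baseMatrix []            i j = x * δ i j
  baseMatrix ((a , b) ∷ E) i j = baseMatrix E i j - s (a , b) * (δ a i * δ b j) - s (a , b) * (δ b i * δ a j)

  override : List (Arc {n}) → Mat n → Mat n
  override []            B i j = B i j
  override ((a , b) ∷ L) B i j = if does (i Fin.≟ a) then δ b j else override L B i j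

  -- The coefficient of the arcs of L in the determinant, which is multilinear in
  -- the rows; it vanishes when two arcs of L compete for a row.
  minorOf : List (Arc {n}) → Mat n → Carrier
  minorOf L B = when (singleOut? L) (det (override L B))

  minorOf-single : ∀ L B → SingleOut L → minorOf L B ≈ det (override L B)
  minorOf-single L B single = reflexive (when-yes (singleOut? L) single)

  minorOf-multiple : ∀ L B → ¬ SingleOut L → minorOf L B ≈ 0#
  minorOf-multiple L B ¬single = reflexive (when-no (singleOut? L) ¬single)

  private
    override-row : ∀ L {B B′ : Mat n} i → (outdeg i L ≡ 0 → ∀ j → B i j ≈ B′ i j) → ∀ j → override L B i j ≈ override L B′ i j
    override-row [] i B≈B′ j = B≈B′ ≡.refl j
    override-row ((a , b) ∷ L) i B≈B′ j with i Fin.≟ a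
    ... | yes _ = refl
    ... | no _ = override-row L i B≈B′ j

    override-free : ∀ L (B : Mat n) i j → outdeg i L ≡ 0 → override L B i j ≈ B i j
    override-free [] B i j _ = refl
    override-free ((a , b) ∷ L) B i j out≡0 with i Fin.≟ a
    ... | no _ = override-free L B i j out≡0

    override-here : ∀ a b L (B : Mat n) j → override ((a , b) ∷ L) B a j ≡ δ b j
    override-here a b L B j rewrite dec-true (a Fin.≟ a) ≡.refl = ≡.refl

    override-there : ∀ {a i} b L (B : Mat n) j → i ≢ a → override ((a , b) ∷ L) B i j ≡ override L B i j
    override-there {a} {i} b L B j i≢a rewrite dec-false (i Fin.≟ a) i≢a = ≡.refl

  -- Linearity in row `a`. If an arc of `L` already occupies that row, the change is invisible, and
  -- the extra term vanishes because two arcs would leave `a`.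
  minorOf-arc : ∀ L a b y (B B′ : Mat n) → (∀ i j → B′ i j ≈ B i j - y * (δ a i * δ b j)) →
    minorOf L B′ ≈ minorOf L B - y * minorOf ((a , b) ∷ L) B
  minorOf-arc L a b y B B′ B′≈ = by-cases (singleOut? L) (outdeg a L ℕ.≟ 0)
    where
    x-y0 : ∀ {z w} → w ≈ 0# → z - y * w ≈ z
    x-y0 w≈0 = trans (+-congˡ (trans (-‿cong (trans (*-congˡ w≈0) (zeroʳ y))) -0#≈0#)) (+-identityʳ _)

    rows-≢ : ∀ i → i ≢ a → ∀ j → B′ i j ≈ B i j
    rows-≢ i i≢a j = trans (B′≈ i j) (x-y0 (trans (*-congʳ (reflexive (δ-≢ (i≢a ∘ ≡.sym)))) (zeroˡ _)))

    by-cases : Dec (SingleOut L) → Dec (outdeg a L ≡ 0) → minorOf L B′ ≈ minorOf L B - y * minorOf ((a , b) ∷ L) B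
    by-cases (no ¬single) _ = trans (minorOf-multiple L B′ ¬single) (sym (trans
      (x-y0 (minorOf-multiple ((a , b) ∷ L) B (¬single ∘ singleOut-tail (a , b) L))) (minorOf-multiple L B ¬single)))
    by-cases (yes single) (no out≢0) = trans (trans (minorOf-single L B′ single) (trans (det-cong same) (sym (minorOf-single L B single))))
      (sym (x-y0 (minorOf-multiple ((a , b) ∷ L) B (out≢0 ∘ singleOut-head a b L))))
      where
      same : ∀ i j → override L B′ i j ≈ override L B i j
      same i = override-row L i λ out≡0 → rows-≢ i λ { ≡.refl → out≢0 out≡0 }
    by-cases (yes single) (yes out≡0) = begin
      minorOf L B′                                       ≈⟨ minorOf-single L B′ single ⟩
      det (override L B′)                                ≈⟨ det-row-linear a {1#} {(- y)}
                                                              (λ i i≢a → override-row L i λ _ → rows-≢ i i≢a)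
                                                              (λ i i≢a j → trans (override-row L i (λ _ → rows-≢ i i≢a) j) (reflexive (≡.sym (override-there b L B j i≢a))))
                                                              row-a ⟩
      1# * det (override L B) + - y * det (override ((a , b) ∷ L) B)
        ≈⟨ +-cong (trans (*-identityˡ _) (sym (minorOf-single L B single)))
                  (trans (sym (-‿distribˡ-* _ _)) (-‿cong (*-congˡ (sym (minorOf-single ((a , b) ∷ L) B (singleOut-cons a b L single out≡0)))))) ⟩
      minorOf L B - y * minorOf ((a , b) ∷ L) B          ∎
      where
      row-a : ∀ j → override L B′ a j ≈ 1# * override L B a j + - y * override ((a , b) ∷ L) B a j
      row-a j = begin
        override L B′ a j                     ≈⟨ override-free L B′ a j out≡0 ⟩
        B′ a j                                ≈⟨ B′≈ a j ⟩
        B a j - y * (δ a a * δ b j)           ≈⟨ +-cong (sym (trans (*-identityˡ _) (override-free L B a j out≡0)))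
                                                   (trans (-‿cong (*-congˡ (trans (*-congʳ (reflexive (δ-diag a))) (*-identityˡ _)))) (trans (-‿distribˡ-* _ _) (*-congˡ (reflexive (≡.sym (override-here a b L B j)))))) ⟩
        1# * override L B a j + - y * override ((a , b) ∷ L) B a j ∎

  minorOf-edge : ∀ L a b E → let y = s (a , b) in
    minorOf L (baseMatrix ((a , b) ∷ E)) ≈
      (minorOf L (baseMatrix E) - y * minorOf ((a , b) ∷ L) (baseMatrix E))
        - y * (minorOf ((b , a) ∷ L) (baseMatrix E) - y * minorOf ((a , b) ∷ (b , a) ∷ L) (baseMatrix E))
  minorOf-edge L a b E = trans (minorOf-arc L b a (s (a , b)) B′ _ λ _ _ → refl)
    (+-cong (minorOf-arc L a b (s (a , b)) (baseMatrix E) B′ λ _ _ → refl)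
      (-‿cong (*-congˡ (minorOf-arc ((b , a) ∷ L) a b (s (a , b)) (baseMatrix E) B′ λ _ _ → refl))))
    where
    B′ : Mat n
    B′ i j = baseMatrix E i j - s (a , b) * (δ a i * δ b j)

  private
    ∏ : ∀ {m} → (Fin m → Carrier) → Carrier
    ∏ = SemiringDefinitions.product (Semiring.rawSemiring semiring)

  det-row-scale : ∀ {m} (y : Fin m → Carrier) (M : Mat m) → det (λ i j → y i * M i j) ≈ ∏ y * det M
  det-row-scale {zero} y M = sym (*-identityˡ _)
  det-row-scale {suc m} y M = trans (sum-cong-≋ λ j → trans
      (*-congˡ (*-congˡ (det-row-scale (y ∘ suc) (minor M j))))
      (solve 5 (λ s y m p d → s :* ((y :* m) :* (p :* d)) := (y :* p) :* (s :* (m :* d))) refl ((- 1#) ^ toℕ j) (y zero) (M zero j) (∏ (y ∘ suc)) (det (minor M j))))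
    (sym (*-distribˡ-sum (∏ y) (laplaceTerm M)))
    where open SemiringSum semiring

  private
    module Σℕ = SemiringSum ℕ.+-*-semiring

    ∏-power : ∀ {m} (k : Fin m → ℕ) → ∏ (λ i → x ^ k i) ≈ x ^ Σℕ.sum k
    ∏-power {zero} k = refl
    ∏-power {suc m} k = trans (*-congˡ (∏-power (k ∘ suc))) (sym (SemiringExp.^-homo-* semiring x (k zero) (Σℕ.sum (k ∘ suc))))

    Σ-[≟] : ∀ {m} (a : Fin m) → Σℕ.sum (λ i → if does (i Fin.≟ a) then 1 else 0) ≡ 1
    Σ-[≟] {suc m} zero = ≡.cong suc (Σℕ.sum-replicate-zero m)
    Σ-[≟] (suc a) = Σ-[≟] a

    Σ-outdeg : ∀ L → Σℕ.sum (λ (i : Fin n) → outdeg i L) ≡ length L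
    Σ-outdeg [] = Σℕ.sum-replicate-zero n
    Σ-outdeg ((a , b) ∷ L) = ≡.trans (Σℕ.∑-distrib-+ (λ i → [ i ≟ a ]) (λ i → outdeg i L)) (≡.cong₂ ℕ._+_ (Σ-[≟] a) (Σ-outdeg L))

    Σ-1 : ∀ m → Σℕ.sum {m} (λ _ → 1) ≡ m
    Σ-1 zero = ≡.refl
    Σ-1 (suc m) = ≡.cong suc (Σ-1 m)

    Σ-free : ∀ L → SingleOut L → Σℕ.sum (λ (i : Fin n) → 1 ∸ outdeg i L) ≡ n ∸ length L
    Σ-free L single = ≡.trans (≡.sym (ℕ.m+n∸n≡m (Σℕ.sum (λ i → 1 ∸ outdeg i L)) (length L)))
      (≡.cong (_∸ length L) (≡.trans (≡.cong (Σℕ.sum (λ i → 1 ∸ outdeg i L) ℕ.+_) (≡.sym (Σ-outdeg L)))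
        (≡.trans (≡.sym (Σℕ.∑-distrib-+ (λ i → 1 ∸ outdeg i L) (λ i → outdeg i L)))
          (≡.trans (Σℕ.sum-cong-≗ (λ i → ℕ.m∸n+n≡m (single i))) (Σ-1 n)))))

    override-scaled : ∀ L → SingleOut L → ∀ i j → override L (baseMatrix []) i j ≈ x ^ (1 ∸ outdeg i L) * δ (successor L i) j
    override-scaled [] _ i j = *-congʳ (sym (*-identityʳ x))
    override-scaled ((a , b) ∷ L) single i j with i Fin.≟ a
    ... | no _ = override-scaled L (singleOut-tail (a , b) L single) i j
    ... | yes _ = sym (trans (*-congʳ (reflexive (≡.cong (x ^_) (ℕ.0∸n≡0 (outdeg i L))))) (*-identityˡ _))

  arcTerm : List (Arc {n}) → Carrier
  arcTerm L = x ^ (n ∸ length L) * ((- 1#) ^ length L * arcSign L)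

  minorOf-base : ∀ L → minorOf L (baseMatrix []) ≈ arcTerm L
  minorOf-base L = by-cases (singleOut? L)
    where
    by-cases : Dec (SingleOut L) → minorOf L (baseMatrix []) ≈ arcTerm L
    by-cases (no ¬single) = trans (minorOf-multiple L _ ¬single)
      (sym (trans (*-congˡ (trans (*-congˡ (arcSign-multiple L ¬single)) (zeroʳ _))) (zeroʳ _)))
    by-cases (yes single) = begin
      minorOf L (baseMatrix [])                                  ≈⟨ minorOf-single L _ single ⟩
      det (override L (baseMatrix []))                           ≈⟨ det-cong (override-scaled L single) ⟩
      det (λ i j → x ^ (1 ∸ outdeg i L) * δ (successor L i) j)   ≈⟨ det-row-scale (λ i → x ^ (1 ∸ outdeg i L)) (λ i j → δ (successor L i) j) ⟩
      ∏ (λ i → x ^ (1 ∸ outdeg i L)) * sgn (successor L)         ≈⟨ *-cong (trans (∏-power (λ i → 1 ∸ outdeg i L)) (reflexive (≡.cong (x ^_) (Σ-free L single))))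
                                                                      (trans (sym (-1^k-involutive (length L) _)) (*-congˡ (sym (arcSign-single L single)))) ⟩
      arcTerm L                                                  ∎

  arcTerm-↭ : ∀ {L L′} → L ↭ L′ → arcTerm L ≈ arcTerm L′
  arcTerm-↭ p = *-cong (reflexive (≡.cong (λ k → x ^ (n ∸ k)) (Perm.↭-length p)))
    (*-cong (reflexive (≡.cong ((- 1#) ^_) (Perm.↭-length p))) (arcSign-↭ p))

  arcTerm-zero : ∀ L → arcSign L ≈ 0# → arcTerm L ≈ 0#
  arcTerm-zero L sign≈0 = trans (*-congˡ (trans (*-congˡ sign≈0) (zeroʳ _))) (zeroʳ _)

  weight : List (Arc {n}) → Carrier
  weight = foldr (λ e w → - s e * w) 1#

  configuration : List (Arc {n}) → List (Arc {n}) → List (Arc {n}) → Carrier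
  configuration L H F = weight H * sumOrientations H (λ o → arcTerm (doubled F ++ o ++ L))

  -- H collects the edges used in one direction only and F those used in both.
  expansion : List (Arc {n}) → List (Arc {n}) → Carrier
  expansion E L = sumᴸ (λ H → sumᴸ (configuration L H) (sublists E)) (sublists E)

  private
    ↭-shift : ∀ (e : Arc {n}) D o L → D ++ e ∷ o ++ L ↭ D ++ o ++ e ∷ L
    ↭-shift e D o L = Perm.++⁺ˡ D (Perm.↭-sym (Perm.shift e o L))

    ↭-both : ∀ (e e′ : Arc {n}) D o L → e ∷ e′ ∷ D ++ o ++ L ↭ D ++ o ++ e ∷ e′ ∷ L
    ↭-both e e′ D o L = Perm.↭-trans (Perm.prep e (move e′ L)) (move e (e′ ∷ L))
      where
      move : ∀ e L → e ∷ D ++ o ++ L ↭ D ++ o ++ e ∷ L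
      move e L = Perm.↭-trans (Perm.↭-sym (Perm.shift e D (o ++ L))) (↭-shift e D o L)

  configuration-one-way : ∀ L a b H F →
    configuration L ((a , b) ∷ H) F ≈ - s (a , b) * (configuration ((a , b) ∷ L) H F + configuration ((b , a) ∷ L) H F)
  configuration-one-way L a b H F = begin
    - s (a , b) * weight H * sumOrientations H (λ o → arcTerm (doubled F ++ (a , b) ∷ o ++ L) + arcTerm (doubled F ++ (b , a) ∷ o ++ L))
      ≈⟨ *-congˡ (trans (sumOrientations-cong H (λ {o} _ → +-cong (arcTerm-↭ (↭-shift (a , b) (doubled F) o L)) (arcTerm-↭ (↭-shift (b , a) (doubled F) o L))))
                        (sumOrientations-+ H (λ o → arcTerm (doubled F ++ o ++ (a , b) ∷ L)) (λ o → arcTerm (doubled F ++ o ++ (b , a) ∷ L)))) ⟩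
    - s (a , b) * weight H * (sumOrientations H (λ o → arcTerm (doubled F ++ o ++ (a , b) ∷ L)) + sumOrientations H (λ o → arcTerm (doubled F ++ o ++ (b , a) ∷ L)))
      ≈⟨ trans (*-assoc _ _ _) (*-congˡ (distribˡ _ _ _)) ⟩
    - s (a , b) * (configuration ((a , b) ∷ L) H F + configuration ((b , a) ∷ L) H F) ∎

  configuration-both-ways : ∀ L a b H F → configuration L H ((a , b) ∷ F) ≈ configuration ((a , b) ∷ (b , a) ∷ L) H F
  configuration-both-ways L a b H F = *-congˡ (sumOrientations-cong H λ {o} _ → arcTerm-↭ (↭-both (a , b) (b , a) (doubled F) o L))

  -- `expansion` runs over all pairs of `H` and `F`, also over pairs that share an edge. Such an
  -- edge would be used by three arcs, two of which leave the same end, so these pairs contribute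
  -- nothing.
  configuration-clash : ∀ L a b H F → configuration L ((a , b) ∷ H) ((a , b) ∷ F) ≈ 0#
  configuration-clash L a b H F = trans (*-congˡ (sumOrientations-zero H λ {o} _ → trans (+-cong
      (trans (arcTerm-↭ (Perm.prep (a , b) (Perm.prep (b , a) (Perm.shift (a , b) (doubled F) (o ++ L)))))
        (arcTerm-zero ((a , b) ∷ (b , a) ∷ (a , b) ∷ doubled F ++ o ++ L) (arcSign-two-out a _ (out-a o))))
      (trans (arcTerm-↭ (Perm.prep (a , b) (Perm.prep (b , a) (Perm.shift (b , a) (doubled F) (o ++ L)))))
        (arcTerm-zero ((a , b) ∷ (b , a) ∷ (b , a) ∷ doubled F ++ o ++ L) (arcSign-two-out b _ (out-b o)))))
      (+-identityˡ 0#))) (zeroʳ _)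
    where
    out-a : ∀ o → 2 ≤ outdeg a ((a , b) ∷ (b , a) ∷ (a , b) ∷ doubled F ++ o ++ L)
    out-a o rewrite [≟]-refl a = s≤s (ℕ.≤-trans (s≤s z≤n) (ℕ.m≤n+m _ [ a ≟ b ]))
    out-b : ∀ o → 2 ≤ outdeg b ((a , b) ∷ (b , a) ∷ (b , a) ∷ doubled F ++ o ++ L)
    out-b o rewrite [≟]-refl b = ℕ.≤-trans (s≤s (s≤s z≤n)) (ℕ.m≤n+m _ [ b ≟ a ])

  module _ (s²≈1 : SquaresToOne R s) where

    -- Induction on the undecided edges `E`, with the arcs already chosen collected in `L`. Moving
    -- an edge from `E` to `L` only permutes the arcs of each term, which `arcTerm` does not notice.
    minorOf≈expansion : ∀ E L → minorOf L (baseMatrix E) ≈ expansion E L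
    minorOf≈expansion [] L = trans (minorOf-base L) (sym (trans (+-identityʳ _) (trans (+-identityʳ _) (*-identityˡ _))))
    minorOf≈expansion ((a , b) ∷ E) L = begin
      minorOf L (baseMatrix ((a , b) ∷ E))
        ≈⟨ minorOf-edge L a b E ⟩
      (minorOf L B - y * minorOf (e ∷ L) B) - y * (minorOf (e′ ∷ L) B - y * minorOf (e ∷ e′ ∷ L) B)
        ≈⟨ solve 5 (λ m y p q r → (m :- y :* p) :- y :* (q :- y :* r) := :- y :* (p :+ q) :+ ((y :* y) :* r :+ m)) refl _ _ _ _ _ ⟩
      - y * (minorOf (e ∷ L) B + minorOf (e′ ∷ L) B) + ((y * y) * minorOf (e ∷ e′ ∷ L) B + minorOf L B)
        ≈⟨ +-cong (*-congˡ (+-cong (minorOf≈expansion E (e ∷ L)) (minorOf≈expansion E (e′ ∷ L))))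
                  (+-cong (trans (*-congʳ (s²≈1 e)) (trans (*-identityˡ _) (minorOf≈expansion E (e ∷ e′ ∷ L)))) (minorOf≈expansion E L)) ⟩
      - y * (expansion E (e ∷ L) + expansion E (e′ ∷ L)) + (expansion E (e ∷ e′ ∷ L) + expansion E L)
        ≈⟨ +-cong one-way both-or-none ⟨
      sumᴸ (λ H → sumᴸ (configuration L (e ∷ H)) (sublists (e ∷ E))) Es + sumᴸ (λ H → sumᴸ (configuration L H) (sublists (e ∷ E))) Es
        ≈⟨ sumᴸ-sublists-∷ (λ H → sumᴸ (configuration L H) (sublists (e ∷ E))) e E ⟨
      expansion (e ∷ E) L ∎
      where
      y = s (a , b)
      e e′ : Arc
      e = a , b
      e′ = b , a
      B = baseMatrix E
      Es = sublists E

      one-way : sumᴸ (λ H → sumᴸ (configuration L (e ∷ H)) (sublists (e ∷ E))) Es ≈ - y * (expansion E (e ∷ L) + expansion E (e′ ∷ L))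
      one-way = begin
        sumᴸ (λ H → sumᴸ (configuration L (e ∷ H)) (sublists (e ∷ E))) Es
          ≈⟨ sumᴸ-cong Es (λ H → trans (sumᴸ-sublists-∷ (configuration L (e ∷ H)) e E)
               (trans (+-cong (sumᴸ-zero Es (configuration-clash L a b H)) (sumᴸ-cong Es (configuration-one-way L a b H))) (+-identityˡ _))) ⟩
        sumᴸ (λ H → sumᴸ (λ F → - y * (configuration (e ∷ L) H F + configuration (e′ ∷ L) H F)) Es) Es
          ≈⟨ sumᴸ-cong Es (λ H → trans (sumᴸ-scale (- y) (λ F → configuration (e ∷ L) H F + configuration (e′ ∷ L) H F) Es) (*-congˡ (sumᴸ-+ (configuration (e ∷ L) H) (configuration (e′ ∷ L) H) Es))) ⟩
        sumᴸ (λ H → - y * (sumᴸ (configuration (e ∷ L) H) Es + sumᴸ (configuration (e′ ∷ L) H) Es)) Es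
          ≈⟨ trans (sumᴸ-scale (- y) (λ H → sumᴸ (configuration (e ∷ L) H) Es + sumᴸ (configuration (e′ ∷ L) H) Es) Es)
                   (*-congˡ (sumᴸ-+ (λ H → sumᴸ (configuration (e ∷ L) H) Es) (λ H → sumᴸ (configuration (e′ ∷ L) H) Es) Es)) ⟩
        - y * (expansion E (e ∷ L) + expansion E (e′ ∷ L)) ∎

      both-or-none : sumᴸ (λ H → sumᴸ (configuration L H) (sublists (e ∷ E))) Es ≈ expansion E (e ∷ e′ ∷ L) + expansion E L
      both-or-none = trans
        (sumᴸ-cong Es λ H → trans (sumᴸ-sublists-∷ (configuration L H) e E) (+-congʳ (sumᴸ-cong Es (configuration-both-ways L a b H))))
        (sumᴸ-+ (λ H → sumᴸ (configuration (e ∷ e′ ∷ L) H) Es) (λ H → sumᴸ (configuration L H) Es) Es)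

-- Sums over sublists

all-sublists : ∀ {a p} {A : Set a} {P : A → Set p} {xs} → All P xs → All (All P) (sublists xs)
all-sublists [] = [] ∷ []
all-sublists (px ∷ pxs) = All.++⁺ (All.map⁺ (All.map (px ∷_) (all-sublists pxs))) (all-sublists pxs)

module _ {n : ℕ} where

  infix 4 _∈ᴸ_
  _∈ᴸ_ : List (Fin n) → List (List (Fin n)) → Set
  _∈ᴸ_ = Membership._∈_

  sublists-⊆ : ∀ V {S w} → S ∈ᴸ sublists V → w ∈ S → w ∈ V
  sublists-⊆ [] (here ≡.refl) ()
  sublists-⊆ (v ∷ V) S∈ w∈S with ∈-++⁻ (map (v ∷_) (sublists V)) S∈
  ... | inj₂ S∈′ = there (sublists-⊆ V S∈′ w∈S)
  ... | inj₁ vS∈ with ∈-map⁻ (v ∷_) vS∈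
  ...   | S′ , S′∈ , ≡.refl with w∈S
  ...     | here w≡v = here w≡v
  ...     | there w∈S′ = there (sublists-⊆ V S′∈ w∈S′)

  sublists-unique : ∀ {V S} → Unique V → S ∈ᴸ sublists V → Unique S
  sublists-unique {[]} [] (here ≡.refl) = []
  sublists-unique {v ∷ V} (v∉V ∷ uniq) S∈ with ∈-++⁻ (map (v ∷_) (sublists V)) S∈
  ... | inj₂ S∈′ = sublists-unique uniq S∈′
  ... | inj₁ vS∈ with ∈-map⁻ (v ∷_) vS∈
  ...   | S′ , S′∈ , ≡.refl = All.tabulate (λ w∈S′ → All.lookup v∉V (sublists-⊆ V S′∈ w∈S′)) ∷ sublists-unique uniq S′∈

  -- A sublist keeps the order of `V`, so its members determine it even as a list.
  sublists-filter : ∀ {p} {P : Fin n → Set p} (P? : Decidable P) {V S} → Unique V → S ∈ᴸ sublists V →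
    (∀ {w} → w ∈ V → (w ∈ S → P w) × (P w → w ∈ S)) → S ≡ filter P? V
  sublists-filter P? {[]} [] (here ≡.refl) _ = ≡.refl
  sublists-filter P? {v ∷ V} {S} (v∉V ∷ uniq) S∈ S⇔P with ∈-++⁻ (map (v ∷_) (sublists V)) S∈
  ... | inj₂ S∈′ = ≡.trans (sublists-filter P? uniq S∈′ (S⇔P ∘ there))
    (≡.sym (filter-reject P? λ Pv → All.lookup v∉V (sublists-⊆ V S∈′ (proj₂ (S⇔P (here ≡.refl)) Pv)) ≡.refl))
  ... | inj₁ vS∈ with ∈-map⁻ (v ∷_) vS∈
  ...   | S′ , S′∈ , ≡.refl = ≡.trans
    (≡.cong (v ∷_) (sublists-filter P? uniq S′∈ λ w∈V → proj₁ (S⇔P (there w∈V)) ∘ there , λ Pw →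
      case proj₂ (S⇔P (there w∈V)) Pw of λ where
        (here ≡.refl) → contradiction ≡.refl (All.lookup v∉V w∈V)
        (there w∈S′) → w∈S′))
    (≡.sym (filter-accept P? (proj₁ (S⇔P (here ≡.refl)) (here ≡.refl))))

module SublistSums {c ℓ} (R : CommutativeRing c ℓ) {n : ℕ} where
  open CommutativeRing R hiding (zero)
  open ListSums R

  private
    _≟ᴸ_ : (S T : List (Fin n)) → Dec (S ≡ T)
    _≟ᴸ_ = ≡-dec Fin._≟_

  sumᴸ-sublists-single : ∀ {p} {P : Fin n → Set p} (P? : Decidable P) {V} → Unique V → (f : List (Fin n) → Carrier) →
    sumᴸ (λ S → when (S ≟ᴸ filter P? V) (f S)) (sublists V) ≈ f (filter P? V)
  sumᴸ-sublists-single P? {[]} [] f = +-identityʳ _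
  sumᴸ-sublists-single {P = P} P? {v ∷ V} (v∉V ∷ uniq) f = trans (sumᴸ-sublists-∷ (λ S → when (S ≟ᴸ filter P? (v ∷ V)) (f S)) v V) (go (P? v))
    where
    Vs = sublists V
    T = filter P? V
    members : All (λ S → S ∈ᴸ Vs) Vs
    members = All.tabulate id
    go : Dec (P v) → sumᴸ (λ S → when ((v ∷ S) ≟ᴸ filter P? (v ∷ V)) (f (v ∷ S))) Vs + sumᴸ (λ S → when (S ≟ᴸ filter P? (v ∷ V)) (f S)) Vs ≈ f (filter P? (v ∷ V))
    go (yes Pv) rewrite filter-accept P? {xs = V} Pv = trans (+-cong
      (trans (sumᴸ-cong Vs λ S → when-⇔ ((v ∷ S) ≟ᴸ (v ∷ T)) (S ≟ᴸ T) ∷-injectiveʳ (≡.cong (v ∷_)) (λ _ → refl)) (sumᴸ-sublists-single P? uniq (f ∘ (v ∷_))))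
      (trans (sumᴸ-cong-∈ Vs members λ {S} S∈ → reflexive (when-no (S ≟ᴸ (v ∷ T)) λ { ≡.refl → All.lookup v∉V (sublists-⊆ V S∈ (here ≡.refl)) ≡.refl }))
        (sumᴸ-zero Vs λ _ → refl)))
      (+-identityʳ _)
    go (no ¬Pv) rewrite filter-reject P? {xs = V} ¬Pv = trans (+-cong
      (sumᴸ-zero Vs λ S → reflexive (when-no ((v ∷ S) ≟ᴸ T) λ eq →
        All.lookup v∉V (proj₁ (∈-filter⁻ P? {xs = V} (≡.subst (v ∈_) eq (here ≡.refl)))) ≡.refl))
      (sumᴸ-sublists-single P? uniq f))
      (+-identityˡ _)

  -- This collapses the sum over vertex sets once the edges leave only one candidate.
  sumᴸ-sublists-unique : ∀ {p q} {P : Fin n → Set p} (P? : Decidable P) {Q : List (Fin n) → Set q} (Q? : Decidable Q) {V} →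
    Unique V → (f : List (Fin n) → Carrier) → (∀ {S} → S ∈ᴸ sublists V → Q S → S ≡ filter P? V) → Q (filter P? V) →
    sumᴸ (λ S → when (Q? S) (f S)) (sublists V) ≈ f (filter P? V)
  sumᴸ-sublists-unique P? {Q} Q? {V} uniq f Q⇒≡ Q-filter = trans
    (sumᴸ-cong-∈ (sublists V) (All.tabulate id) λ {S} S∈ →
      when-⇔ (Q? S) (S ≟ᴸ filter P? V) (Q⇒≡ S∈) (λ { ≡.refl → Q-filter }) (λ _ → refl))
    (sumᴸ-sublists-single P? uniq f)

-- Regrouping the expansion by 2-regular subgraphs

module _ {n : ℕ} where

  -- `IsGraph` and `TwoRegular` without nonemptiness: the empty subgraph takes part in the
  -- expansion, with the matching polynomial of the whole graph as its term.
  AllDegrees2 : List (Fin n) → List (Fin n × Fin n) → Set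
  AllDegrees2 S H = IsGraph ⟨ S , H ⟩ × All (λ v → degree ⟨ S , H ⟩ v ≡ 2) S

  allDegrees2? : ∀ S H → Dec (AllDegrees2 S H)
  allDegrees2? S H = isGraph? ⟨ S , H ⟩ ×-dec all? (λ v → degree ⟨ S , H ⟩ v ℕ.≟ 2) S

  degree≡deg : ∀ {S H} (v : Fin n) → Loopless H → degree ⟨ S , H ⟩ v ≡ deg v H
  degree≡deg v [] = ≡.refl
  degree≡deg {S} {(a , b) ∷ H} v (a≢b ∷ loopless) with v Fin.≟ a | v Fin.≟ b
  ... | yes ≡.refl | yes ≡.refl = contradiction ≡.refl a≢b
  ... | yes _ | no _ = ≡.cong suc (degree≡deg {S} v loopless)
  ... | no _ | yes _ = ≡.cong suc (degree≡deg {S} v loopless)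
  ... | no _ | no _ = degree≡deg {S} v loopless

  deg-avoid : ∀ w (H : List (Fin n × Fin n)) → All (λ e → w ≢ proj₁ e × w ≢ proj₂ e) H → deg w H ≡ 0
  deg-avoid w [] [] = ≡.refl
  deg-avoid w ((a , b) ∷ H) ((w≢a , w≢b) ∷ avoid) = ≡.cong₂ ℕ._+_ (≡.cong₂ ℕ._+_ ([≟]-≢ w≢a) ([≟]-≢ w≢b)) (deg-avoid w H avoid)

  allDegrees2⇒covers : ∀ {S : List (Fin n)} {H} → Unique S → Loopless H → AllDegrees2 S H → Covers S H
  allDegrees2⇒covers {S} {H} uniq loopless (graph , degrees) = record
    { unique = uniq
    ; on = λ w∈S → ≡.trans (≡.sym (degree≡deg {S} _ loopless)) (All.lookup degrees w∈S)
    ; off = λ {w} w∉S → deg-avoid w H (All.map (λ (a∈S , b∈S) → (λ { ≡.refl → w∉S a∈S }) , (λ { ≡.refl → w∉S b∈S })) graph)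
    }

  covers⇒allDegrees2 : ∀ {S : List (Fin n)} {H} → Loopless H → Covers S H → AllDegrees2 S H
  covers⇒allDegrees2 {S} {H} loopless covers =
    All.tabulate (λ e∈H → deg≥1⇒∈ (proj₁ (∈⇒deg e∈H)) , deg≥1⇒∈ (proj₂ (∈⇒deg e∈H))) ,
    All.tabulate (λ w∈S → ≡.trans (degree≡deg {S} _ loopless) (on w∈S))
    where open Covers covers

  AvoidsVertices : List (Fin n) → List (Fin n × Fin n) → Set
  AvoidsVertices S = All λ e → proj₁ e ∉ S × proj₂ e ∉ S

  avoidsVertices? : ∀ S → Decidable (AvoidsVertices S)
  avoidsVertices? S = all? λ e → ¬? (proj₁ e ∈? S) ×-dec ¬? (proj₂ e ∈? S)

  degreesIn02? : ∀ (H : List (Fin n × Fin n)) → Dec (∀ w → deg w H ≡ 0 ⊎ deg w H ≡ 2)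
  degreesIn02? H = Fin.all? λ w → (deg w H ℕ.≟ 0) ⊎-dec (deg w H ℕ.≟ 2)

  degree2? : ∀ (H : List (Fin n × Fin n)) → Decidable (λ w → deg w H ≡ 2)
  degree2? H w = deg w H ℕ.≟ 2

  degreesIn02⇒covers : ∀ {H : List (Fin n × Fin n)} → (∀ w → deg w H ≡ 0 ⊎ deg w H ≡ 2) → Covers (filter (degree2? H) (allFin n)) H
  degreesIn02⇒covers {H} degrees = record
    { unique = Unique.filter⁺ (degree2? H) (Unique.allFin⁺ n)
    ; on = λ w∈ → proj₂ (∈-filter⁻ (degree2? H) {xs = allFin n} w∈)
    ; off = λ {w} w∉ → case degrees w of λ where
        (inj₁ deg≡0) → deg≡0
        (inj₂ deg≡2) → contradiction (∈-filter⁺ (degree2? H) (∈-allFin w) deg≡2) w∉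
    }

  covers⇒degreesIn02 : ∀ {S} {H : List (Fin n × Fin n)} → Covers S H → ∀ w → deg w H ≡ 0 ⊎ deg w H ≡ 2
  covers⇒degreesIn02 {S} covers w with w ∈? S
  ... | yes w∈S = inj₂ (Covers.on covers w∈S)
  ... | no w∉S = inj₁ (Covers.off covers w∉S)

  covers-filter : ∀ {S} {H : List (Fin n × Fin n)} → S ∈ᴸ sublists (allFin n) → Covers S H → S ≡ filter (degree2? H) (allFin n)
  covers-filter {S} {H} S∈ covers = sublists-filter (degree2? H) (Unique.allFin⁺ n) S∈ λ {w} _ → on , λ deg≡2 → deg≥1⇒∈ (≡.subst (1 ≤_) (≡.sym deg≡2) (s≤s z≤n))
    where open Covers covers

module DeterminantRegrouping {c ℓ} (R : CommutativeRing c ℓ) {n : ℕ}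
  (x : CommutativeRing.Carrier R) (s : Fin n × Fin n → CommutativeRing.Carrier R) (s²≈1 : SquaresToOne R s) where
  open CommutativeRing R hiding (zero)
  open RingProperties ring
  open SemiringDefinitions (Semiring.rawSemiring semiring) using (_^_)
  open SemiringExp semiring using (^-homo-*)
  open DeterminantTheory R
  open DeterminantKernel R using (-1^k-involutive)
  open ArcSigns R {n}
  open CycleSums R {n}
  open ListSums R
  open SublistSums R {n}
  open DeterminantExpansion R x s
  open IntegerScalars R
  open Solver using (solve; _:=_; _:*_)
  open SetoidReasoning setoid

  signProduct : List (Arc {n}) → Carrier
  signProduct = foldr (λ e w → s e * w) 1#

  weight≈ : ∀ H → weight H ≈ (- 1#) ^ length H * signProduct H
  weight≈ [] = sym (*-identityˡ 1#)
  weight≈ (e ∷ H) = trans (*-cong (sym (-1*x≈-x (s e))) (weight≈ H))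
    (solve 4 (λ m s p w → (m :* s) :* (p :* w) := (m :* p) :* (s :* w)) refl (- 1#) (s e) ((- 1#) ^ length H) (signProduct H))

  -- The contribution of a matching with j edges of a graph on m vertices.
  matchingTerm : ℕ → ℕ → Carrier
  matchingTerm m j = (- 1#) ^ j * x ^ (m ∸ 2 ℕ.* j)

  MatchingOff : List (Arc {n}) → List (Arc {n}) → Set
  MatchingOff o F = AllPairs DisjointEdges F × Avoids o F

  matchingOff? : ∀ o F → Dec (MatchingOff o F)
  matchingOff? o F = allPairs? disjointEdges? F ×-dec all? (λ e → (deg (proj₁ e) o ℕ.≟ 0) ×-dec (deg (proj₂ e) o ℕ.≟ 0)) F

  -1^[k+2j] : ∀ k j → (- 1#) ^ (k ℕ.+ 2 ℕ.* j) ≈ (- 1#) ^ k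
  -1^[k+2j] k j = trans (^-homo-* (- 1#) k (2 ℕ.* j)) (trans (*-congˡ (trans (^-homo-* (- 1#) j (j ℕ.+ 0))
    (trans (*-congˡ (trans (reflexive (≡.cong ((- 1#) ^_) (ℕ.+-identityʳ j))) (sym (*-identityʳ _)))) (-1^k-involutive j 1#)))) (*-identityʳ _))

  private
    length-doubled : ∀ F (o : List (Arc {n})) → length (doubled F ++ o) ≡ length o ℕ.+ 2 ℕ.* length F
    length-doubled [] o = ≡.sym (ℕ.+-identityʳ (length o))
    length-doubled (_ ∷ F) o = ≡.trans (≡.cong (2 ℕ.+_) (length-doubled F o))
      (≡.sym (≡.trans (≡.cong (length o ℕ.+_) (ℕ.*-suc 2 (length F))) (≡.trans (ℕ.+-suc (length o) _) (≡.cong suc (ℕ.+-suc (length o) _)))))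

    avoids-orientation : ∀ {H o F} → Orientation H o → Avoids H F → Avoids o F
    avoids-orientation p = All.map λ (a , b) → ≡.trans (deg-orientation _ p) a , ≡.trans (deg-orientation _ p) b

    orientation-avoids : ∀ {H o F} → Orientation H o → Avoids o F → Avoids H F
    orientation-avoids p = All.map λ (a , b) → ≡.trans (≡.sym (deg-orientation _ p)) a , ≡.trans (≡.sym (deg-orientation _ p)) b

  -- Of the signs, (-1)^k from the weights cancels the (-1)^(k+2j) in `arcTerm`, and the (-1)^j that
  -- remains comes from the 2-cycles of the matching.
  configuration≈ : ∀ H F → Loopless F →
    configuration [] H F ≈ when (matchingOff? H F) (signProduct H * cycleSum H * matchingTerm (n ∸ length H) (length F))
  configuration≈ H F loopless = by-cases (matchingOff? H F)
    where
    k = length H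
    j = length F
    xᵏ = x ^ (n ∸ (k ℕ.+ 2 ℕ.* j))

    drop-[] : ∀ o → arcTerm (doubled F ++ o ++ []) ≈ arcTerm (doubled F ++ o)
    drop-[] o = reflexive (≡.cong (λ o → arcTerm (doubled F ++ o)) (++-identityʳ o))

    good : ∀ {o} → MatchingOff H F → Orientation H o → arcTerm (doubled F ++ o ++ []) ≈ xᵏ * ((- 1#) ^ k * (- 1#) ^ j) * arcSign o
    good {o} (match , avoids) p = begin
      arcTerm (doubled F ++ o ++ [])                            ≈⟨ drop-[] o ⟩
      x ^ (n ∸ length (doubled F ++ o)) * ((- 1#) ^ length (doubled F ++ o) * arcSign (doubled F ++ o))
        ≈⟨ *-cong (reflexive (≡.cong (λ l → x ^ (n ∸ l)) len))
                  (*-cong (trans (reflexive (≡.cong ((- 1#) ^_) len)) (-1^[k+2j] k j)) (arcSign-doubled F o loopless match (avoids-orientation p avoids))) ⟩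
      xᵏ * ((- 1#) ^ k * ((- 1#) ^ j * arcSign o))              ≈⟨ trans (*-congˡ (sym (*-assoc _ _ _))) (sym (*-assoc _ _ _)) ⟩
      xᵏ * ((- 1#) ^ k * (- 1#) ^ j) * arcSign o                ∎
      where
      len : length (doubled F ++ o) ≡ k ℕ.+ 2 ℕ.* j
      len = ≡.trans (length-doubled F o) (≡.cong (ℕ._+ 2 ℕ.* j) (length-orientation p))

    by-cases : (d : Dec (MatchingOff H F)) → configuration [] H F ≈ when d (signProduct H * cycleSum H * matchingTerm (n ∸ k) j)
    by-cases (no bad) = trans (*-congˡ (sumOrientations-zero H λ {o} p → trans (drop-[] o)
      (arcTerm-zero (doubled F ++ o) (arcSign-doubled-zero F o loopless λ (match , avoids) → bad (match , orientation-avoids p avoids))))) (zeroʳ _)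
    by-cases (yes ok) = begin
      weight H * sumOrientations H (λ o → arcTerm (doubled F ++ o ++ []))
        ≈⟨ *-cong (weight≈ H) (trans (sumOrientations-cong H (good ok)) (sumOrientations-scale H _ arcSign)) ⟩
      ((- 1#) ^ k * signProduct H) * (xᵏ * ((- 1#) ^ k * (- 1#) ^ j) * cycleSum H)
        ≈⟨ solve 5 (λ e s x f c → (e :* s) :* ((x :* (e :* f)) :* c) := e :* (e :* ((s :* c) :* (f :* x)))) refl ((- 1#) ^ k) (signProduct H) xᵏ ((- 1#) ^ j) (cycleSum H) ⟩
      (- 1#) ^ k * ((- 1#) ^ k * (signProduct H * cycleSum H * ((- 1#) ^ j * xᵏ)))
        ≈⟨ -1^k-involutive k _ ⟩
      signProduct H * cycleSum H * ((- 1#) ^ j * xᵏ)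
        ≈⟨ *-congˡ (*-congˡ (reflexive (≡.cong (x ^_) (≡.sym (ℕ.∸-+-assoc n k (2 ℕ.* j)))))) ⟩
      signProduct H * cycleSum H * matchingTerm (n ∸ k) j ∎

  module _ {E : List (Arc {n})} (loopless : Loopless E) where

    private
      Es = sublists E
      Vs = sublists (allFin n)

      looplessSub : All Loopless Es
      looplessSub = all-sublists loopless

    matchingSum : List (Fin n) → Carrier
    matchingSum S = sumᴸ (λ F → when (allPairs? disjointEdges? F ×-dec avoidsVertices? S F) (matchingTerm (n ∸ length S) (length F))) Es

    twoRegularTerm : List (Fin n) → List (Arc {n}) → Carrier
    twoRegularTerm S H = signProduct H * -2# ^ #components ⟨ S , H ⟩ * matchingSum S

    private
      -- A vertex has degree 0 in `H` exactly if it lies outside `S`, so `F` ranges over the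
      -- matchings of the graph without `S`, and the weight of `H` is a common factor.
      configurations-covers : ∀ {S H} → Covers S H → sumᴸ (configuration [] H) Es ≈ twoRegularTerm S H
      configurations-covers {S} {H} covers = trans
        (sumᴸ-cong-∈ Es looplessSub λ {F} loopless-F → begin
          configuration [] H F
            ≈⟨ configuration≈ H F loopless-F ⟩
          when (matchingOff? H F) (signProduct H * cycleSum H * matchingTerm (n ∸ length H) (length F))
            ≈⟨ when-⇔ (matchingOff? H F) (matching? F)
                 (λ (match , avoids) → match , All.map (λ (a , b) → deg0⇒∉ a , deg0⇒∉ b) avoids)
                 (λ (match , avoids) → match , All.map (λ (a , b) → off a , off b) avoids)
                 (λ _ → *-cong (*-congˡ (cycleSum-covers covers)) (reflexive (≡.cong (λ k → matchingTerm (n ∸ k) (length F)) (≡.sym (covers-length covers))))) ⟩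
          when (matching? F) (signProduct H * -2# ^ #components ⟨ S , H ⟩ * matchingTerm (n ∸ length S) (length F))
            ≈⟨ when-* (matching? F) _ ⟨
          signProduct H * -2# ^ #components ⟨ S , H ⟩ * when (matching? F) (matchingTerm (n ∸ length S) (length F)) ∎)
        (sumᴸ-scale (signProduct H * -2# ^ #components ⟨ S , H ⟩) (λ F → when (matching? F) (matchingTerm (n ∸ length S) (length F))) Es)
        where
        open Covers covers
        matching? : ∀ F → Dec (AllPairs DisjointEdges F × AvoidsVertices S F)
        matching? F = allPairs? disjointEdges? F ×-dec avoidsVertices? S F
        deg0⇒∉ : ∀ {w} → deg w H ≡ 0 → w ∉ S
        deg0⇒∉ deg≡0 w∈S = case ≡.trans (≡.sym (on w∈S)) deg≡0 of λ ()

      -- The edges determine the vertex set, namely the vertices of degree 2. If some degree is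
      -- neither 0 nor 2, no vertex set qualifies and the orientation sum is zero as well.
      configurations≈ : ∀ {H} → Loopless H → sumᴸ (configuration [] H) Es ≈ sumᴸ (λ S → when (allDegrees2? S H) (twoRegularTerm S H)) Vs
      configurations≈ {H} loopless-H = by-cases (degreesIn02? H)
        where
        covers : ∀ {S} → S ∈ᴸ Vs → AllDegrees2 S H → Covers S H
        covers S∈ = allDegrees2⇒covers (sublists-unique (Unique.allFin⁺ n) S∈) loopless-H
        by-cases : Dec (∀ w → deg w H ≡ 0 ⊎ deg w H ≡ 2) → sumᴸ (configuration [] H) Es ≈ sumᴸ (λ S → when (allDegrees2? S H) (twoRegularTerm S H)) Vs
        by-cases (yes degrees) = trans (configurations-covers (degreesIn02⇒covers degrees))
          (sym (sumᴸ-sublists-unique (degree2? H) (λ S → allDegrees2? S H) (Unique.allFin⁺ n) (λ S → twoRegularTerm S H)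
            (λ S∈ ok → covers-filter S∈ (covers S∈ ok))
            (covers⇒allDegrees2 loopless-H (degreesIn02⇒covers degrees))))
        by-cases (no ¬degrees) with Fin.¬∀⟶∃¬ n _ (λ w → (deg w H ℕ.≟ 0) ⊎-dec (deg w H ℕ.≟ 2)) ¬degrees
        ... | w , ¬deg = trans
          (trans (sumᴸ-cong-∈ Es looplessSub λ {F} loopless-F → trans (configuration≈ H F loopless-F) (when-zero (matchingOff? H F)
            (trans (*-congʳ (trans (*-congˡ (cycleSum-degree w H (¬deg ∘ inj₁) (¬deg ∘ inj₂))) (zeroʳ _))) (zeroˡ _)))) (sumᴸ-zero Es λ _ → refl))
          (sym (trans (sumᴸ-cong-∈ Vs (All.tabulate id) λ {S} S∈ → reflexive (when-no (allDegrees2? S H) λ ok → ¬degrees (covers⇒degreesIn02 (covers S∈ ok)))) (sumᴸ-zero Vs λ _ → refl)))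
          where
          when-zero : ∀ {P : Set} (P? : Dec P) {z} → z ≈ 0# → when P? z ≈ 0#
          when-zero (yes _) z≈0 = z≈0
          when-zero (no _) _ = refl

    -- The exchange of the sums at the end puts vertex sets outside and edge lists inside, the order
    -- in which `subgraphs` enumerates them.
    det≈twoRegularSum : det (baseMatrix E) ≈ sumᴸ (λ S → sumᴸ (λ H → when (allDegrees2? S H) (twoRegularTerm S H)) Es) Vs
    det≈twoRegularSum = begin
      det (baseMatrix E)                                    ≈⟨ minorOf-single [] (baseMatrix E) (λ _ → z≤n) ⟨
      minorOf [] (baseMatrix E)                             ≈⟨ minorOf≈expansion s²≈1 E [] ⟩
      sumᴸ (λ H → sumᴸ (configuration [] H) Es) Es          ≈⟨ sumᴸ-cong-∈ Es looplessSub configurations≈ ⟩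
      sumᴸ (λ H → sumᴸ (λ S → when (allDegrees2? S H) (twoRegularTerm S H)) Vs) Es ≈⟨ sumᴸ-comm (λ H S → when (allDegrees2? S H) (twoRegularTerm S H)) Es Vs ⟩
      sumᴸ (λ S → sumᴸ (λ H → when (allDegrees2? S H) (twoRegularTerm S H)) Es) Vs ∎

-- Sums over finite lists and the matrix of a graph

module FinListSums {c ℓ} (R : CommutativeRing c ℓ) where
  open CommutativeRing R hiding (zero)
  open SemiringDefinitions (Semiring.rawSemiring semiring) using () renaming (_×_ to _·_)
  open ListSums R

  sumᴸ-single : ∀ {n} {f : Fin n → Carrier} {xs} j → Unique xs → j ∈ xs → (∀ i → i ≢ j → f i ≈ 0#) → sumᴸ f xs ≈ f j
  sumᴸ-single {xs = x ∷ xs} j (x∉ ∷ uniq) (here ≡.refl) f≈0 = trans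
    (+-congˡ (trans (sumᴸ-cong-∈ xs x∉ (λ x≢y → f≈0 _ (x≢y ∘ ≡.sym))) (sumᴸ-zero xs λ _ → refl))) (+-identityʳ _)
  sumᴸ-single {xs = x ∷ xs} j (x∉ ∷ uniq) (there j∈) f≈0 = trans
    (+-cong (f≈0 x (All.lookup x∉ j∈)) (sumᴸ-single j uniq j∈ f≈0)) (+-identityˡ _)

  sumᴸ-allFin : ∀ {n} {f : Fin n → Carrier} j → (∀ i → i ≢ j → f i ≈ 0#) → sumᴸ f (allFin n) ≈ f j
  sumᴸ-allFin {n} j = sumᴸ-single j (Unique.allFin⁺ n) (∈-allFin j)

  sumᴸ-cartesianProductWith : ∀ {a b d} {A : Set a} {B : Set b} {D : Set d} (f : D → Carrier) (g : A → B → D) xs ys →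
    sumᴸ f (cartesianProductWith g xs ys) ≈ sumᴸ (λ x → sumᴸ (λ y → f (g x y)) ys) xs
  sumᴸ-cartesianProductWith f g [] ys = refl
  sumᴸ-cartesianProductWith f g (x ∷ xs) ys = trans (sumᴸ-++ f (map (g x) ys) (cartesianProductWith g xs ys))
    (+-cong (sumᴸ-map f (g x) ys) (sumᴸ-cartesianProductWith f g xs ys))

  -- Lets the matchings of a graph without some vertices be summed over edge lists of the whole
  -- graph, the common range of all terms of the expansion.
  sumᴸ-sublists-filter : ∀ {a p} {A : Set a} {P : A → Set p} (P? : Decidable P) (f : List A → Carrier) xs →
    sumᴸ f (sublists (filter P? xs)) ≈ sumᴸ (λ F → when (all? P? F) (f F)) (sublists xs)
  sumᴸ-sublists-filter P? f [] = refl
  sumᴸ-sublists-filter P? f (x ∷ xs) with P? x in eq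
  ... | yes px = trans (sumᴸ-sublists-∷ f x (filter P? xs)) (trans
    (+-cong (trans (sumᴸ-sublists-filter P? (f ∘ (x ∷_)) xs)
        (sumᴸ-cong (sublists xs) λ F → when-⇔ (all? P? F) (all? P? (x ∷ F)) (px ∷_) (λ { (_ ∷ pF) → pF }) (λ _ → refl)))
      (sumᴸ-sublists-filter P? f xs))
    (sym (sumᴸ-sublists-∷ (λ F → when (all? P? F) (f F)) x xs)))
  ... | no ¬px = trans (sumᴸ-sublists-filter P? f xs) (trans
    (sym (trans (+-congʳ (sumᴸ-zero (sublists xs) λ F → reflexive (when-no (all? P? (x ∷ F)) λ { (px ∷ _) → ¬px px }))) (+-identityˡ _)))
    (sym (sumᴸ-sublists-∷ (λ F → when (all? P? F) (f F)) x xs)))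

  sumᴸ-applyUpTo : ∀ (g : ℕ → Carrier) (h : ℕ → ℕ) {k m} → k < m → (∀ i → i ≢ k → g (h i) ≈ 0#) → sumᴸ g (applyUpTo h m) ≈ g (h k)
  sumᴸ-applyUpTo g h {zero} {suc m} _ g≈0 = trans (+-congˡ (vanish (h ∘ suc) m (λ i → g≈0 (suc i) λ ()))) (+-identityʳ _)
    where
    vanish : ∀ h m → (∀ i → g (h i) ≈ 0#) → sumᴸ g (applyUpTo h m) ≈ 0#
    vanish h zero g≈0 = refl
    vanish h (suc m) g≈0 = trans (+-cong (g≈0 0) (vanish (h ∘ suc) m (g≈0 ∘ suc))) (+-identityˡ 0#)
  sumᴸ-applyUpTo g h {suc k} {suc m} (s≤s k<m) g≈0 = trans
    (+-cong (g≈0 0 λ ()) (sumᴸ-applyUpTo g (h ∘ suc) k<m λ i i≢k → g≈0 (suc i) (i≢k ∘ ℕ.suc-injective))) (+-identityˡ _)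

  -- Grouping by size is what turns a sum over single matchings into one with the coefficients
  -- `matchingCount`.
  sumᴸ-by-value : ∀ {a} {A : Set a} (size : A → ℕ) (t : ℕ → Carrier) m (xs : List A) → All (λ x → size x < m) xs →
    sumᴸ (t ∘ size) xs ≈ sumᴸ (λ i → (length (filter (λ x → size x ℕ.≟ i) xs) · 1#) * t i) (upTo m)
  sumᴸ-by-value size t m [] [] = sym (sumᴸ-zero (upTo m) λ i → zeroˡ (t i))
  sumᴸ-by-value size t m (x ∷ xs) (x<m ∷ xs<m) = begin
    t (size x) + sumᴸ (t ∘ size) xs
      ≈⟨ +-cong (trans (reflexive (≡.sym (when-yes (size x ℕ.≟ size x) ≡.refl)))
           (sym (sumᴸ-applyUpTo (λ i → when (size x ℕ.≟ i) (t i)) id x<m λ i i≢ → reflexive (when-no (size x ℕ.≟ i) (i≢ ∘ ≡.sym)))))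
           (sumᴸ-by-value size t m xs xs<m) ⟩
    sumᴸ (λ i → when (size x ℕ.≟ i) (t i)) (upTo m) + sumᴸ (λ i → (count i xs · 1#) * t i) (upTo m)
      ≈⟨ sumᴸ-+ (λ i → when (size x ℕ.≟ i) (t i)) (λ i → (count i xs · 1#) * t i) (upTo m) ⟨
    sumᴸ (λ i → when (size x ℕ.≟ i) (t i) + (count i xs · 1#) * t i) (upTo m)
      ≈⟨ sumᴸ-cong (upTo m) count-∷ ⟩
    sumᴸ (λ i → (count i (x ∷ xs) · 1#) * t i) (upTo m) ∎
    where
    open SetoidReasoning setoid
    count : ℕ → List _ → ℕ
    count i xs = length (filter (λ x → size x ℕ.≟ i) xs)
    count-∷ : ∀ i → when (size x ℕ.≟ i) (t i) + (count i xs · 1#) * t i ≈ (count i (x ∷ xs) · 1#) * t i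
    count-∷ i with does (size x ℕ.≟ i)
    ... | true = trans (+-congʳ (sym (*-identityˡ (t i)))) (sym (distribʳ (t i) 1# (count i xs · 1#)))
    ... | false = +-identityˡ _

edges-loopless : ∀ {n} (G : SimpleGraph n) → Loopless (edges (toVE G))
edges-loopless {n} G = All.map (λ (a<b , _) a≡b → Fin.<⇒≢ a<b a≡b)
  (All.all-filter (λ e → (proj₁ e Fin.<? proj₂ e) ×-dec (proj₁ e ~? proj₂ e)) (cartesianProduct (allFin n) (allFin n)))
  where open SimpleGraph G using (_~?_)

module GraphMatrix {c ℓ} (R : CommutativeRing c ℓ) {n : ℕ} (G : SimpleGraph n)
  (x : CommutativeRing.Carrier R) (s : Fin n × Fin n → CommutativeRing.Carrier R)
  (s-sym : ∀ {a b} → SimpleGraph._~_ G a b → CommutativeRing._≈_ R (s (a , b)) (s (b , a))) where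
  open SimpleGraph G using (_~_; _~?_; irrefl)
  open CommutativeRing R hiding (zero)
  open RingProperties ring
  open DeterminantTheory R using (δ; δ-diag; δ-≢)
  open ListSums R
  open FinListSums R
  open DeterminantExpansion R x s using (baseMatrix)
  open IntegerScalars R
  open Solver using (solve; _:=_; _:+_; :-_; _:-_)

  private
    V = allFin n

    isEdge? : ∀ a b → Dec (a Fin.< b × a ~ b)
    isEdge? a b = (a Fin.<? b) ×-dec (a ~? b)

    arcEntry : Fin n → Fin n → Fin n × Fin n → Carrier
    arcEntry i j (a , b) = s (a , b) * (δ a i * δ b j)

    baseMatrix≈ : ∀ E i j → baseMatrix E i j ≈ x * δ i j - (sumᴸ (arcEntry i j) E + sumᴸ (λ (a , b) → s (a , b) * (δ b i * δ a j)) E)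
    baseMatrix≈ [] i j = sym (trans (+-congˡ (trans (-‿cong (+-identityˡ 0#)) -0#≈0#)) (+-identityʳ _))
    baseMatrix≈ ((a , b) ∷ E) i j = trans (+-congʳ (+-congʳ (baseMatrix≈ E i j)))
      (solve 5 (λ d p q t u → (d :- (p :+ q)) :- t :- u := d :- ((t :+ p) :+ (u :+ q))) refl _ _ _ _ _)

    when-entry : ∀ {P : Set} (P? : Dec P) y {i j a b : Fin n} → ¬ (a ≡ i × b ≡ j) → when P? (y * (δ a i * δ b j)) ≈ 0#
    when-entry (no _) _ _ = refl
    when-entry (yes _) y {i} {j} {a} {b} ≢ with a Fin.≟ i
    ... | no a≢i = trans (*-congˡ (zeroˡ _)) (zeroʳ y)
    ... | yes ≡.refl = trans (*-congˡ (trans (*-congˡ (reflexive (δ-≢ (λ b≡j → ≢ (≡.refl , b≡j))))) (zeroʳ _))) (zeroʳ y)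

    double-single : ∀ {f : Fin n → Fin n → Carrier} i j → (∀ {a b} → ¬ (a ≡ i × b ≡ j) → f a b ≈ 0#) →
      sumᴸ (λ a → sumᴸ (f a) V) V ≈ f i j
    double-single {f} i j f≈0 = trans
      (sumᴸ-allFin i λ a a≢i → sumᴸ-zero V λ b → f≈0 (a≢i ∘ proj₁))
      (sumᴸ-allFin {f = f i} j λ b b≢j → f≈0 (b≢j ∘ proj₂))

    sum-edges : ∀ (f : Fin n × Fin n → Carrier) → sumᴸ f (edges (toVE G)) ≈ sumᴸ (λ a → sumᴸ (λ b → when (isEdge? a b) (f (a , b))) V) V
    sum-edges f = trans (sumᴸ-filter (λ (a , b) → isEdge? a b) f (cartesianProduct V V))
      (sumᴸ-cartesianProductWith (λ (a , b) → when (isEdge? a b) (f (a , b))) _,_ V V)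

    diagonal : ∀ y (i j : Fin n) → y * (δ i i * δ j j) ≈ y
    diagonal y i j = trans (*-congˡ (trans (*-cong (reflexive (δ-diag i)) (reflexive (δ-diag j))) (*-identityˡ 1#))) (*-identityʳ y)

    when-cong : ∀ {P : Set} (P? : Dec P) {y z} → y ≈ z → when P? y ≈ when P? z
    when-cong (yes _) y≈z = y≈z
    when-cong (no _) y≈z = refl

    forward : ∀ i j → sumᴸ (arcEntry i j) (edges (toVE G)) ≈ when (isEdge? i j) (s (i , j))
    forward i j = trans (sum-edges (arcEntry i j)) (trans
      (double-single {λ a b → when (isEdge? a b) (arcEntry i j (a , b))} i j λ {a} {b} → when-entry (isEdge? a b) (s (a , b)))
      (when-cong (isEdge? i j) (diagonal (s (i , j)) i j)))

    backward : ∀ i j → sumᴸ (λ (a , b) → s (a , b) * (δ b i * δ a j)) (edges (toVE G)) ≈ when (isEdge? j i) (s (j , i))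
    backward i j = trans (sum-edges λ (a , b) → s (a , b) * (δ b i * δ a j)) (trans
      (double-single {λ a b → when (isEdge? a b) (s (a , b) * (δ b i * δ a j))} j i λ {a} {b} ≢ →
        when-entry (isEdge? a b) (s (a , b)) λ (b≡i , a≡j) → ≢ (a≡j , b≡i))
      (when-cong (isEdge? j i) (diagonal (s (j , i)) i j)))

  -- An edge is recorded once, in increasing order. Above the diagonal its forward arc supplies the
  -- entry, below it the backward arc, whose weight `s-sym` turns around; on the diagonal `irrefl`
  -- excludes an edge.
  baseMatrix-graph : ∀ i j → baseMatrix (edges (toVE G)) i j ≈ x * δ i j - when (i ~? j) (s (i , j))
  baseMatrix-graph i j = trans (baseMatrix≈ (edges (toVE G)) i j) (+-congˡ (-‿cong (trans (+-cong (forward i j) (backward i j)) (by-cases (i ~? j) (Fin.<-cmp i j)))))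
    where
    by-cases : (d : Dec (i ~ j)) → _ → when (isEdge? i j) (s (i , j)) + when (isEdge? j i) (s (j , i)) ≈ when d (s (i , j))
    by-cases (no i≁j) _ = trans (+-cong (reflexive (when-no (isEdge? i j) (i≁j ∘ proj₂))) (reflexive (when-no (isEdge? j i) (i≁j ∘ SimpleGraph.sym G ∘ proj₂)))) (+-identityˡ 0#)
    by-cases (yes i~j) (tri< i<j _ j≮i) = trans (+-cong (reflexive (when-yes (isEdge? i j) (i<j , i~j))) (reflexive (when-no (isEdge? j i) (j≮i ∘ proj₁)))) (+-identityʳ _)
    by-cases (yes i~j) (tri> i≮j _ j<i) = trans (+-cong (reflexive (when-no (isEdge? i j) (i≮j ∘ proj₁))) (reflexive (when-yes (isEdge? j i) (j<i , SimpleGraph.sym G i~j)))) (trans (+-identityˡ _) (sym (s-sym i~j)))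
    by-cases (yes i~j) (tri≈ _ i≡j _) = contradiction i~j (irrefl i≡j)

-- Parity under the change of sign of `x`

module _ {n : ℕ} where

  ends : List (Fin n × Fin n) → List (Fin n)
  ends []            = []
  ends ((a , b) ∷ F) = a ∷ b ∷ ends F

  length-ends : ∀ F → length (ends F) ≡ 2 ℕ.* length F
  length-ends [] = ≡.refl
  length-ends (_ ∷ F) = ≡.trans (≡.cong (2 ℕ.+_) (length-ends F)) (≡.sym (ℕ.*-suc 2 (length F)))

  all-ends : ∀ {ℓ} {P : Fin n → Set ℓ} {F} → All (λ e → P (proj₁ e) × P (proj₂ e)) F → All P (ends F)
  all-ends [] = []
  all-ends ((pa , pb) ∷ rest) = pa ∷ pb ∷ all-ends rest

  unique-ends : ∀ {F S} → Loopless F → AllPairs DisjointEdges F → AvoidsVertices S F → Unique S → Unique (ends F ++ S)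
  unique-ends [] [] [] uniq = uniq
  unique-ends {S = S} (a≢b ∷ loopless) (disj ∷ match) ((a∉S , b∉S) ∷ avoids) uniq =
    (a≢b ∷ All.++⁺ (all-ends (All.map proj₁ disj)) (All.tabulate λ { w∈S ≡.refl → a∉S w∈S }))
    ∷ All.++⁺ (all-ends (All.map proj₂ disj)) (All.tabulate λ { w∈S ≡.refl → b∉S w∈S })
    ∷ unique-ends loopless match avoids uniq

  length-unique : ∀ {xs : List (Fin n)} → Unique xs → length xs ≤ n
  length-unique {xs} uniq = ≡.subst (length xs ≤_) (length-tabulate id) (Unique⇒length-≤ uniq (λ {w} _ → ∈-allFin w))

  -- The ends of the matching together with `S` are distinct vertices among `n`. This makes the
  -- exponent in `matchingTerm` a true difference, whose parity can be read off.
  matching-fits : ∀ {F S} → Loopless F → AllPairs DisjointEdges F → AvoidsVertices S F → Unique S → 2 ℕ.* length F ≤ n ∸ length S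
  matching-fits {F} {S} loopless match avoids uniq = ℕ.m+n≤o⇒m≤o∸n (2 ℕ.* length F)
    (≡.subst (_≤ n) (≡.trans (length-++ (ends F)) (≡.cong (ℕ._+ length S) (length-ends F))) (length-unique (unique-ends loopless match avoids uniq)))

even-or-odd : ∀ k → 2 ∣ℕ k ⊎ 2 ∣ℕ suc k
even-or-odd zero = inj₁ (divides 0 ≡.refl)
even-or-odd (suc k) with even-or-odd k
... | inj₁ (divides q eq) = inj₂ (divides (suc q) (≡.cong (2 ℕ.+_) eq))
... | inj₂ even = inj₁ even

module OddEvenParts {c ℓ} (R : CommutativeRing c ℓ) {n : ℕ}
  (x : CommutativeRing.Carrier R) (s : Fin n × Fin n → CommutativeRing.Carrier R) (s²≈1 : SquaresToOne R s)
  {E : List (Fin n × Fin n)} (loopless : Loopless E)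
  {r : CommutativeRing.Carrier R → CommutativeRing.Carrier R}
  (r-homo : IsRingHomomorphism (CommutativeRing.rawRing R) (CommutativeRing.rawRing R) r)
  (rx : CommutativeRing._≈_ R (r x) (CommutativeRing.-_ R x)) (rs : ∀ e → CommutativeRing._≈_ R (r (s e)) (s e)) where
  open CommutativeRing R hiding (zero)
  open RingProperties ring
  open SemiringDefinitions (Semiring.rawSemiring semiring) using (_^_)
  open SemiringExp semiring using (^-homo-*; ^-congˡ)
  open DeterminantTheory R using (det)
  open DeterminantKernel R using (-1^k-involutive)
  open CycleSums R {n} using (-2#)
  open ListSums R
  open DeterminantExpansion R x s using (baseMatrix)
  open DeterminantRegrouping R x s s²≈1
  open IntegerScalars R using (module Solver)
  open Solver using (solve; _:=_; _:+_; _:*_; :-_; _:-_)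
  open SetoidReasoning setoid
  private
    module r = IsRingHomomorphism r-homo
    Es = sublists E
    Vs = sublists (allFin n)

  -- The ring endomorphism `r` negates `x` and fixes the weights, so it multiplies `evenPart` by
  -- (-1)^n and `oddPart` by the opposite sign. The empty subgraph belongs to `evenPart`.
  oddPart evenPart : Carrier
  oddPart  = sumᴸ (λ S → sumᴸ (λ H → when (¬? (2 ∣? length S)) (when (allDegrees2? S H) (twoRegularTerm loopless S H))) Es) Vs
  evenPart = sumᴸ (λ S → sumᴸ (λ H → when (2 ∣? length S) (when (allDegrees2? S H) (twoRegularTerm loopless S H))) Es) Vs

  det≈odd+even : det (baseMatrix E) ≈ oddPart + evenPart
  det≈odd+even = trans (det≈twoRegularSum loopless) (trans
    (sumᴸ-cong Vs λ S → trans (sumᴸ-cong Es λ H → split (2 ∣? length S) _) (sumᴸ-+ _ _ Es))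
    (sumᴸ-+ _ _ Vs))
    where
    split : ∀ {P : Set} (P? : Dec P) y → y ≈ when (¬? P?) y + when P? y
    split (yes _) y = sym (+-identityˡ y)
    split (no _) y = sym (+-identityʳ y)

  private
    r-fixes-^ : ∀ k {y} → r y ≈ y → r (y ^ k) ≈ y ^ k
    r-fixes-^ k ry≈y = trans (^-homo R R r-homo _ k) (^-congˡ k ry≈y)

    r-1 : r (- 1#) ≈ - 1#
    r-1 = trans (r.-‿homo 1#) (-‿cong r.1#-homo)

    r-2 : r -2# ≈ -2#
    r-2 = trans (r.-‿homo _) (-‿cong (trans (r.+-homo 1# 1#) (+-cong r.1#-homo r.1#-homo)))

    r-signProduct : ∀ H → r (signProduct H) ≈ signProduct H
    r-signProduct [] = r.1#-homo
    r-signProduct (e ∷ H) = trans (r.*-homo _ _) (*-cong (rs e) (r-signProduct H))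

    neg^ : ∀ k y → (- y) ^ k ≈ (- 1#) ^ k * y ^ k
    neg^ zero y = sym (*-identityˡ 1#)
    neg^ (suc k) y = trans (*-cong (sym (-1*x≈-x y)) (neg^ k y))
      (solve 4 (λ m y p q → (m :* y) :* (p :* q) := (m :* p) :* (y :* q)) refl (- 1#) y ((- 1#) ^ k) (y ^ k))

    r-when : ∀ {P : Set} (P? : Dec P) {y a} → (P → r y ≈ a * y) → r (when P? y) ≈ a * when P? y
    r-when (yes p) ry≈ = ry≈ p
    r-when (no _) _ = trans r.0#-homo (sym (zeroʳ _))

    r-sumᴸ : ∀ {a b} {A : Set a} {P : A → Set b} {f : A → Carrier} {y} xs → All P xs → (∀ {x} → P x → r (f x) ≈ y * f x) →
      r (sumᴸ f xs) ≈ y * sumᴸ f xs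
    r-sumᴸ [] [] _ = trans r.0#-homo (sym (zeroʳ _))
    r-sumᴸ (x ∷ xs) (px ∷ pxs) rf≈ = trans (r.+-homo _ _) (trans (+-cong (rf≈ px) (r-sumᴸ xs pxs rf≈)) (sym (distribˡ _ _ _)))

    -- Every edge of a matching lowers the exponent of `x` by 2, so the sign depends on `m` alone,
    -- provided that the subtraction is not truncated.
    r-matchingTerm : ∀ m j → 2 ℕ.* j ≤ m → r (matchingTerm m j) ≈ (- 1#) ^ m * matchingTerm m j
    r-matchingTerm m j 2j≤m = begin
      r ((- 1#) ^ j * x ^ k)                         ≈⟨ r.*-homo _ _ ⟩
      r ((- 1#) ^ j) * r (x ^ k)                     ≈⟨ *-cong (r-fixes-^ j r-1) (trans (^-homo R R r-homo x k) (trans (^-congˡ k rx) (neg^ k x))) ⟩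
      (- 1#) ^ j * ((- 1#) ^ k * x ^ k)              ≈⟨ x∙yz≈y∙xz _ _ _ ⟩
      (- 1#) ^ k * ((- 1#) ^ j * x ^ k)              ≈⟨ *-congʳ (-1^[k+2j] k j) ⟨
      (- 1#) ^ (k ℕ.+ 2 ℕ.* j) * ((- 1#) ^ j * x ^ k) ≈⟨ *-congʳ (reflexive (≡.cong ((- 1#) ^_) (ℕ.m∸n+n≡m 2j≤m))) ⟩
      (- 1#) ^ m * matchingTerm m j                  ∎
      where
      k = m ∸ 2 ℕ.* j
      open CommutativeSemigroupProperties *-commutativeSemigroup using (x∙yz≈y∙xz)

    r-matchingSum : ∀ {S} → Unique S → r (matchingSum loopless S) ≈ (- 1#) ^ (n ∸ length S) * matchingSum loopless S
    r-matchingSum {S} uniq = r-sumᴸ Es (all-sublists loopless) λ {F} loopless-F →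
      r-when (allPairs? disjointEdges? F ×-dec avoidsVertices? S F) λ (match , avoids) →
        r-matchingTerm (n ∸ length S) (length F) (matching-fits loopless-F match avoids uniq)

    r-twoRegularTerm : ∀ {S} H → Unique S → r (twoRegularTerm loopless S H) ≈ (- 1#) ^ (n ∸ length S) * twoRegularTerm loopless S H
    r-twoRegularTerm {S} H uniq = begin
      r (signProduct H * -2# ^ p * matchingSum loopless S)      ≈⟨ trans (r.*-homo _ _) (*-congʳ (r.*-homo _ _)) ⟩
      r (signProduct H) * r (-2# ^ p) * r (matchingSum loopless S) ≈⟨ *-cong (*-cong (r-signProduct H) (r-fixes-^ p r-2)) (r-matchingSum uniq) ⟩
      signProduct H * -2# ^ p * ((- 1#) ^ (n ∸ length S) * matchingSum loopless S) ≈⟨ x∙yz≈y∙xz _ _ _ ⟩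
      (- 1#) ^ (n ∸ length S) * twoRegularTerm loopless S H     ∎
      where
      p = #components ⟨ S , H ⟩
      open CommutativeSemigroupProperties *-commutativeSemigroup using (x∙yz≈y∙xz)

    -1^even : ∀ {k} → 2 ∣ℕ k → (- 1#) ^ k ≈ 1#
    -1^even (divides q ≡.refl) = trans (reflexive (≡.cong ((- 1#) ^_) (ℕ.*-comm q 2))) (-1^[k+2j] 0 q)

    -1^odd : ∀ {k} → ¬ 2 ∣ℕ k → (- 1#) ^ k ≈ - 1#
    -1^odd {k} odd with even-or-odd k
    ... | inj₁ even = contradiction even odd
    ... | inj₂ even = begin
      (- 1#) ^ k                     ≈⟨ -1^k-involutive 1 _ ⟨
      (- 1#) ^ 1 * ((- 1#) ^ 1 * (- 1#) ^ k) ≈⟨ *-cong (*-identityʳ _) (*-congʳ (*-identityʳ _)) ⟩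
      - 1# * (- 1#) ^ suc k          ≈⟨ trans (*-congˡ (-1^even even)) (*-identityʳ _) ⟩
      - 1#                           ∎

    -1^∸ : ∀ {l} → l ≤ n → (- 1#) ^ (n ∸ l) ≈ (- 1#) ^ l * (- 1#) ^ n
    -1^∸ {l} l≤n = sym (trans (*-congˡ (trans (reflexive (≡.cong ((- 1#) ^_) (≡.sym (ℕ.m+[n∸m]≡n l≤n)))) (^-homo-* (- 1#) l (n ∸ l)))) (-1^k-involutive l _))

    uniqueSub : All Unique Vs
    uniqueSub = All.tabulate (sublists-unique (Unique.allFin⁺ n))

    r-part : ∀ {a} {P : ℕ → Set} (P? : ∀ l → Dec (P l)) → (∀ {l} → P l → (- 1#) ^ l ≈ a) →
      let part = sumᴸ (λ S → sumᴸ (λ H → when (P? (length S)) (when (allDegrees2? S H) (twoRegularTerm loopless S H))) Es) Vs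
      in r part ≈ (a * (- 1#) ^ n) * part
    r-part {a} P? parity = r-sumᴸ Vs uniqueSub λ {S} uniq → r-sumᴸ Es (All.universal (λ _ → tt) Es) λ {H} _ →
      r-when (P? (length S)) λ p → r-when (allDegrees2? S H) λ _ →
        trans (r-twoRegularTerm H uniq) (*-congʳ (trans (-1^∸ (length-unique uniq)) (*-congʳ (parity p))))

    r-odd : r oddPart ≈ - 1# * (- 1#) ^ n * oddPart
    r-odd = r-part (λ l → ¬? (2 ∣? l)) -1^odd

    r-even : r evenPart ≈ 1# * (- 1#) ^ n * evenPart
    r-even = r-part (2 ∣?_) -1^even

    r-det : r (det (baseMatrix E)) ≈ (- 1#) ^ n * evenPart - (- 1#) ^ n * oddPart
    r-det = trans (r.⟦⟧-cong det≈odd+even) (trans (r.+-homo _ _) (trans (+-comm _ _) (+-cong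
      (trans r-even (*-congʳ (*-identityˡ _)))
      (trans r-odd (trans (*-assoc _ _ _) (-1*x≈-x _))))))

  oddPart≈0⇒symmetric : oddPart ≈ 0# → r (det (baseMatrix E)) ≈ (- 1#) ^ n * det (baseMatrix E)
  oddPart≈0⇒symmetric odd≈0 = trans r-det (trans
    (trans (+-congˡ (trans (-‿cong (trans (*-congˡ odd≈0) (zeroʳ _))) -0#≈0#)) (+-identityʳ _))
    (*-congˡ (sym (trans det≈odd+even (trans (+-congʳ odd≈0) (+-identityˡ _))))))

  -- Up to the sign (-1)^n, the determinant is odd plus even and its image under `r` is even minus
  -- odd. In a general ring 2 cannot be cancelled from their difference.
  symmetric⇒oddPart+oddPart≈0 : r (det (baseMatrix E)) ≈ (- 1#) ^ n * det (baseMatrix E) → oddPart + oddPart ≈ 0#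
  symmetric⇒oddPart+oddPart≈0 eq = begin
    oddPart + oddPart                                                  ≈⟨ -1^k-involutive n _ ⟨
    t * (t * (oddPart + oddPart))                                      ≈⟨ *-congˡ (solve 3 (λ t o e → t :* (o :+ o) := t :* (o :+ e) :- (t :* e :- t :* o)) refl t oddPart evenPart) ⟩
    t * (t * (oddPart + evenPart) - (t * evenPart - t * oddPart))      ≈⟨ *-congˡ (+-cong (trans (*-congˡ (sym det≈odd+even)) (sym eq)) (-‿cong (sym r-det))) ⟩
    t * (r (det (baseMatrix E)) - r (det (baseMatrix E)))              ≈⟨ trans (*-congˡ (-‿inverseʳ _)) (zeroʳ t) ⟩
    0#                                                                 ∎
    where t = (- 1#) ^ n

-- Signed graphs

module _ {n : ℕ} where

  length-filter-∉ : ∀ {S : List (Fin n)} → Unique S → length (filter (λ v → ¬? (v ∈? S)) (allFin n)) ≡ n ∸ length S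
  length-filter-∉ {S} uniq = ≡.trans (≡.sym (ℕ.m+n∸n≡m (length T) (length S)))
    (≡.cong (_∸ length S) (≡.trans (≡.sym (length-++ T)) (≡.trans
      (Unique⇒length-≡ unique-++ (Unique.allFin⁺ n) (λ {w} _ → ∈-allFin w) (λ {w} _ → covered w)) (length-tabulate id))))
    where
    ∉S? : Decidable (λ v → ¬ (v ∈ S))
    ∉S? v = ¬? (v ∈? S)
    T = filter ∉S? (allFin n)
    unique-++ : Unique (T ++ S)
    unique-++ = Unique.++⁺ (Unique.filter⁺ ∉S? (Unique.allFin⁺ n)) uniq λ (w∈T , w∈S) → proj₂ (∈-filter⁻ ∉S? {xs = allFin n} w∈T) w∈S
    covered : ∀ w → w ∈ T ++ S
    covered w with w ∈? S
    ... | yes w∈S = ∈-++⁺ʳ T w∈S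
    ... | no w∉S = ∈-++⁺ˡ (∈-filter⁺ ∉S? (∈-allFin w) w∉S)

  matchingNumber-bound : ∀ (K : VEGraph n) → All (λ F → length F < suc (matchingNumber K)) (matchings K)
  matchingNumber-bound K = go (matchings K)
    where
    go : ∀ Fs → All (λ F → length F < suc (foldr (λ F m → length F ℕ.⊔ m) 0 Fs)) Fs
    go [] = []
    go (F ∷ Fs) = s≤s (ℕ.m≤m⊔n (length F) _) ∷ All.map (λ F<m → ℕ.<-≤-trans F<m (s≤s (ℕ.m≤n⊔m (length F) _))) (go Fs)

-- The characteristic polynomial of a signed graph over the integers

ℤ-ring : CommutativeRing _ _
ℤ-ring = ℤ.+-*-commutativeRing

module Characteristic where
  open PolynomialRing ℤ-ring
  open CharacteristicPolynomial ℤ-ring using (charPoly; coeff-sign*; charMatrix; Alternates)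
  open DeterminantKernel ℤ-ring using (-1^k-involutive)
  open SemiringDefinitions (Semiring.rawSemiring (CommutativeRing.semiring ℤ-ring)) using () renaming (_^_ to _^ᶻ_)
  open LinearFactors ℤ-ring using (_^ₚ_)
  P : CommutativeRing _ _
  P = polyRing
  module P = CommutativeRing P
  open SemiringDefinitions (Semiring.rawSemiring P.semiring) using () renaming (_^_ to _^ᵖ_; _×_ to _·ᵖ_)
  open ListSums P
  open FinListSums P
  open SetoidReasoning P.setoid

  const-* : ∀ a b → const (a ℤ.* b) ≈ₚ const a *ₚ const b
  const-* a b zero = ≡.sym (coeff-const* a (const b) 0)
  const-* a b (suc k) = ≡.sym (≡.trans (coeff-const* a (const b) (suc k)) (ℤ.*-zeroʳ a))

  const--1^ : ∀ i → const (-1ℤ ℤ.^ i) ≈ₚ (P.- P.1#) ^ᵖ i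
  const--1^ zero = P.refl {const 1ℤ}
  const--1^ (suc i) = begin
    const (-1ℤ ℤ.* -1ℤ ℤ.^ i)             ≈⟨ const-* -1ℤ (-1ℤ ℤ.^ i) ⟩
    const -1ℤ *ₚ const (-1ℤ ℤ.^ i)        ≈⟨ P.*-congˡ {const -1ℤ} {const (-1ℤ ℤ.^ i)} {(P.- P.1#) ^ᵖ i} (const--1^ i) ⟩
    const -1ℤ *ₚ (P.- P.1#) ^ᵖ i          ∎

  const--2^ : ∀ i → const ((ℤ.- (+ 2)) ℤ.^ i) ≈ₚ const (ℤ.- (+ 2)) ^ᵖ i
  const--2^ zero = P.refl {const 1ℤ}
  const--2^ (suc i) = P.trans {const ((ℤ.- (+ 2)) ℤ.^ suc i)} {const (ℤ.- (+ 2)) *ₚ const ((ℤ.- (+ 2)) ℤ.^ i)} {const (ℤ.- (+ 2)) ^ᵖ suc i}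
    (const-* (ℤ.- (+ 2)) ((ℤ.- (+ 2)) ℤ.^ i))
    (P.*-congˡ {const (ℤ.- (+ 2))} {const ((ℤ.- (+ 2)) ℤ.^ i)} {const (ℤ.- (+ 2)) ^ᵖ i} (const--2^ i))

  const-+ : ∀ c → const (+ c) ≈ₚ c ·ᵖ P.1#
  const-+ zero zero = ≡.refl
  const-+ zero (suc k) = ≡.refl
  const-+ (suc c) k = ≡.trans (≡.trans (split k) (≡.sym (coeff-+ P.1# (const (+ c)) k)))
    (P.+-congˡ {P.1#} {const (+ c)} {c ·ᵖ P.1#} (const-+ c) k)
    where
    split : ∀ k → coeff (const (+ suc c)) k ≡ coeff P.1# k ℤ.+ coeff (const (+ c)) k
    split zero = ≡.refl
    split (suc k) = ≡.refl

  module _ {n : ℕ} (Γ : SignedGraph n) where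
    open SignedGraph Γ

    private
      E = edges (toVE graph)
      Es = sublists E
      Vs = sublists (allFin n)
      loopless = edges-loopless graph

    weightσ : Fin n × Fin n → Poly
    weightσ (a , b) = const (σ a b ◃ 1)

    weightσ² : ∀ e → weightσ e *ₚ weightσ e ≈ₚ P.1#
    weightσ² (a , b) with σ a b
    ... | Sign.+ = λ { zero → ≡.refl ; (suc k) → ≡.refl }
    ... | Sign.- = λ { zero → ≡.refl ; (suc k) → ≡.refl }

    open DeterminantExpansion P X weightσ using (baseMatrix)
    open DeterminantRegrouping P X weightσ weightσ²

    charPoly≈ : P._≈_ (DeterminantTheory.det P (baseMatrix E)) (charPoly (adjacencyMatrix Γ))
    charPoly≈ = DeterminantTheory.det-cong P {M = baseMatrix E} {N = charMatrix (adjacencyMatrix Γ)} λ i j →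
      P.trans {baseMatrix E i j} {X *ₚ δ i j +ₚ P.- when (i ~? j) (weightσ (i , j))} {charMatrix (adjacencyMatrix Γ) i j}
        (baseMatrix-graph i j) (entry i j)
      where
      open DeterminantTheory P using (δ)
      weightσ-sym : ∀ {a b} → a ~ b → weightσ (a , b) ≈ₚ weightσ (b , a)
      weightσ-sym a~b = P.reflexive (≡.cong (λ s → const (s ◃ 1)) (σ-sym a~b))
      open GraphMatrix P graph X weightσ weightσ-sym
      entry : ∀ i j → X *ₚ δ i j +ₚ P.- when (i ~? j) (weightσ (i , j)) ≈ₚ charMatrix (adjacencyMatrix Γ) i j
      -- Once the diagonal, the adjacency and the sign are known, both sides are lists of known
      -- length, possibly with different trailing zeros, and agree coefficient by coefficient.
      entry i j with does (i Fin.≟ j) | does (i ~? j) | σ i j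
      ... | true | true | Sign.+ = λ { zero → ≡.refl ; (suc zero) → ≡.refl ; (suc (suc k)) → ≡.refl }
      ... | true | true | Sign.- = λ { zero → ≡.refl ; (suc zero) → ≡.refl ; (suc (suc k)) → ≡.refl }
      ... | true | false | _ = λ { zero → ≡.refl ; (suc zero) → ≡.refl ; (suc (suc k)) → ≡.refl }
      ... | false | true | Sign.+ = λ { zero → ≡.refl ; (suc zero) → ≡.refl ; (suc (suc k)) → ≡.refl }
      ... | false | true | Sign.- = λ { zero → ≡.refl ; (suc zero) → ≡.refl ; (suc (suc k)) → ≡.refl }
      ... | false | false | _ = λ { zero → ≡.refl ; (suc zero) → ≡.refl ; (suc (suc k)) → ≡.refl }

    -- `matchingPoly` groups the matchings by size, while `matchingSum` has one term for each;
    -- besides, the edges of the smaller graph become the edges of `graph` that avoid `S`.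
    matchingPoly≈ : ∀ {S} → Unique S → matchingPoly (toVE graph ─ S) ≈ₚ matchingSum loopless S
    matchingPoly≈ {S} uniq = begin
      sumᴸ (λ i → const (-1ℤ ℤ.^ i ℤ.* + matchingCount K i) *ₚ X ^ₚ (order K ∸ 2 ℕ.* i)) (upTo (suc (matchingNumber K)))
        ≈⟨ sumᴸ-cong {f = λ i → const (-1ℤ ℤ.^ i ℤ.* + matchingCount K i) *ₚ X ^ₚ (order K ∸ 2 ℕ.* i)} {g = λ i → (matchingCount K i ·ᵖ P.1#) *ₚ matchingTerm (n ∸ length S) i}
             (upTo (suc (matchingNumber K))) (λ i → coefficient i (matchingCount K i)) ⟩
      sumᴸ (λ i → (matchingCount K i ·ᵖ P.1#) *ₚ matchingTerm (n ∸ length S) i) (upTo (suc (matchingNumber K)))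
        ≈⟨ sumᴸ-by-value length (matchingTerm (n ∸ length S)) (suc (matchingNumber K)) (matchings K) (matchingNumber-bound K) ⟨
      sumᴸ (λ F → matchingTerm (n ∸ length S) (length F)) (matchings K)
        ≈⟨ sumᴸ-filter (allPairs? disjointEdges?) (λ F → matchingTerm (n ∸ length S) (length F)) (sublists (edges K)) ⟩
      sumᴸ (λ F → when (allPairs? disjointEdges? F) (matchingTerm (n ∸ length S) (length F))) (sublists (edges K))
        ≈⟨ sumᴸ-sublists-filter (λ e → ¬? (proj₁ e ∈? S) ×-dec ¬? (proj₂ e ∈? S)) (λ F → when (allPairs? disjointEdges? F) (matchingTerm (n ∸ length S) (length F))) E ⟩
      sumᴸ (λ F → when (avoidsVertices? S F) (when (allPairs? disjointEdges? F) (matchingTerm (n ∸ length S) (length F)))) Es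
        ≈⟨ sumᴸ-cong {f = λ F → when (avoidsVertices? S F) (when (allPairs? disjointEdges? F) (matchingTerm (n ∸ length S) (length F)))}
             {g = λ F → when (allPairs? disjointEdges? F ×-dec avoidsVertices? S F) (matchingTerm (n ∸ length S) (length F))}
             Es (λ F → when-when (avoidsVertices? S F) (allPairs? disjointEdges? F) (matchingTerm (n ∸ length S) (length F))) ⟩
      matchingSum loopless S ∎
      where
      K : VEGraph n
      K = toVE graph ─ S

      when-when : ∀ {A B : Set} (A? : Dec A) (B? : Dec B) y → when A? (when B? y) ≈ₚ when (B? ×-dec A?) y
      when-when (yes _) (yes _) y = P.refl {y}
      when-when (yes _) (no _) y = P.refl {[]}
      when-when (no _) (yes _) y = P.refl {[]}
      when-when (no _) (no _) y = P.refl {[]}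

      coefficient : ∀ i c → const (-1ℤ ℤ.^ i ℤ.* + c) *ₚ X ^ₚ (order K ∸ 2 ℕ.* i) ≈ₚ (c ·ᵖ P.1#) *ₚ matchingTerm (n ∸ length S) i
      coefficient i c = begin
        const (-1ℤ ℤ.^ i ℤ.* + c) *ₚ X ^ₚ (order K ∸ 2 ℕ.* i)
          ≡⟨ ≡.cong₂ (λ a m → const a *ₚ X ^ₚ (m ∸ 2 ℕ.* i)) (ℤ.*-comm (-1ℤ ℤ.^ i) (+ c)) (length-filter-∉ uniq) ⟩
        const (+ c ℤ.* -1ℤ ℤ.^ i) *ₚ Xᵐ
          ≈⟨ P.*-congʳ {Xᵐ} {const (+ c ℤ.* -1ℤ ℤ.^ i)} {const (+ c) *ₚ const (-1ℤ ℤ.^ i)} (const-* (+ c) (-1ℤ ℤ.^ i)) ⟩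
        const (+ c) *ₚ const (-1ℤ ℤ.^ i) *ₚ Xᵐ
          ≈⟨ P.*-congʳ {Xᵐ} {const (+ c) *ₚ const (-1ℤ ℤ.^ i)} {(c ·ᵖ P.1#) *ₚ (P.- P.1#) ^ᵖ i}
               (P.*-cong {const (+ c)} {c ·ᵖ P.1#} {const (-1ℤ ℤ.^ i)} {(P.- P.1#) ^ᵖ i} (const-+ c) (const--1^ i)) ⟩
        (c ·ᵖ P.1#) *ₚ (P.- P.1#) ^ᵖ i *ₚ Xᵐ
          ≈⟨ P.*-assoc (c ·ᵖ P.1#) ((P.- P.1#) ^ᵖ i) Xᵐ ⟩
        (c ·ᵖ P.1#) *ₚ matchingTerm (n ∸ length S) i ∎
        where Xᵐ = X ^ₚ (n ∸ length S ∸ 2 ℕ.* i)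

    signProduct≈ : ∀ S H → signProduct H ≈ₚ const (sign Γ ⟨ S , H ⟩ ◃ 1)
    signProduct≈ S [] = P.refl {P.1#}
    signProduct≈ S ((a , b) ∷ H) = P.trans {signProduct ((a , b) ∷ H)} {const (σ a b ◃ 1) *ₚ const (t ◃ 1)} {const ((σ a b Sign.* t) ◃ 1)}
      (P.*-congˡ {const (σ a b ◃ 1)} {signProduct H} {const (t ◃ 1)} (signProduct≈ S H))
      (product (σ a b) t)
      where
      t = sign Γ ⟨ S , H ⟩
      product : ∀ s t → const (s ◃ 1) *ₚ const (t ◃ 1) ≈ₚ const ((s Sign.* t) ◃ 1)
      product Sign.+ Sign.+ = λ { zero → ≡.refl ; (suc k) → ≡.refl }
      product Sign.+ Sign.- = λ { zero → ≡.refl ; (suc k) → ≡.refl }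
      product Sign.- Sign.+ = λ { zero → ≡.refl ; (suc k) → ≡.refl }
      product Sign.- Sign.- = λ { zero → ≡.refl ; (suc k) → ≡.refl }

    subgraphTerm : VEGraph n → Poly
    subgraphTerm C = const ((ℤ.- (+ 2)) ℤ.^ #components C) *ₚ M[G-_] Γ C

    twoRegularTerm≈ : ∀ {S} H → Unique S → const (sign Γ ⟨ S , H ⟩ ◃ 1) *ₚ subgraphTerm ⟨ S , H ⟩ ≈ₚ twoRegularTerm loopless S H
    twoRegularTerm≈ {S} H uniq = begin
      signᶜ *ₚ (const ((ℤ.- (+ 2)) ℤ.^ p) *ₚ M)
        ≈⟨ P.*-assoc signᶜ (const ((ℤ.- (+ 2)) ℤ.^ p)) M ⟨
      signᶜ *ₚ const ((ℤ.- (+ 2)) ℤ.^ p) *ₚ M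
        ≈⟨ P.*-cong {signᶜ *ₚ const ((ℤ.- (+ 2)) ℤ.^ p)} {signProduct H *ₚ const (ℤ.- (+ 2)) ^ᵖ p} {M} {matchingSum loopless S}
             (P.*-cong {signᶜ} {signProduct H} {const ((ℤ.- (+ 2)) ℤ.^ p)} {const (ℤ.- (+ 2)) ^ᵖ p}
               (P.sym {signProduct H} {signᶜ} (signProduct≈ S H)) (const--2^ p))
             (matchingPoly≈ uniq) ⟩
      twoRegularTerm loopless S H ∎
      where
      signᶜ = const (sign Γ ⟨ S , H ⟩ ◃ 1)
      p = #components ⟨ S , H ⟩
      M = M[G-_] Γ ⟨ S , H ⟩

    reflect-X : reflect X ≈ₚ P.- X
    reflect-X zero = ≡.refl
    reflect-X (suc zero) = ≡.refl
    reflect-X (suc (suc k)) = ≡.refl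

    reflect-weightσ : ∀ e → reflect (weightσ e) ≈ₚ weightσ e
    reflect-weightσ e zero = ≡.refl
    reflect-weightσ e (suc k) = ≡.refl

    open OddEvenParts P X weightσ weightσ² loopless reflectHomomorphism reflect-X reflect-weightσ

    positive negative : Poly
    positive = sumᴸ subgraphTerm (𝓗₁⁺ Γ)
    negative = sumᴸ subgraphTerm (𝓗₁⁻ Γ)

    private
      signedTerm : VEGraph n → Poly
      signedTerm C = const (sign Γ C ◃ 1) *ₚ subgraphTerm C

      when-cong₂ : ∀ {A B D F : Set} (A? : Dec A) (B? : Dec B) (D? : Dec D) (F? : Dec F) {y z} →
        (A → B → D × F) → (D → F → A × B) → y ≈ₚ z → when A? (when B? y) ≈ₚ when D? (when F? z)
      when-cong₂ (yes a) (yes b) D? F? to _ y≈z rewrite dec-true D? (proj₁ (to a b)) | dec-true F? (proj₂ (to a b)) = y≈z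
      when-cong₂ A? B? (yes d) (yes f) _ from y≈z rewrite dec-true A? (proj₁ (from d f)) | dec-true B? (proj₂ (from d f)) = y≈z
      when-cong₂ (no _) _ (no _) _ _ _ _ = P.refl {[]}
      when-cong₂ (no _) _ (yes _) (no _) _ _ _ = P.refl {[]}
      when-cong₂ (yes _) (no _) (no _) _ _ _ _ = P.refl {[]}
      when-cong₂ (yes _) (no _) (yes _) (no _) _ _ _ = P.refl {[]}

      signedSum : sumᴸ signedTerm (𝓗₁ Γ) ≈ₚ oddPart
      signedSum = begin
        sumᴸ signedTerm (𝓗₁ Γ)
          ≈⟨ sumᴸ-filter (λ C → twoRegular? C ×-dec ¬? (2 ∣? order C)) signedTerm (subgraphs (toVE graph)) ⟩
        sumᴸ (λ C → when (twoRegular? C ×-dec ¬? (2 ∣? order C)) (signedTerm C)) (subgraphs (toVE graph))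
          ≈⟨ sumᴸ-filter isGraph? (λ C → when (twoRegular? C ×-dec ¬? (2 ∣? order C)) (signedTerm C)) (cartesianProductWith ⟨_,_⟩ Vs Es) ⟩
        sumᴸ (λ C → when (isGraph? C) (when (twoRegular? C ×-dec ¬? (2 ∣? order C)) (signedTerm C))) (cartesianProductWith ⟨_,_⟩ Vs Es)
          ≈⟨ sumᴸ-cartesianProductWith (λ C → when (isGraph? C) (when (twoRegular? C ×-dec ¬? (2 ∣? order C)) (signedTerm C))) ⟨_,_⟩ Vs Es ⟩
        sumᴸ (λ S → sumᴸ (before S) Es) Vs
          ≈⟨ sumᴸ-cong-∈ {P = Unique} {f = λ S → sumᴸ (before S) Es} {g = λ S → sumᴸ (after S) Es} Vs (All.tabulate (sublists-unique (Unique.allFin⁺ n)))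
               (λ {S} uniq → sumᴸ-cong {f = before S} {g = after S} Es λ H → regroup uniq H) ⟩
        oddPart ∎
        where
        before after : List (Fin n) → List (Fin n × Fin n) → Poly
        before S H = when (isGraph? ⟨ S , H ⟩) (when (twoRegular? ⟨ S , H ⟩ ×-dec ¬? (2 ∣? length S)) (signedTerm ⟨ S , H ⟩))
        after S H = when (¬? (2 ∣? length S)) (when (allDegrees2? S H) (twoRegularTerm loopless S H))
        regroup : ∀ {S} → Unique S → ∀ H → before S H ≈ₚ after S H
        regroup {S} uniq H = when-cong₂ (isGraph? ⟨ S , H ⟩) (twoRegular? ⟨ S , H ⟩ ×-dec ¬? (2 ∣? length S)) (¬? (2 ∣? length S)) (allDegrees2? S H)
          {signedTerm ⟨ S , H ⟩} {twoRegularTerm loopless S H}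
          (λ graph ((_ , degrees) , odd) → odd , graph , degrees)
          -- `TwoRegular` asks for a nonempty vertex set, which follows here because 0 is even.
          (λ odd (graph , degrees) → graph , (ℕ.n≢0⇒n>0 (λ S≡0 → odd (divides 0 S≡0)) , degrees) , odd)
          (twoRegularTerm≈ H uniq)

    -- Each subgraph of sign + appears in the signed sum with its own term. For sign - its term
    -- occurs negatively in the signed sum and is cancelled by `negative`.
    positive≈ : positive ≈ₚ oddPart +ₚ negative
    positive≈ = begin
      positive
        ≈⟨ sumᴸ-filter (λ H → sign Γ H Sign.≟ Sign.+) subgraphTerm (𝓗₁ Γ) ⟩
      sumᴸ (λ C → when (sign Γ C Sign.≟ Sign.+) (subgraphTerm C)) (𝓗₁ Γ)
        ≈⟨ sumᴸ-cong {f = λ C → when (sign Γ C Sign.≟ Sign.+) (subgraphTerm C)} {g = λ C → signedTerm C +ₚ negativeTerm C} (𝓗₁ Γ) (λ C → split (sign Γ C) (subgraphTerm C)) ⟩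
      sumᴸ (λ C → signedTerm C +ₚ negativeTerm C) (𝓗₁ Γ)
        ≈⟨ sumᴸ-+ signedTerm negativeTerm (𝓗₁ Γ) ⟩
      sumᴸ signedTerm (𝓗₁ Γ) +ₚ sumᴸ negativeTerm (𝓗₁ Γ)
        ≈⟨ P.+-cong {sumᴸ signedTerm (𝓗₁ Γ)} {oddPart} {sumᴸ negativeTerm (𝓗₁ Γ)} {negative}
             signedSum (P.sym {negative} {sumᴸ negativeTerm (𝓗₁ Γ)} (sumᴸ-filter (λ H → sign Γ H Sign.≟ Sign.-) subgraphTerm (𝓗₁ Γ))) ⟩
      oddPart +ₚ negative ∎
      where
      negativeTerm : VEGraph n → Poly
      negativeTerm C = when (sign Γ C Sign.≟ Sign.-) (subgraphTerm C)
      split : ∀ t p → when (t Sign.≟ Sign.+) p ≈ₚ const (t ◃ 1) *ₚ p +ₚ when (t Sign.≟ Sign.-) p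
      split Sign.+ p = P.sym {P.1# *ₚ p +ₚ []} {p} (P.trans {P.1# *ₚ p +ₚ []} {P.1# *ₚ p} {p} (P.+-identityʳ (P.1# *ₚ p)) (P.*-identityˡ p))
      split Sign.- p = P.sym {(P.- P.1#) *ₚ p +ₚ p} {[]} (P.trans {(P.- P.1#) *ₚ p +ₚ p} {P.- p +ₚ p} {[]}
        (P.+-congʳ {p} {(P.- P.1#) *ₚ p} {P.- p} (RingProperties.-1*x≈-x P.ring p)) (P.-‿inverseˡ p))

    private
      φ : Poly
      φ = charPoly (adjacencyMatrix Γ)

      det-base : Poly
      det-base = DeterminantTheory.det P (baseMatrix E)

      coeff-reflected : ∀ k → coeff (reflect det-base) k ≡ -1ℤ ^ᶻ k ℤ.* coeff φ k
      coeff-reflected k = ≡.trans (coeff-reflect det-base k) (≡.cong (-1ℤ ^ᶻ k ℤ.*_) (charPoly≈ k))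

      coeff-signed : ∀ k → coeff ((P.- P.1#) ^ᵖ n *ₚ det-base) k ≡ -1ℤ ^ᶻ n ℤ.* coeff φ k
      coeff-signed k = ≡.trans (coeff-sign* n det-base k) (≡.cong (-1ℤ ^ᶻ n ℤ.*_) (charPoly≈ k))

      -- The double of any other integer computes to a nonzero constructor form. This is where 2 is
      -- cancelled, one coefficient at a time.
      i+i≡0⇒i≡0 : ∀ i → i ℤ.+ i ≡ 0ℤ → i ≡ 0ℤ
      i+i≡0⇒i≡0 (+ zero) _ = ≡.refl

    balanced⇒alternates : positive ≈ₚ negative → Alternates n φ
    balanced⇒alternates p≈n k = ≡.trans (≡.sym (-1^k-involutive n (coeff φ k)))
      (≡.cong (-1ℤ ^ᶻ n ℤ.*_) (≡.trans (≡.sym (coeff-signed k)) (≡.trans (≡.sym (oddPart≈0⇒symmetric odd≈0 k)) (coeff-reflected k))))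
      where
      odd≈0 : oddPart ≈ₚ []
      odd≈0 k = RingProperties.+-identityˡ-unique (CommutativeRing.ring ℤ-ring) (coeff oddPart k) (coeff negative k)
        (≡.trans (≡.sym (coeff-+ oddPart negative k)) (≡.trans (≡.sym (positive≈ k)) (p≈n k)))

    alternates⇒balanced : Alternates n φ → positive ≈ₚ negative
    alternates⇒balanced alt k = ≡.trans (positive≈ k) (≡.trans (coeff-+ oddPart negative k)
      (≡.trans (≡.cong (ℤ._+ coeff negative k) odd≡0) (ℤ.+-identityˡ (coeff negative k))))
      where
      symmetric : reflect det-base ≈ₚ (P.- P.1#) ^ᵖ n *ₚ det-base
      symmetric k = ≡.trans (coeff-reflected k) (≡.trans (≡.sym (-1^k-involutive n (-1ℤ ^ᶻ k ℤ.* coeff φ k)))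
        (≡.trans (≡.cong (-1ℤ ^ᶻ n ℤ.*_) (≡.sym (alt k))) (≡.sym (coeff-signed k))))
      odd≡0 : coeff oddPart k ≡ 0ℤ
      odd≡0 = i+i≡0⇒i≡0 (coeff oddPart k) (≡.trans (≡.sym (coeff-+ oddPart oddPart k)) (symmetric⇒oddPart+oddPart≈0 symmetric k))

-- Passage between the integers and the field

module _ {c ℓ₁ ℓ₂} (K : AlgebraicallyClosedField₀ c ℓ₁ ℓ₂) where
  private
    module K = AlgebraicallyClosedField₀ K

  fieldRing : CommutativeRing c ℓ₁
  fieldRing = HeytingCommutativeRing.commutativeRing K.heytingCommutativeRing

  private
    module R = CommutativeRing fieldRing
    open RingProperties R.ring
    module Z = IntegerScalars fieldRing
    module K[X] = PolynomialRing fieldRing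
    module ℤ[x] = PolynomialRing ℤ-ring

  fromℤ≈ : ∀ i → K.fromℤ i R.≈ Z.⟦ i ⟧
  fromℤ≈ (+ k) = R.refl
  fromℤ≈ -[1+ k ] = R.refl

  fromℤ-homomorphism : IsRingHomomorphism (CommutativeRing.rawRing ℤ-ring) R.rawRing K.fromℤ
  fromℤ-homomorphism = mkRingHomomorphism (CommutativeRing.rawRing ℤ-ring) R.rawRing
    (λ { ≡.refl → R.refl })
    (λ i j → R.trans (fromℤ≈ (i ℤ.+ j)) (R.trans (Z.+-homo i j) (R.sym (R.+-cong (fromℤ≈ i) (fromℤ≈ j)))))
    (λ i j → R.trans (fromℤ≈ (i ℤ.* j)) (R.trans (Z.*-homo i j) (R.sym (R.*-cong (fromℤ≈ i) (fromℤ≈ j)))))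
    (λ i → R.trans (fromℤ≈ (ℤ.- i)) (R.trans (Z.neg-homo i) (R.sym (R.-‿cong (fromℤ≈ i)))))
    R.refl Z.1-homo

  private
    module f = IsRingHomomorphism fromℤ-homomorphism

  -- Subtraction reduces the claim to the kernel, where a nonzero integer would contradict
  -- characteristic zero. This brings the identity of coefficients back from the field to ℤ.
  fromℤ-injective : ∀ {i j} → K.fromℤ i R.≈ K.fromℤ j → i ≡ j
  fromℤ-injective {i} {j} eq = ℤ.i-j≡0⇒i≡j i j (kernel (i ℤ.- j) (R.trans (f.+-homo i (ℤ.- j))
    (R.trans (R.+-cong eq (f.-‿homo j)) (R.-‿inverseʳ (K.fromℤ j)))))
    where
    kernel : ∀ i → K.fromℤ i R.≈ R.0# → i ≡ 0ℤ
    kernel (+ zero) _ = ≡.refl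
    kernel (+ suc k) eq = contradiction eq (K.characteristic-zero k)
    kernel -[1+ k ] eq = contradiction (R.trans (R.sym (-‿involutive _)) (R.trans (R.-‿cong eq) -0#≈0#)) (K.characteristic-zero k)

  zero-or-unit : ∀ x → x R.≈ R.0# ⊎ ∃[ y ] y R.* x R.≈ R.1#
  zero-or-unit x with x K.#? R.0#
  ... | no ¬x#0 = inj₁ (proj₁ (K.tight x R.0#) ¬x#0)
  ... | yes x#0 with K.#⇒invertible x#0
  -- Apartness from `0#` provides an inverse of `x - 0#`, not of `x` itself.
  ...   | y , y[x-0]≈1 , _ = inj₂ (y , R.trans (R.*-congˡ (R.sym (R.trans (R.+-congˡ -0#≈0#) (R.+-identityʳ x)))) y[x-0]≈1)

  1≉0 : ¬ R.1# R.≈ R.0#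
  1≉0 1≈0 = K.characteristic-zero 0 (R.trans (R.+-identityʳ R.1#) 1≈0)

  module _ {n} (A : Fin n → Fin n → ℤ) where
    private
      Aᴷ : Fin n → Fin n → R.Carrier
      Aᴷ u v = K.fromℤ (A u v)

      open CharacteristicPolynomial ℤ-ring using () renaming (charPoly to charPolyℤ; charMatrix to charMatrixℤ; Alternates to Alternatesℤ)
      open CharacteristicPolynomial fieldRing using (charPoly; charMatrix; Alternates)
      open SemiringDefinitions (Semiring.rawSemiring (CommutativeRing.semiring ℤ-ring)) using () renaming (_^_ to _^ᶻ_)
      open SemiringDefinitions (Semiring.rawSemiring R.semiring) using () renaming (_^_ to _^ᴿ_)
      open DeterminantTheory K[X].polyRing using () renaming (det to detᴷ; det-cong to detᴷ-cong)

    coeff-charPoly : ∀ k → K[X].coeff (charPoly Aᴷ) k R.≈ K.fromℤ (ℤ[x].coeff (charPolyℤ A) k)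
    coeff-charPoly k = R.trans (R.sym (mapped k)) (coeff-map ℤ-ring fieldRing fromℤ-homomorphism (charPolyℤ A) k)
      where
      entry : ∀ i j → map K.fromℤ (charMatrixℤ A i j) K[X].≈ₚ charMatrix Aᴷ i j
      entry i j with does (i Fin.≟ j)
      ... | true = λ where
        zero → R.trans (f.+-homo 0ℤ (ℤ.- A i j)) (R.+-congˡ (f.-‿homo (A i j)))
        (suc zero) → Z.1-homo
        (suc (suc k)) → R.refl
      ... | false = λ where
        zero → f.-‿homo (A i j)
        (suc k) → R.refl

      mapped : map K.fromℤ (charPolyℤ A) K[X].≈ₚ charPoly Aᴷ
      mapped k = R.trans
        (det-homo ℤ[x].polyRing K[X].polyRing (mapHomomorphism ℤ-ring fieldRing fromℤ-homomorphism) (charMatrixℤ A) k)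
        (detᴷ-cong {M = λ i j → map K.fromℤ (charMatrixℤ A i j)} {N = charMatrix Aᴷ} entry k)

    private
      fromℤ-signs : ∀ k z → K.fromℤ (-1ℤ ^ᶻ n ℤ.* (-1ℤ ^ᶻ k ℤ.* z)) R.≈ (R.- R.1#) ^ᴿ n R.* ((R.- R.1#) ^ᴿ k R.* K.fromℤ z)
      fromℤ-signs k z = R.trans (f.*-homo (-1ℤ ^ᶻ n) (-1ℤ ^ᶻ k ℤ.* z)) (R.*-cong (sign-power n)
        (R.trans (f.*-homo (-1ℤ ^ᶻ k) z) (R.*-congʳ (sign-power k))))
        where
        sign-power : ∀ k → K.fromℤ (-1ℤ ^ᶻ k) R.≈ (R.- R.1#) ^ᴿ k
        sign-power zero = Z.1-homo
        sign-power (suc k) = R.trans (f.*-homo -1ℤ (-1ℤ ^ᶻ k)) (R.*-cong (R.-‿cong Z.1-homo) (sign-power k))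

    alternates⇒alternatesᴷ : Alternatesℤ n (charPolyℤ A) → Alternates n (charPoly Aᴷ)
    alternates⇒alternatesᴷ alt k = R.trans (coeff-charPoly k) (R.trans (f.⟦⟧-cong (alt k))
      (R.trans (fromℤ-signs k _) (R.*-congˡ (R.*-congˡ (R.sym (coeff-charPoly k))))))

    alternatesᴷ⇒alternates : Alternates n (charPoly Aᴷ) → Alternatesℤ n (charPolyℤ A)
    alternatesᴷ⇒alternates alt k = fromℤ-injective (R.trans (R.sym (coeff-charPoly k)) (R.trans (alt k)
      (R.trans (R.*-congˡ (R.*-congˡ (coeff-charPoly k))) (R.sym (fromℤ-signs k _)))))

open import Data.Integer.Base using (-_; _^_)
open ℤ[X] using (_≈ₚ_; _*ₚ_; const; sumₚ)

theorem2p4 : ∀ {c ℓ₁ ℓ₂} (K : AlgebraicallyClosedField₀ c ℓ₁ ℓ₂) {n : ℕ} (Γ : SignedGraph n) →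
    HasSymmetricSpectrum K Γ ⇔
    (sumₚ (λ C → const ((- (+ 2)) ^ #components C) *ₚ M[G-_] Γ C) (𝓗₁⁺ Γ)
    ≈ₚ sumₚ (λ C → const ((- (+ 2)) ^ #components C) *ₚ M[G-_] Γ C) (𝓗₁⁻ Γ))
theorem2p4 K {n} Γ = mk⇔
  (λ symm → Characteristic.alternates⇒balanced Γ (alternatesᴷ⇒alternates K (adjacencyMatrix Γ)
    (symmetricSpectrum⇒alternates Aᴷ (AlgebraicallyClosedField₀.algebraically-closed K) symm)))
  (λ balanced → alternates⇒symmetricSpectrum Aᴷ (alternates⇒alternatesᴷ K (adjacencyMatrix Γ)
    (Characteristic.balanced⇒alternates Γ balanced)))
  where
  open FieldSpectrum (fieldRing K) (zero-or-unit K) (1≉0 K)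
  Aᴷ = λ u v → AlgebraicallyClosedField₀.fromℤ K (adjacencyMatrix Γ u v)
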